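{- Let $d,e>1$ and $w\ge 0$ be integers. The number of $d$-balanced partitions in a block (any block) of $e$-weight $w$ is $$\binom{w+\left\lfloor\frac{e-1}{d}\right\rfloor}{w}.$$
   Context: A partition $\lambda=(\lambda_1\ge\lambda_2\ge\dots\ge\lambda_\ell>0)$ has Young diagram $[\lambda]=\{(r,c):1\le r\le \ell,\ 1\le c\le\lambda_r\}$ and size $|\lambda|=\sum\lambda_j$; $\lambda'$ denotes the conjugate partition. For $(r,c)\in[\lambda]$ the arm length of the hook at $(r,c)$ is $a_{rc}(\lambda)=\lambda_r-c$ and its hook length is $h_{rc}(\lambda)=a_{rc}(\lambda)+(\lambda'_c-r)+1$. The partition $\lambda$ is $d$-balanced (with respect to $e$) if $d\mid a_{rc}(\lambda)$ for every node $(r,c)\in[\lambda]$ with $e\mid h_{rc}(\lambda)$. The $\beta$-set of $\lambda$ is $B_0(\lambda)=\{\lambda_j-j: j\ge 1\}$ (with $\lambda_j=0$ for $j>\ell$). The $e$-core of $\lambda$ is the partition whose $\beta$-set is obtained from $B_0(\lambda)$ by repeatedly replacing an element $b$ by $b-e$ whenever $b-e$ is not in the set, until this is no longer possible (equivalently, by removing rim hooks of length $e$ until none remain). The $e$-weight of $\lambda$ is $(|\lambda|-|\gamma|)/e$, where $\gamma$ is the $e$-core of $\lambda$. A block is the set of all partitions with a given $e$-core $\gamma$ (a partition equal to its own $e$-core) and a given $e$-weight $w\geq 0$. -}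

module Defs where

open import Data.Integer.Base as ℤ using (ℤ; +_)
open import Data.List.Base using (List; []; _∷_; length; sum; filter)
open import Data.List.Membership.Propositional using () renaming (_∈_ to _∈ˡ_)
open import Data.List.Relation.Unary.All using (All)
open import Data.List.Relation.Unary.Linked using (Linked)
open import Data.List.Relation.Unary.Unique.Propositional using (Unique)
import Data.List.Relation.Unary.All as All
import Data.List.Relation.Unary.Linked as Linked
open import Data.Nat.Base using (ℕ; zero; suc; _+_; _*_; _∸_; _≤_; _<_; _≥_)
open import Data.Nat.Divisibility using (_∣_)
open import Data.Nat.Properties using (_≤?_; ≤-irrelevant)
open import Data.Product.Base using (Σ; ∃; _×_; _,_)
open import Function.Bundles using (_⇔_)
open import Level using (Level; 0ℓ)
open import Relation.Binary.Construct.Closure.ReflexiveTransitive using (Star)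
open import Relation.Binary.Core using (Rel)
open import Relation.Binary.PropositionalEquality.Core using (_≡_; refl; cong₂)
open import Relation.Binary.Rewriting using (IsNormalForm)
open import Relation.Unary using (Pred; _∈_; _∉_; _∪_; _∖_; ｛_｝; _≐_)

record Partition : Set where
  constructor mkPartition
  field
    parts    : List ℕ
    sorted   : Linked _≥_ parts
    positive : All (0 <_) parts

open Partition public

-- The proof fields carry no information, so counting partitions up to _≡_ is
-- counting lists of parts.
parts-injective : ∀ {p q} → parts p ≡ parts q → p ≡ q
parts-injective {mkPartition xs s t} {mkPartition .xs s′ t′} refl =
  cong₂ (mkPartition xs) (Linked.irrelevant ≤-irrelevant s s′)
                         (All.irrelevant ≤-irrelevant t t′)

size : Partition → ℕ
size p = sum (parts p)

-- The entry at a 0-based position, and 0 past the end of the list.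
entry : List ℕ → ℕ → ℕ
entry []       _       = 0
entry (x ∷ _)  zero    = x
entry (_ ∷ xs) (suc i) = entry xs i

-- Rows and columns are numbered from 1; the value of row at 0 is junk and is
-- never used.
row : Partition → ℕ → ℕ
row p r = entry (parts p) (r ∸ 1)

-- The c-th part of the conjugate partition: the number of rows of length ≥ c.
col : Partition → ℕ → ℕ
col p c = length (filter (c ≤?_) (parts p))

Node : Partition → ℕ → ℕ → Set
Node p r c = (1 ≤ r × r ≤ length (parts p)) × (1 ≤ c × c ≤ row p r)

-- On nodes of the diagram neither of the subtractions below truncates.
arm : Partition → ℕ → ℕ → ℕ
arm p r c = row p r ∸ c

hook : Partition → ℕ → ℕ → ℕ
hook p r c = arm p r c + (col p c ∸ r) + 1

Balanced : (d e : ℕ) → Partition → Set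
Balanced d e p = ∀ r c → Node p r c → e ∣ hook p r c → d ∣ arm p r c

β-set : Partition → Pred ℤ 0ℓ
β-set p b = ∃ λ j → 1 ≤ j × b ≡ + row p j ℤ.- + j

-- One replacement of an element b of X by b - e, where b - e is not in X.
Move : ℕ → Rel (Pred ℤ 0ℓ) 0ℓ
Move e X Y = ∃ λ b → b ∈ X × (b ℤ.- + e) ∉ X
                   × Y ≐ ((X ∖ ｛ b ｝) ∪ ｛ b ℤ.- + e ｝)

-- IsCoreOf e γ p : γ is the e-core of p.
IsCoreOf : ℕ → Partition → Partition → Set₁
IsCoreOf e γ p = ∃ λ X → Star (Move e) (β-set p) X
                       × IsNormalForm (Move e) X
                       × X ≐ β-set γ

IsCore : ℕ → Partition → Set₁
IsCore e γ = IsCoreOf e γ γ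

-- The equation on sizes says that the e-weight (size p - size γ) / e is w.
Block : (e : ℕ) (γ : Partition) (w : ℕ) → Pred Partition _
Block e γ w p = IsCoreOf e γ p × size p ≡ size γ + w * e

-- P has exactly n elements: they can be listed without repetition in a list
-- of length n.
HasCardinality : ∀ {a ℓ : Level} {A : Set a} → Pred A ℓ → ℕ → Set _
HasCardinality {A = A} P n =
  Σ (List A) λ xs → Unique xs × (∀ x → (x ∈ˡ xs) ⇔ (x ∈ P)) × length xs ≡ n

{-# OPTIONS --safe #-}
module Submission where

-- Read the β-set of a partition as beads on an abacus with e runners. A hook is
-- a gap x together with a bead y > x; its length is y - x and its arm is the
-- number of gaps strictly between. Being balanced thus compares, modulo d, the
-- gap counts at positions on a common runner, and the block of a partition is
-- given by the numbers of beads on the runners (the charges) and the weight.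
--
-- The number of balanced configurations of weight w does not depend on the
-- charges. Adding a bead at the bottom rotates the runners. To exchange two
-- adjacent runners, fix the configuration except for the order of bead and gap
-- in those rows where the two runners carry exactly one bead. Balance makes the
-- gap counts of these rows, modulo d, increase at most once and then by one, as
-- soon as both orders occur; and then every possible number of beads on the
-- first runner is realised by exactly one balanced filling. If only one order
-- occurs, the opposite constant filling is the partner.
--
-- So the charges may be taken so far apart that the runners do not interact.
-- Then every row crossed adds k gaps to a hook of runner k, whence runner k
-- must have the shape (1ⁿ), with n = 0 unless d divides k. What remains is to
-- count the compositions of w indexed by the multiples of d below e.

import Algebra.Properties.CommutativeSemigroup
open import Data.Bool.Base using (Bool; true; false; not; _∧_; _∨_; _xor_; if_then_else_)
open import Data.Bool.Properties using (∧-comm; ∨-comm; xor-comm; ∧-zeroʳ)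
open import Data.Integer.Base as ℤ using (ℤ; -[1+_]; _⊖_)
import Data.Integer.Properties as ℤ
open import Data.List.Base using (List; []; _∷_; _∷ʳ_; _++_; [_]; map; length; filter; zipWith; applyUpTo; applyDownFrom)
open import Data.List.Membership.Propositional using () renaming (_∈_ to _∈ˡ_)
open import Data.List.Membership.Propositional.Properties using (∈-map⁺; ∈-map⁻; ∈-++⁺ˡ; ∈-++⁺ʳ; ∈-++⁻)
open import Data.List.Properties
  using (∷-injective; ∷ʳ-injective; ++-identityʳ; ++-assoc; map-++; map-applyUpTo; zipWith-comm; length-map; length-++;
         length-applyUpTo; length-applyDownFrom; applyUpTo-∷ʳ; filter-none; filter-accept)
open import Data.List.Relation.Unary.All as All using (All; []; _∷_)
import Data.List.Relation.Unary.All.Properties as All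
open import Data.List.Relation.Unary.AllPairs using ([]; _∷_)
open import Data.List.Relation.Unary.Any using (here; there)
open import Data.List.Relation.Unary.Linked as Linked using (Linked; []; [-]; _∷_)
open import Data.List.Relation.Unary.Linked.Properties using (Linked⇒All)
open import Data.List.Relation.Unary.Unique.Propositional using (Unique)
import Data.List.Relation.Unary.Unique.Propositional.Properties as Unique
open import Data.Nat.Base
open import Data.Nat.Combinatorics using (_C_; nCn≡1; nCk+nC[k+1]≡[n+1]C[k+1])
open import Data.Nat.Divisibility
open import Data.Nat.DivMod
open import Data.Nat.ListAction using (sum)
open import Data.Nat.ListAction.Properties using (sum-++)
open import Data.Nat.Properties
open import Data.Nat.Tactic.RingSolver using (solve-∀)
open import Data.Product.Base using (∃; ∃₂; _×_; _,_; proj₁; proj₂)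
open import Data.Sum.Base using (_⊎_; inj₁; inj₂)
open import Data.Unit.Base using (⊤; tt)
open import Function.Base using (_∘_; id; const; _on_)
open import Function.Bundles using (Inverse; Equivalence; mk⇔)
import Function.Construct.Composition as Compose
import Function.Construct.Identity as Identity
import Function.Construct.Symmetry as Symmetry
open import Level using (0ℓ)
open import Relation.Binary.Bundles using (Setoid)
open import Relation.Binary.Construct.Closure.ReflexiveTransitive using (Star; ε; _◅_)
import Relation.Binary.Construct.On as On
open import Relation.Binary.Definitions using (tri<; tri≈; tri>)
open import Relation.Binary.PropositionalEquality hiding ([_])
open import Relation.Binary.Rewriting using (IsNormalForm)
open import Relation.Nullary using (¬_; Dec; yes; no; contradiction)
open import Relation.Unary using (Pred; _∈_; _∩_; _∪_; _∖_; ｛_｝; _≐_)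
open import Relation.Unary.Properties using (≐-sym; ≐-trans)

open import Defs

open Algebra.Properties.CommutativeSemigroup +-commutativeSemigroup using (interchange; x∙yz≈y∙xz)


-- Adding a bead wraps the last runner round to the front and raises its charge by one, so the
-- number of beads is not conserved. This gives the exchanges, which only permute charges, their
-- reach: a runner sent to the back by exchanges and fetched by a rotation has gained one bead, and
-- nothing else has changed. Any two lists of charges can therefore be raised to a common one. The
-- price is that a rotation can be undone only if position 0 carries a bead. Excess energy `w`
-- cannot open a gap at the bottom of a runner with more than `w` beads; hence all charges are kept
-- at least `w`. The same bound dictates the separation: a runner of charge `c` and weight at most
-- `w` has no gap below `c - w` and no bead from `c + w` on, so charges `2w` apart suffice. An
-- explicit bijection for an exchange would have to say which filling goes where. Only existence and
-- uniqueness of a filling with given charges are shown instead, and both inverse laws follow from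
-- uniqueness. Configurations are compared pointwise, so the bijections run between setoids.

-- Bead configurations

-- true marks a bead; all positions below 0 are understood to be beads.
Beads : Set
Beads = ℕ → Bool

⟦_⟧ : Bool → ℕ
⟦ true ⟧  = 1
⟦ false ⟧ = 0

infixr 5 _◂_

_◂_ : Bool → Beads → Beads
(b ◂ r) zero    = b
(b ◂ r) (suc t) = r t

Vanishes : ℕ → Beads → Set
Vanishes n r = ∀ t → n ≤ t → r t ≡ false

count : ℕ → Beads → ℕ
count zero    r = 0
count (suc n) r = ⟦ r 0 ⟧ + count n (r ∘ suc)

-- The bead at position `j` is counted once in each of the first `j` shifts, so this is the sum of
-- the bead positions below `n`. `tri c` is its least value for `c` beads.
energy : ℕ → Beads → ℕ
energy zero    r = 0
energy (suc n) r = count n (r ∘ suc) + energy n (r ∘ suc)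

tri : ℕ → ℕ
tri zero    = 0
tri (suc n) = n + tri n

gaps : Beads → ℕ → ℕ
gaps f zero    = 0
gaps f (suc x) = gaps f x + ⟦ not (f x) ⟧

vanishes-tail : ∀ {n r} → Vanishes (suc n) r → Vanishes n (r ∘ suc)
vanishes-tail v t n≤t = v (suc t) (s≤s n≤t)

vanishes-mono : ∀ {m n r} → m ≤ n → Vanishes m r → Vanishes n r
vanishes-mono m≤n v t n≤t = v t (≤-trans m≤n n≤t)

vanishes-≗ : ∀ {n r s} → r ≗ s → Vanishes n r → Vanishes n s
vanishes-≗ eq v t n≤t = trans (sym (eq t)) (v t n≤t)

count-cong : ∀ n {r s} → (∀ t → t < n → r t ≡ s t) → count n r ≡ count n s
count-cong zero    eq = refl
count-cong (suc n) eq = cong₂ (λ b c → ⟦ b ⟧ + c) (eq 0 z<s) (count-cong n (λ t t<n → eq (suc t) (s<s t<n)))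

energy-cong : ∀ n {r s} → (∀ t → t < n → r t ≡ s t) → energy n r ≡ energy n s
energy-cong zero    eq = refl
energy-cong (suc n) eq = cong₂ _+_ (count-cong n eq′) (energy-cong n eq′)
  where eq′ = λ t t<n → eq (suc t) (s<s t<n)

count-vanish : ∀ n {r} → Vanishes 0 r → count n r ≡ 0
count-vanish zero    v = refl
count-vanish (suc n) v rewrite v 0 z≤n = count-vanish n (λ t _ → v (suc t) z≤n)

energy-vanish : ∀ n {r} → Vanishes 0 r → energy n r ≡ 0
energy-vanish zero    v = refl
energy-vanish (suc n) {r} v = cong₂ _+_ (count-vanish n v′) (energy-vanish n v′)
  where v′ : Vanishes 0 (r ∘ suc)
        v′ t _ = v (suc t) z≤n

count-extend : ∀ m k {r} → Vanishes m r → count (m + k) r ≡ count m r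
count-extend zero    k v = count-vanish k v
count-extend (suc m) k {r} v = cong (⟦ r 0 ⟧ +_) (count-extend m k (vanishes-tail v))

energy-extend : ∀ m k {r} → Vanishes m r → energy (m + k) r ≡ energy m r
energy-extend zero    k v = energy-vanish k v
energy-extend (suc m) k v =
  cong₂ _+_ (count-extend m k (vanishes-tail v)) (energy-extend m k (vanishes-tail v))

count-unique : ∀ {m n r s} → Vanishes m r → Vanishes n s → r ≗ s → count m r ≡ count n s
count-unique {m} {n} {r} {s} v v′ eq = begin
  count m r        ≡⟨ count-extend m n v ⟨
  count (m + n) r  ≡⟨ count-cong (m + n) (λ t _ → eq t) ⟩
  count (m + n) s  ≡⟨ cong (λ k → count k s) (+-comm m n) ⟩
  count (n + m) s  ≡⟨ count-extend n m v′ ⟩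
  count n s        ∎
  where open ≡-Reasoning

energy-unique : ∀ {m n r s} → Vanishes m r → Vanishes n s → r ≗ s → energy m r ≡ energy n s
energy-unique {m} {n} {r} {s} v v′ eq = begin
  energy m r        ≡⟨ energy-extend m n v ⟨
  energy (m + n) r  ≡⟨ energy-cong (m + n) (λ t _ → eq t) ⟩
  energy (m + n) s  ≡⟨ cong (λ k → energy k s) (+-comm m n) ⟩
  energy (n + m) s  ≡⟨ energy-extend n m v′ ⟩
  energy n s        ∎
  where open ≡-Reasoning

count-snoc : ∀ n r → count (suc n) r ≡ count n r + ⟦ r n ⟧
count-snoc zero    r = +-comm ⟦ r 0 ⟧ 0
count-snoc (suc n) r = trans (cong (⟦ r 0 ⟧ +_) (count-snoc n (r ∘ suc))) (sym (+-assoc ⟦ r 0 ⟧ _ _))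

tri-count≤energy : ∀ n r → tri (count n r) ≤ energy n r
tri-count≤energy zero    r = z≤n
tri-count≤energy (suc n) r with r 0
... | true  = +-monoʳ-≤ (count n (r ∘ suc)) (tri-count≤energy n (r ∘ suc))
... | false = ≤-trans (tri-count≤energy n (r ∘ suc)) (m≤n+m _ _)

count+gaps : ∀ x f → count x f + gaps f x ≡ x
count+gaps zero    f = refl
count+gaps (suc x) f = begin
  count (suc x) f + (gaps f x + ⟦ not (f x) ⟧)    ≡⟨ cong (_+ (gaps f x + ⟦ not (f x) ⟧)) (count-snoc x f) ⟩
  (count x f + ⟦ f x ⟧) + (gaps f x + ⟦ not (f x) ⟧)
    ≡⟨ interchange (count x f) ⟦ f x ⟧ (gaps f x) ⟦ not (f x) ⟧ ⟩
  (count x f + gaps f x) + (⟦ f x ⟧ + ⟦ not (f x) ⟧) ≡⟨ cong₂ _+_ (count+gaps x f) (one (f x)) ⟩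
  x + 1                                           ≡⟨ +-comm x 1 ⟩
  suc x                                           ∎
  where
  open ≡-Reasoning
  one : ∀ b → ⟦ b ⟧ + ⟦ not b ⟧ ≡ 1
  one true  = refl
  one false = refl

gaps-cong : ∀ x {f g} → (∀ t → t < x → f t ≡ g t) → gaps f x ≡ gaps g x
gaps-cong zero    eq = refl
gaps-cong (suc x) eq = cong₂ (λ c b → c + ⟦ not b ⟧) (gaps-cong x (λ t t<x → eq t (m<n⇒m<1+n t<x))) (eq x ≤-refl)

gaps-tail : ∀ f x → gaps f (suc x) ≡ ⟦ not (f 0) ⟧ + gaps (f ∘ suc) x
gaps-tail f zero    = sym (+-identityʳ _)
gaps-tail f (suc x) = trans (cong (_+ ⟦ not (f (suc x)) ⟧) (gaps-tail f x)) (+-assoc ⟦ not (f 0) ⟧ _ _)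

gaps-mono : ∀ f {x y} → x ≤ y → gaps f x ≤ gaps f y
gaps-mono f {x} {zero}  z≤n = z≤n
gaps-mono f {x} {suc y} x≤1+y with m≤n⇒m<n∨m≡n x≤1+y
... | inj₁ (s≤s x≤y) = ≤-trans (gaps-mono f x≤y) (m≤m+n _ _)
... | inj₂ refl      = ≤-refl

-- A bead moves from `y + δ` down to `y`. The distance is a parameter because the same slide is seen
-- with `δ = 1` inside its runner and with `δ = e` on the whole line.
record Slide (y δ : ℕ) (r s : Beads) : Set where
  field
    gap-before  : r y ≡ false
    bead-before : r (y + δ) ≡ true
    bead-after  : s y ≡ true
    gap-after   : s (y + δ) ≡ false
    elsewhere   : ∀ x → x ≢ y → x ≢ y + δ → r x ≡ s x

remove-bead : ∀ n j {r s} → j < n → r j ≡ true → s j ≡ false → (∀ x → x ≢ j → r x ≡ s x) →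
  count n r ≡ suc (count n s) × energy n r ≡ j + energy n s
remove-bead (suc n) zero {r} {s} _ rj sj eq rewrite rj | sj =
  cong suc (count-cong n eq′) , cong₂ _+_ (count-cong n eq′) (energy-cong n eq′)
  where eq′ = λ t _ → eq (suc t) λ ()
remove-bead (suc n) (suc j) {r} {s} (s≤s j<n) rj sj eq
  with remove-bead n j {r ∘ suc} {s ∘ suc} j<n rj sj (λ x x≢j → eq (suc x) (x≢j ∘ suc-injective))
... | c , e rewrite eq 0 (λ ()) =
  trans (cong (⟦ s 0 ⟧ +_) c) (+-suc _ _) ,
  trans (cong₂ _+_ c e) (lemma (count n (s ∘ suc)) j (energy n (s ∘ suc)))
  where
  lemma : ∀ a b c → suc a + (b + c) ≡ suc b + (a + c)
  lemma = solve-∀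

slide-invariants : ∀ n y δ {r s} → y + δ < n → Slide y δ r s →
  count n r ≡ count n s × energy n r ≡ δ + energy n s
slide-invariants (suc n) zero zero _ σ = contradiction (trans (sym gap-before) bead-before) λ ()
  where open Slide σ
slide-invariants (suc n) zero (suc δ) {r} {s} (s≤s δ<n) σ
  with remove-bead n δ {r ∘ suc} {s ∘ suc} δ<n (Slide.bead-before σ) (Slide.gap-after σ)
         (λ x x≢δ → Slide.elsewhere σ (suc x) (λ ()) (x≢δ ∘ suc-injective))
... | c , e rewrite Slide.gap-before σ | Slide.bead-after σ =
  c , trans (cong₂ _+_ c e) (lemma (count n (s ∘ suc)) δ (energy n (s ∘ suc)))
  where
  lemma : ∀ a b c → suc a + (b + c) ≡ suc b + (a + c)
  lemma = solve-∀
slide-invariants (suc n) (suc y) δ {r} {s} (s≤s lt) σ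
  with slide-invariants n y δ {r ∘ suc} {s ∘ suc} lt record
         { gap-before = gap-before ; bead-before = bead-before
         ; bead-after = bead-after ; gap-after = gap-after
         ; elsewhere = λ x a b → elsewhere (suc x) (a ∘ suc-injective) (b ∘ suc-injective) }
  where open Slide σ
... | c , e rewrite Slide.elsewhere σ 0 (λ ()) (λ ()) =
  cong (⟦ s 0 ⟧ +_) c ,
  trans (cong₂ _+_ c e) (x∙yz≈y∙xz (count n (s ∘ suc)) δ (energy n (s ∘ suc)))

flat : ℕ → Beads
flat c t = t <ᵇ c

<ᵇ-true : ∀ {m n} → m < n → (m <ᵇ n) ≡ true
<ᵇ-true {zero}  {suc n} _         = refl
<ᵇ-true {suc m} {suc n} (s≤s m<n) = <ᵇ-true m<n

<ᵇ-false : ∀ {m n} → n ≤ m → (m <ᵇ n) ≡ false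
<ᵇ-false {zero}  {zero}  _         = refl
<ᵇ-false {suc m} {zero}  _         = refl
<ᵇ-false {suc m} {suc n} (s≤s n≤m) = <ᵇ-false n≤m

<ᵇ-true⁻¹ : ∀ {m n} → (m <ᵇ n) ≡ true → m < n
<ᵇ-true⁻¹ {zero}  {suc n} _  = z<s
<ᵇ-true⁻¹ {suc m} {suc n} eq = s<s (<ᵇ-true⁻¹ eq)

<ᵇ-false⁻¹ : ∀ {m n} → (m <ᵇ n) ≡ false → n ≤ m
<ᵇ-false⁻¹ {m} {zero}  _  = z≤n
<ᵇ-false⁻¹ {suc m} {suc n} eq = s≤s (<ᵇ-false⁻¹ eq)

flat-vanishes : ∀ c → Vanishes c (flat c)
flat-vanishes c t = <ᵇ-false

count-flat : ∀ {n} c → c ≤ n → count n (flat c) ≡ c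
count-flat {n} zero    _         = count-vanish n (λ _ _ → refl)
count-flat     (suc c) (s≤s c≤n) = cong suc (count-flat c c≤n)

energy-flat : ∀ {n} c → c ≤ n → energy n (flat c) ≡ tri c
energy-flat {n} zero    _         = energy-vanish n (λ _ _ → refl)
energy-flat     (suc c) (s≤s c≤n) = cong₂ _+_ (count-flat c c≤n) (energy-flat c c≤n)

stays-gap : ∀ {r : Beads} → (∀ t → r t ≡ false → r (suc t) ≡ false) → ∀ t → r 0 ≡ false → r t ≡ false
stays-gap step zero    r0 = r0
stays-gap step (suc t) r0 = step t (stays-gap step t r0)

flat-characterization : ∀ n {r} → Vanishes n r → (∀ t → r t ≡ false → r (suc t) ≡ false) →
  r ≗ flat (count n r)
flat-characterization zero    v step t = v t z≤n
flat-characterization (suc n) {r} v step t with r 0 in r0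
... | false = trans (stays-gap step t r0)
                (cong (t <ᵇ_) (sym (count-vanish n {r ∘ suc} λ s _ → stays-gap step (suc s) r0)))
flat-characterization (suc n) v step zero    | true = r0
flat-characterization (suc n) v step (suc t) | true =
  flat-characterization n (vanishes-tail v) (λ s → step (suc s)) t

[r+q*n]/n≡q : ∀ {n r} .{{_ : NonZero n}} q → r < n → (r + q * n) / n ≡ q
[r+q*n]/n≡q {n} {r} q r<n = trans (+-distrib-/-∣ʳ r (n∣m*n q)) (cong₂ _+_ (m<n⇒m/n≡0 r<n) (m*n/n≡m q n))

[r+q*n]%n≡r : ∀ {n r} .{{_ : NonZero n}} q → r < n → (r + q * n) % n ≡ r
[r+q*n]%n≡r {n} {r} q r<n = trans ([m+kn]%n≡m%n r q n) (m<n⇒m%n≡m r<n)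

-- Congruence modulo d

module Congruence (d : ℕ) where

  infix 4 _≋_

  -- Multiples are added on both sides, so that gap counts can be compared without truncated
  -- subtraction and without knowing which one is larger.
  _≋_ : ℕ → ℕ → Set
  a ≋ b = ∃₂ λ k l → a + k * d ≡ b + l * d

  ≋-refl : ∀ {a} → a ≋ a
  ≋-refl = 0 , 0 , refl

  ≋-reflexive : ∀ {a b} → a ≡ b → a ≋ b
  ≋-reflexive refl = ≋-refl

  ≋-sym : ∀ {a b} → a ≋ b → b ≋ a
  ≋-sym (k , l , eq) = l , k , sym eq

  ≋-trans : ∀ {a b c} → a ≋ b → b ≋ c → a ≋ c
  ≋-trans {a} {b} {c} (k , l , p) (m , n , q) = k + m , l + n , (begin
    a + (k + m) * d      ≡⟨ lemma a k m d ⟩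
    (a + k * d) + m * d  ≡⟨ cong (_+ m * d) p ⟩
    (b + l * d) + m * d  ≡⟨ swap b l m d ⟩
    (b + m * d) + l * d  ≡⟨ cong (_+ l * d) q ⟩
    (c + n * d) + l * d  ≡⟨ swap c n l d ⟩
    (c + l * d) + n * d  ≡⟨ lemma c l n d ⟨
    c + (l + n) * d      ∎)
    where
    open ≡-Reasoning
    lemma : ∀ a k m d → a + (k + m) * d ≡ (a + k * d) + m * d
    lemma = solve-∀
    swap : ∀ a k m d → (a + k * d) + m * d ≡ (a + m * d) + k * d
    swap = solve-∀

  ≋-suc : ∀ {a b} → a ≋ b → suc a ≋ suc b
  ≋-suc (k , l , p) = k , l , cong suc p

  ≋-suc⁻¹ : ∀ {a b} → suc a ≋ suc b → a ≋ b
  ≋-suc⁻¹ (k , l , p) = k , l , suc-injective p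

  -- All uses of `1 < d` come down to this: two hooks that would force gap counts differing by one
  -- to be congruent cannot coexist.
  suc-≋̸ : 1 < d → ∀ {a} → ¬ (suc a ≋ a)
  suc-≋̸ 1<d {a} (k , l , p) = <⇒≢ 1<d (sym (∣1⇒≡1 d∣1))
    where
    eq : k * d + 1 ≡ l * d
    eq = +-cancelˡ-≡ a _ _ (trans (cong (a +_) (+-comm (k * d) 1)) (trans (+-suc a (k * d)) p))
    d∣1 : d ∣ 1
    d∣1 = ∣m+n∣m⇒∣n (subst (d ∣_) (sym eq) (n∣m*n l)) (n∣m*n k)

  ∣∸⇒≋ : ∀ {a b} → a ≤ b → d ∣ b ∸ a → b ≋ a
  ∣∸⇒≋ {a} {b} a≤b (divides q eq) =
    0 , q , trans (+-identityʳ b) (trans (sym (m+[n∸m]≡n a≤b)) (cong (a +_) eq))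

  ≋⇒∣∸ : ∀ {a b} → a ≤ b → b ≋ a → d ∣ b ∸ a
  ≋⇒∣∸ {a} {b} a≤b (k , l , p) = ∣m+n∣m⇒∣n (subst (d ∣_) (sym eq) (n∣m*n l)) (n∣m*n k)
    where
    eq : k * d + (b ∸ a) ≡ l * d
    eq = +-cancelˡ-≡ a _ _ (begin
      a + (k * d + (b ∸ a))  ≡⟨ cong (a +_) (+-comm (k * d) (b ∸ a)) ⟩
      a + ((b ∸ a) + k * d)  ≡⟨ +-assoc a (b ∸ a) (k * d) ⟨
      (a + (b ∸ a)) + k * d  ≡⟨ cong (_+ k * d) (m+[n∸m]≡n a≤b) ⟩
      b + k * d              ≡⟨ p ⟩
      a + l * d              ∎)
      where open ≡-Reasoning

count-mono : ∀ n {r s} → (∀ t → r t ≡ true → s t ≡ true) → count n r ≤ count n s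
count-mono zero    imp = z≤n
count-mono (suc n) {r} {s} imp = +-mono-≤ (head (r 0) (imp 0)) (count-mono n (λ t → imp (suc t)))
  where
  head : ∀ b {c} → (b ≡ true → c ≡ true) → ⟦ b ⟧ ≤ ⟦ c ⟧
  head true  h rewrite h refl = ≤-refl
  head false h = z≤n

some-bead? : ∀ n r → Vanishes n r → (∃ λ t → r t ≡ true) ⊎ (∀ t → r t ≡ false)
some-bead? zero    r v = inj₂ (λ t → v t z≤n)
some-bead? (suc n) r v with r 0 in r0 | some-bead? n (r ∘ suc) (vanishes-tail v)
... | true  | _            = inj₁ (0 , r0)
... | false | inj₁ (t , p) = inj₁ (suc t , p)
... | false | inj₂ none    = inj₂ λ { zero → r0 ; (suc t) → none t }

-- Words of rows with exactly one bead

module Words (d : ℕ) where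
  open Congruence d

  -- A letter says on which of two adjacent runners the bead of a row lies (true:
  -- the first one), and g counts the gaps before the row. Link spells out balance
  -- for the hook of the first or second runner that joins two such rows.
  Link : Bool → Bool → ℕ → ℕ → Set
  Link false true  g h = h ≋ suc g
  Link true  false g h = h ≋ g
  Link true  true  g h = ⊤
  Link false false g h = ⊤

  Valid : Beads → (ℕ → ℕ) → Beads → Set
  Valid s g a = ∀ i j → i < j → s i ≡ true → s j ≡ true → Link (a i) (a j) (g i) (g j)

  rights lefts : ℕ → Beads → Beads → ℕ
  rights n s a = count n (λ t → s t ∧ a t)
  lefts  n s a = count n (λ t → s t ∧ not (a t))

  valid-tail : ∀ {s g a} → Valid s g a → Valid (s ∘ suc) (g ∘ suc) (a ∘ suc)
  valid-tail v i j i<j = v (suc i) (suc j) (s<s i<j)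

  valid-◂ : ∀ {s g a} b → Valid (s ∘ suc) (g ∘ suc) a →
    (∀ t → s 0 ≡ true → s (suc t) ≡ true → Link b (a t) (g 0) (g (suc t))) → Valid s g (b ◂ a)
  valid-◂ b v h zero    (suc j) _         s0 sj = h j s0 sj
  valid-◂ b v h (suc i) (suc j) (s≤s i<j) si sj = v i j i<j si sj

  link-const : ∀ b {g h} → Link b b g h
  link-const true  = tt
  link-const false = tt

  valid-const : ∀ b s g → Valid s g (const b)
  valid-const b s g i j _ _ _ = link-const b

  rights+lefts : ∀ n s a → rights n s a + lefts n s a ≡ count n s
  rights+lefts zero    s a = refl
  rights+lefts (suc n) s a = trans
    (interchange ⟦ s 0 ∧ a 0 ⟧ _ ⟦ s 0 ∧ not (a 0) ⟧ _)
    (cong₂ _+_ (head (s 0) (a 0)) (rights+lefts n (s ∘ suc) (a ∘ suc)))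
    where
    head : ∀ b c → ⟦ b ∧ c ⟧ + ⟦ b ∧ not c ⟧ ≡ ⟦ b ⟧
    head true  true  = refl
    head true  false = refl
    head false c     = refl

  -- Where a and b carry true and false, g would be congruent to both suc (g 0) and g 0.
  rights-excess : 1 < d → ∀ n {s g a b} → Valid s g a → Valid s g b →
    s 0 ≡ true → a 0 ≡ false → b 0 ≡ true → rights n (s ∘ suc) (a ∘ suc) ≤ rights n (s ∘ suc) (b ∘ suc)
  rights-excess 1<d n {s} {g} {a} {b} va vb s0 a0 b0 = count-mono n imp
    where
    imp : ∀ t → s (suc t) ∧ a (suc t) ≡ true → s (suc t) ∧ b (suc t) ≡ true
    imp t eq with s (suc t) in st | a (suc t) in at | b (suc t) in bt
    ... | true | true | true  = refl
    ... | true | true | false = contradiction (≋-trans (≋-sym g≋) g≋′) (suc-≋̸ 1<d)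
      where
      g≋ : g (suc t) ≋ suc (g 0)
      g≋ = subst₂ (λ x y → Link x y (g 0) (g (suc t))) a0 at (va 0 (suc t) z<s s0 st)
      g≋′ : g (suc t) ≋ g 0
      g≋′ = subst₂ (λ x y → Link x y (g 0) (g (suc t))) b0 bt (vb 0 (suc t) z<s s0 st)

  -- At the first single row where the words differ, the word with `true` there leads by one, and by
  -- `rights-excess` the other cannot catch up later; so the totals would differ.
  valid-unique : 1 < d → ∀ n {s g a b} → Valid s g a → Valid s g b → rights n s a ≡ rights n s b →
    ∀ t → t < n → s t ≡ true → a t ≡ b t
  valid-unique 1<d (suc n) {s} {g} {a} {b} va vb eq t t<n st with s 0 in s0 | a 0 in a0 | b 0 in b0
  valid-unique 1<d (suc n) va vb eq zero _ st | true | false | false = trans a0 (sym b0)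
  valid-unique 1<d (suc n) va vb eq zero _ st | true | true | true = trans a0 (sym b0)
  valid-unique 1<d (suc n) va vb eq zero _ st | false | _ | _ = contradiction (trans (sym s0) st) λ ()
  valid-unique 1<d (suc n) va vb eq t _ st | true | false | true =
    contradiction eq (<⇒≢ (s≤s (rights-excess 1<d n va vb s0 a0 b0)))
  valid-unique 1<d (suc n) va vb eq t _ st | true | true | false =
    contradiction (sym eq) (<⇒≢ (s≤s (rights-excess 1<d n vb va s0 b0 a0)))
  valid-unique 1<d (suc n) va vb eq (suc t) (s≤s t<n) st | false | _ | _ =
    valid-unique 1<d n (valid-tail va) (valid-tail vb) eq t t<n st
  valid-unique 1<d (suc n) va vb eq (suc t) (s≤s t<n) st | true | false | false =
    valid-unique 1<d n (valid-tail va) (valid-tail vb) eq t t<n st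
  valid-unique 1<d (suc n) va vb eq (suc t) (s≤s t<n) st | true | true | true =
    valid-unique 1<d n (valid-tail va) (valid-tail vb) (suc-injective eq) t t<n st

  -- Modulo `d`, the single rows form an initial block of gap count `h` and a final block of gap
  -- count `suc h`. A valid word in which both letters occur forces this shape, and the shape in
  -- turn admits valid words with any number of right letters. Here right means `true` and left
  -- means `false`.
  data TwoBlocks (h : ℕ) : ℕ → Beads → (ℕ → ℕ) → Set where
    skip : ∀ {n s g} → s 0 ≡ false → TwoBlocks h n (s ∘ suc) (g ∘ suc) → TwoBlocks h (suc n) s g
    low  : ∀ {n s g} → s 0 ≡ true → g 0 ≋ h → TwoBlocks h n (s ∘ suc) (g ∘ suc) → TwoBlocks h (suc n) s g
    high : ∀ {n s g} → (∀ t → s t ≡ true → g t ≋ suc h) → TwoBlocks h n s g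

  vanishing-high : ∀ {h s g} → Vanishes 0 s → TwoBlocks h 0 s g
  vanishing-high v = high λ t st → contradiction (trans (sym st) (v t z≤n)) λ ()

  -- A right letter in front is already at level `suc h`, and any left letter behind it is linked to
  -- the same level, so the low block is over.
  high-from : ∀ {h n s g a} → Valid s g a → s 0 ≡ true → a 0 ≡ true →
    (∀ t → s t ≡ true → a t ≡ true → g t ≋ suc h) → TwoBlocks h n s g
  high-from {h} {n} {s} {g} {a} v s0 a0 rs = high all
    where
    all : ∀ t → s t ≡ true → g t ≋ suc h
    all zero    st = rs 0 st a0
    all (suc t) st with a (suc t) in at
    ... | true  = rs (suc t) st at
    ... | false = ≋-trans (subst₂ (λ x y → Link x y (g 0) (g (suc t))) a0 at (v 0 (suc t) z<s s0 st))
                          (rs 0 s0 a0)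

  -- A left letter before some right letter must lie one level below it, hence at `h`. From the
  -- first right letter on, `high-from` takes over.
  blocks-of-rights : ∀ n {h s g a} → Vanishes n s → Valid s g a →
    (∀ t → s t ≡ true → a t ≡ true → g t ≋ suc h) → (∃ λ t → s t ≡ true × a t ≡ true) → TwoBlocks h n s g
  blocks-of-rights zero    vs v rs w = vanishing-high vs
  blocks-of-rights (suc n) {h} {s} {g} {a} vs v rs (t , st , at) with s 0 in s0 | a 0 in a0
  ... | true | true = high-from v s0 a0 rs
  blocks-of-rights (suc n) vs v rs (zero , st , at) | true | false = contradiction (trans (sym at) a0) λ ()
  blocks-of-rights (suc n) {h} {s} {g} {a} vs v rs (suc t , st , at) | true | false =
    low s0 (≋-suc⁻¹ (≋-trans (≋-sym link) (rs (suc t) st at)))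
      (blocks-of-rights n (vanishes-tail vs) (valid-tail v) (λ i → rs (suc i)) (t , st , at))
    where
    link : g (suc t) ≋ suc (g 0)
    link = subst₂ (λ x y → Link x y (g 0) (g (suc t))) a0 at (v 0 (suc t) z<s s0 st)
  blocks-of-rights (suc n) vs v rs (zero , st , at) | false | _ = contradiction (trans (sym st) s0) λ ()
  blocks-of-rights (suc n) vs v rs (suc t , st , at) | false | _ =
    skip s0 (blocks-of-rights n (vanishes-tail vs) (valid-tail v) (λ i → rs (suc i)) (t , st , at))

  blocks-of-both : ∀ n {h s g a} → Vanishes n s → Valid s g a →
    (∀ t → s t ≡ true → a t ≡ true → g t ≋ suc h) → (∀ t → s t ≡ true → a t ≡ false → g t ≋ h) →
    TwoBlocks h n s g
  blocks-of-both zero    vs v rs ls = vanishing-high vs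
  blocks-of-both (suc n) {h} {s} {g} {a} vs v rs ls with s 0 in s0 | a 0 in a0
  ... | true  | true  = high-from v s0 a0 rs
  ... | true  | false = low s0 (ls 0 s0 a0)
    (blocks-of-both n (vanishes-tail vs) (valid-tail v) (λ i → rs (suc i)) (λ i → ls (suc i)))
  ... | false | _     = skip s0
    (blocks-of-both n (vanishes-tail vs) (valid-tail v) (λ i → rs (suc i)) (λ i → ls (suc i)))

  -- A right letter before some left letter shares its level `h`. Once a left letter has appeared,
  -- every later right letter is linked to level `suc h`, so the levels of both letters are known.
  blocks-of-lefts : ∀ n {h s g a} → Vanishes n s → Valid s g a →
    (∀ t → s t ≡ true → a t ≡ false → g t ≋ h) → (∃ λ t → s t ≡ true × a t ≡ false) → TwoBlocks h n s g
  blocks-of-lefts zero    vs v ls w = vanishing-high vs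
  blocks-of-lefts (suc n) {h} {s} {g} {a} vs v ls (t , st , at) with s 0 in s0 | a 0 in a0
  ... | true | false = low s0 (ls 0 s0 a0)
    (blocks-of-both n (vanishes-tail vs) (valid-tail v)
      (λ i si ai → ≋-trans (subst₂ (λ x y → Link x y (g 0) (g (suc i))) a0 ai (v 0 (suc i) z<s s0 si))
                           (≋-suc (ls 0 s0 a0)))
      (λ i → ls (suc i)))
  blocks-of-lefts (suc n) vs v ls (zero , st , at) | true | true = contradiction (trans (sym a0) at) λ ()
  blocks-of-lefts (suc n) {h} {s} {g} {a} vs v ls (suc t , st , at) | true | true =
    low s0 (≋-trans (≋-sym link) (ls (suc t) st at))
      (blocks-of-lefts n (vanishes-tail vs) (valid-tail v) (λ i → ls (suc i)) (t , st , at))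
    where
    link : g (suc t) ≋ g 0
    link = subst₂ (λ x y → Link x y (g 0) (g (suc t))) a0 at (v 0 (suc t) z<s s0 st)
  blocks-of-lefts (suc n) vs v ls (zero , st , at) | false | _ = contradiction (trans (sym st) s0) λ ()
  blocks-of-lefts (suc n) vs v ls (suc t , st , at) | false | _ =
    skip s0 (blocks-of-lefts n (vanishes-tail vs) (valid-tail v) (λ i → ls (suc i)) (t , st , at))

  -- The level `h` is the gap count of the first single row. Whichever letter stands there, its
  -- links fix the levels of all occurrences of the other letter, and there is at least one.
  nonconstant-blocks : ∀ n {s g a} → Vanishes n s → Valid s g a →
    (∃ λ t → s t ≡ true × a t ≡ true) → (∃ λ t → s t ≡ true × a t ≡ false) → ∃ λ h → TwoBlocks h n s g
  nonconstant-blocks zero    vs v _ _ = 0 , vanishing-high vs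
  nonconstant-blocks (suc n) {s} {g} {a} vs v (i , si , ai) (j , sj , aj) with s 0 in s0 | a 0 in a0
  nonconstant-blocks (suc n) vs v (zero , si , ai) _ | true | false = contradiction (trans (sym ai) a0) λ ()
  nonconstant-blocks (suc n) {s} {g} vs v (suc i , si , ai) _ | true | false = g 0 , low s0 ≋-refl
    (blocks-of-rights n (vanishes-tail vs) (valid-tail v)
      (λ t st at → subst₂ (λ x y → Link x y (g 0) (g (suc t))) a0 at (v 0 (suc t) z<s s0 st)) (i , si , ai))
  nonconstant-blocks (suc n) vs v _ (zero , sj , aj) | true | true = contradiction (trans (sym a0) aj) λ ()
  nonconstant-blocks (suc n) {s} {g} vs v _ (suc j , sj , aj) | true | true = g 0 , low s0 ≋-refl
    (blocks-of-lefts n (vanishes-tail vs) (valid-tail v)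
      (λ t st at → subst₂ (λ x y → Link x y (g 0) (g (suc t))) a0 at (v 0 (suc t) z<s s0 st)) (j , sj , aj))
  nonconstant-blocks (suc n) vs v (zero , si , ai) _ | false | _ = contradiction (trans (sym si) s0) λ ()
  nonconstant-blocks (suc n) vs v _ (zero , sj , aj) | false | _ = contradiction (trans (sym sj) s0) λ ()
  nonconstant-blocks (suc n) vs v (suc i , si , ai) (suc j , sj , aj) | false | _
    with nonconstant-blocks n (vanishes-tail vs) (valid-tail v) (i , si , ai) (j , sj , aj)
  ... | h , p = h , skip s0 p

  #low #high : ∀ {h n s g} → TwoBlocks h n s g → ℕ
  #low (skip _ p)  = #low p
  #low (low _ _ p) = suc (#low p)
  #low (high _)    = 0
  #high (skip _ p)  = #high p
  #high (low _ _ p) = #high p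
  #high {n = n} {s = s} (high _) = count n s

  #low+#high : ∀ {h n s g} (p : TwoBlocks h n s g) → #low p + #high p ≡ count n s
  #low+#high (skip s0 p) rewrite s0  = #low+#high p
  #low+#high (low s0 _ p) rewrite s0 = cong suc (#low+#high p)
  #low+#high (high _)                = refl

  -- Between rows of equal gap count a right letter may precede a left one, so the `r` right letters
  -- are put first.
  word-on-constant : ∀ n k {s g} → (∀ t → s t ≡ true → g t ≋ k) → ∀ r → r ≤ count n s →
    ∃ λ a → Valid s g a × rights n s a ≡ r
  word-on-constant zero    k {s} {g} eq zero    _ = const true , valid-const true s g , refl
  word-on-constant (suc n) k {s} {g} eq r r≤ with s 0 in s0
  word-on-constant (suc n) k {s} {g} eq r r≤ | false
    with word-on-constant n k (λ t → eq (suc t)) r r≤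
  ... | a , v , c = false ◂ a , valid-◂ false v (λ t s0′ → contradiction (trans (sym s0) s0′) λ ()) ,
    c
  word-on-constant (suc n) k {s} {g} eq (suc r) (s≤s r≤) | true
    with word-on-constant n k (λ t → eq (suc t)) r r≤
  ... | a , v , c = true ◂ a , valid-◂ true v link , cong suc c
    where
    link : ∀ t → s 0 ≡ true → s (suc t) ≡ true → Link true (a t) (g 0) (g (suc t))
    link t s0 st with a t
    ... | true  = tt
    ... | false = ≋-trans (eq (suc t) st) (≋-sym (eq 0 s0))
  word-on-constant (suc n) k {s} {g} eq zero _ | true =
    const false , valid-const false s g , none n (s ∘ suc)
    where
    none : ∀ n s → rights n s (const false) ≡ 0
    none zero    s = refl
    none (suc n) s with s 0
    ... | true  = none n (s ∘ suc)
    ... | false = none n (s ∘ suc)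

  -- The low block gets left letters only, and the high block is filled as in `word-on-constant`.
  -- The step from low to high supplies the increase by one that a left letter before a right one
  -- requires.
  word-with-few-rights : ∀ {h n s g} (p : TwoBlocks h n s g) → ∀ r → r ≤ #high p →
    ∃ λ a → Valid s g a × (∀ t → s t ≡ true → a t ≡ true → g t ≋ suc h) × rights n s a ≡ r
  word-with-few-rights {h} {suc n} {s} (skip s0 p) r r≤ with word-with-few-rights p r r≤
  ... | a , v , rs , c = false ◂ a ,
    valid-◂ false v (λ t s0′ → contradiction (trans (sym s0) s0′) λ ()) ,
    (λ { (suc t) → rs t }) ,
    trans (cong (λ b → ⟦ b ∧ false ⟧ + rights n (s ∘ suc) a) s0) c
  word-with-few-rights {h} {suc n} {s} {g} (low s0 g0 p) r r≤ with word-with-few-rights p r r≤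
  ... | a , v , rs , c = false ◂ a , valid-◂ false v link ,
    (λ { (suc t) → rs t }) ,
    trans (cong (λ b → ⟦ b ∧ false ⟧ + rights n (s ∘ suc) a) s0) c
    where
    link : ∀ t → s 0 ≡ true → s (suc t) ≡ true → Link false (a t) (g 0) (g (suc t))
    link t _ st with a t in at
    ... | true  = ≋-trans (rs t st at) (≋-suc (≋-sym g0))
    ... | false = tt
  word-with-few-rights {h} {n} (high eq) r r≤ with word-on-constant n (suc h) eq r r≤
  ... | a , v , c = a , v , (λ t st _ → eq t st) , c

  -- Left letters on the low block and right letters on the high block: the extreme case of both
  -- ways of filling, and the tail of the words built next.
  separating-word : ∀ {h n s g} (p : TwoBlocks h n s g) →
    ∃ λ a → Valid s g a × (∀ t → s t ≡ true → a t ≡ true → g t ≋ suc h)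
          × (∀ t → s t ≡ true → a t ≡ false → g t ≋ h) × lefts n s a ≡ #low p
  separating-word {n = suc n} {s} (skip s0 p) with separating-word p
  ... | a , v , rs , ls , c = false ◂ a ,
    valid-◂ false v (λ t s0′ → contradiction (trans (sym s0) s0′) λ ()) ,
    (λ { (suc t) → rs t }) ,
    (λ { zero s0′ → contradiction (trans (sym s0) s0′) λ () ; (suc t) → ls t }) ,
    trans (cong (λ b → ⟦ b ∧ true ⟧ + lefts n (s ∘ suc) a) s0) c
  separating-word {h} {n = suc n} {s} {g} (low s0 g0 p) with separating-word p
  ... | a , v , rs , ls , c = false ◂ a , valid-◂ false v link ,
    (λ { (suc t) → rs t }) ,
    (λ { zero _ _ → g0 ; (suc t) → ls t }) ,
    cong₂ (λ b m → ⟦ b ∧ true ⟧ + m) s0 c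
    where
    link : ∀ t → s 0 ≡ true → s (suc t) ≡ true → Link false (a t) (g 0) (g (suc t))
    link t _ st with a t in at
    ... | true  = ≋-trans (rs t st at) (≋-suc (≋-sym g0))
    ... | false = tt
  separating-word {n = n} {s} {g} (high eq) =
    const true , valid-const true s g , (λ t st _ → eq t st) , (λ _ _ ()) , none n s
    where
    none : ∀ n s → lefts n s (const true) ≡ 0
    none zero    s = refl
    none (suc n) s with s 0
    ... | true  = none n (s ∘ suc)
    ... | false = none n (s ∘ suc)

  -- The left letters go to the last `l` rows of the low block; all other single rows get right
  -- letters.
  word-with-few-lefts : ∀ {h n s g} (p : TwoBlocks h n s g) → ∀ l → l ≤ #low p →
    ∃ λ a → Valid s g a × (∀ t → s t ≡ true → a t ≡ false → g t ≋ h) × lefts n s a ≡ l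
  word-with-few-lefts {h} {suc n} {s} (skip s0 p) l l≤ with word-with-few-lefts p l l≤
  ... | a , v , ls , c = true ◂ a ,
    valid-◂ true v (λ t s0′ → contradiction (trans (sym s0) s0′) λ ()) ,
    (λ { (suc t) → ls t }) ,
    trans (cong (λ b → ⟦ b ∧ false ⟧ + lefts n (s ∘ suc) a) s0) c
  word-with-few-lefts {h} {suc n} {s} {g} q@(low s0 g0 p) l l≤ with m≤n⇒m<n∨m≡n l≤
  ... | inj₂ refl with separating-word q
  ...   | a , v , _ , ls , c = a , v , ls , c
  word-with-few-lefts {h} {suc n} {s} {g} (low s0 g0 p) l _ | inj₁ (s≤s l≤) with word-with-few-lefts p l l≤
  ... | a , v , ls , c = true ◂ a , valid-◂ true v link ,
    (λ { (suc t) → ls t }) ,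
    trans (cong (λ b → ⟦ b ∧ false ⟧ + lefts n (s ∘ suc) a) s0) c
    where
    link : ∀ t → s 0 ≡ true → s (suc t) ≡ true → Link true (a t) (g 0) (g (suc t))
    link t _ st with a t in at
    ... | true  = tt
    ... | false = ≋-trans (ls t st at) (≋-sym g0)
  word-with-few-lefts q@(high eq) zero _ with separating-word q
  ... | a , v , _ , ls , c = a , v , ls , c

  -- A constant word is simply flipped, since constant words satisfy every link. Otherwise there are
  -- two blocks, whose sizes add up to the number of letters. So either the wanted right letters fit
  -- into the high block, or the remaining left letters fit into the low block.
  exchanged-word : ∀ n {s g a} → Vanishes n s → Valid s g a →
    ∃ λ b → Valid s g b × rights n s b ≡ lefts n s a
  exchanged-word n {s} {g} {a} vs v
    with some-bead? n (λ t → s t ∧ a t) (vanishes-∧ a) | some-bead? n (λ t → s t ∧ not (a t)) (vanishes-∧ (not ∘ a))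
    where
    vanishes-∧ : ∀ c → Vanishes n (λ t → s t ∧ c t)
    vanishes-∧ c t n≤t rewrite vs t n≤t = refl
  ... | inj₂ none | _ = not ∘ a , valid , refl
    where
    value : ∀ t → s t ≡ true → a t ≡ false
    value t st = subst (λ b → b ∧ a t ≡ false) st (none t)
    valid : Valid s g (not ∘ a)
    valid i j _ si sj rewrite value i si | value j sj = tt
  ... | inj₁ _ | inj₂ none = not ∘ a , valid , refl
    where
    value : ∀ t → s t ≡ true → not (a t) ≡ false
    value t st = subst (λ b → b ∧ not (a t) ≡ false) st (none t)
    valid : Valid s g (not ∘ a)
    valid i j _ si sj rewrite value i si | value j sj = tt
  ... | inj₁ (i , pi) | inj₁ (j , pj)
    with nonconstant-blocks n vs v (i , split (s i) pi) (j , split′ (s j) (a j) pj)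
    where
    split : ∀ x {y} → x ∧ y ≡ true → x ≡ true × y ≡ true
    split true eq = refl , eq
    split′ : ∀ x y → x ∧ not y ≡ true → x ≡ true × y ≡ false
    split′ true false eq = refl , refl
  ... | h , p with lefts n s a ≤? #high p
  ...   | yes l≤ with word-with-few-rights p (lefts n s a) l≤
  ...     | b , vb , _ , c = b , vb , c
  exchanged-word n {s} {g} {a} vs v | _ | _ | h , p | no l≰
    with word-with-few-lefts p (rights n s a) r≤
    where
    total : rights n s a + lefts n s a ≡ #low p + #high p
    total = trans (rights+lefts n s a) (sym (#low+#high p))
    r≤ : rights n s a ≤ #low p
    r≤ = +-cancelʳ-≤ (#high p) _ _
           (≤-trans (+-monoʳ-≤ (rights n s a) (<⇒≤ (≰⇒> l≰))) (≤-reflexive total))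
  ... | b , vb , _ , c = b , vb , +-cancelʳ-≡ (rights n s a) _ _ (begin
    rights n s b + rights n s a  ≡⟨ cong (rights n s b +_) c ⟨
    rights n s b + lefts n s b   ≡⟨ rights+lefts n s b ⟩
    count n s                    ≡⟨ rights+lefts n s a ⟨
    rights n s a + lefts n s a   ≡⟨ +-comm (rights n s a) _ ⟩
    lefts n s a + rights n s a   ∎)
    where open ≡-Reasoning

-- Exchanging the first two runners

applyUpTo-cong : ∀ {a} {A : Set a} {f g : ℕ → A} n → (∀ i → i < n → f i ≡ g i) → applyUpTo f n ≡ applyUpTo g n
applyUpTo-cong zero    eq = refl
applyUpTo-cong (suc n) eq = cong₂ _∷_ (eq 0 z<s) (applyUpTo-cong n (λ i i<n → eq (suc i) (s<s i<n)))

count-+ : ∀ n {p q r s} → (∀ t → ⟦ p t ⟧ + ⟦ q t ⟧ ≡ ⟦ r t ⟧ + ⟦ s t ⟧) →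
  count n p + count n q ≡ count n r + count n s
count-+ zero    eq = refl
count-+ (suc n) {p} {q} {r} {s} eq = begin
  (⟦ p 0 ⟧ + count n (p ∘ suc)) + (⟦ q 0 ⟧ + count n (q ∘ suc))  ≡⟨ interchange ⟦ p 0 ⟧ _ ⟦ q 0 ⟧ _ ⟩
  (⟦ p 0 ⟧ + ⟦ q 0 ⟧) + (count n (p ∘ suc) + count n (q ∘ suc))
    ≡⟨ cong₂ _+_ (eq 0) (count-+ n (λ t → eq (suc t))) ⟩
  (⟦ r 0 ⟧ + ⟦ s 0 ⟧) + (count n (r ∘ suc) + count n (s ∘ suc))  ≡⟨ interchange ⟦ r 0 ⟧ ⟦ s 0 ⟧ _ _ ⟩
  (⟦ r 0 ⟧ + count n (r ∘ suc)) + (⟦ s 0 ⟧ + count n (s ∘ suc))  ∎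
  where
  open ≡-Reasoning

energy-+ : ∀ n {p q r s} → (∀ t → ⟦ p t ⟧ + ⟦ q t ⟧ ≡ ⟦ r t ⟧ + ⟦ s t ⟧) →
  energy n p + energy n q ≡ energy n r + energy n s
energy-+ zero    eq = refl
energy-+ (suc n) {p} {q} {r} {s} eq = begin
  (count n (p ∘ suc) + energy n (p ∘ suc)) + (count n (q ∘ suc) + energy n (q ∘ suc))
    ≡⟨ interchange (count n (p ∘ suc)) _ (count n (q ∘ suc)) _ ⟩
  (count n (p ∘ suc) + count n (q ∘ suc)) + (energy n (p ∘ suc) + energy n (q ∘ suc))
    ≡⟨ cong₂ _+_ (count-+ n (λ t → eq (suc t))) (energy-+ n (λ t → eq (suc t))) ⟩
  (count n (r ∘ suc) + count n (s ∘ suc)) + (energy n (r ∘ suc) + energy n (s ∘ suc))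
    ≡⟨ interchange (count n (r ∘ suc)) (count n (s ∘ suc)) _ _ ⟩
  (count n (r ∘ suc) + energy n (r ∘ suc)) + (count n (s ∘ suc) + energy n (s ∘ suc))
    ∎
  where
  open ≡-Reasoning

SubSetoid : ∀ {a ℓ p} (S : Setoid a ℓ) → Pred (Setoid.Carrier S) p → Setoid _ _
SubSetoid S P = record
  { Carrier       = ∃ P
  ; _≈_           = Setoid._≈_ S on proj₁
  ; isEquivalence = On.isEquivalence proj₁ (Setoid.isEquivalence S)
  }

beadsSetoid : Setoid 0ℓ 0ℓ
beadsSetoid = ℕ →-setoid Bool

-- Configurations on `e` runners, and what an exchange of the first two preserves.

module Abacus (d e′ : ℕ) where

  open Congruence d public
  open Words d public

  e : ℕ
  e = 2 + e′

  column : Beads → ℕ → Beads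
  column f i t = f (i + t * e)

  -- gaps f (x + k * e) - suc (gaps f x) is the arm of the hook with gap x and
  -- bead x + k * e.
  Balancedᶠ : Beads → Set
  Balancedᶠ f = ∀ x k → f x ≡ false → f (x + k * e) ≡ true → gaps f (x + k * e) ≋ suc (gaps f x)

  charges : ℕ → Beads → List ℕ
  charges n f = applyUpTo (λ i → count n (column f i)) e

  totalEnergy : ℕ → Beads → ℕ
  totalEnergy n f = sum (applyUpTo (λ i → energy n (column f i)) e)

  -- The core with charges cs has energy sum (map tri cs), and every step of a bead
  -- along its runner changes the energy by one.
  record InBlockAt (n : ℕ) (cs : List ℕ) (w : ℕ) (f : Beads) : Set where
    constructor inBlockAt
    field
      vanishes : Vanishes (n * e) f
      charges≡ : charges n f ≡ cs
      energy≡  : totalEnergy n f ≡ sum (map tri cs) + w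

  -- The cut-off is existential because rotations change it; by `extend-block` any larger one serves
  -- as well.
  InBlock : List ℕ → ℕ → Beads → Set
  InBlock cs w f = ∃ λ n → InBlockAt n cs w f

  Config : List ℕ → ℕ → Setoid 0ℓ 0ℓ
  Config cs w = SubSetoid beadsSetoid (λ f → InBlock cs w f × Balancedᶠ f)

  column-vanishes : ∀ {n f} i → Vanishes (n * e) f → Vanishes n (column f i)
  column-vanishes {n} i v t n≤t = v (i + t * e) (≤-trans (*-monoˡ-≤ e n≤t) (m≤n+m _ i))

  extend-block : ∀ {n cs w f} m → InBlockAt n cs w f → InBlockAt (n + m) cs w f
  extend-block {n} {f = f} m b = inBlockAt (vanishes-mono (*-monoˡ-≤ e (m≤m+n n m)) vanishes)
    (trans (applyUpTo-cong e (λ i _ → count-extend n m (column-vanishes i vanishes))) charges≡)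
    (trans (cong sum (applyUpTo-cong e (λ i _ → energy-extend n m (column-vanishes i vanishes)))) energy≡)
    where open InBlockAt b

  row-shift : ∀ i t k → i + t * e + k * e ≡ i + (t + k) * e
  row-shift i t k = trans (+-assoc i (t * e) (k * e)) (cong (i +_) (sym (*-distribʳ-+ e t k)))

  RowBalanced : Beads → Set
  RowBalanced f = ∀ i t j → i < e → t < j → column f i t ≡ false → column f i j ≡ true →
    gaps f (i + j * e) ≋ suc (gaps f (i + t * e))

  balanced⇒rowBalanced : ∀ {f} → Balancedᶠ f → RowBalanced f
  balanced⇒rowBalanced {f} bal i t j _ t<j ft fj =
    subst (λ x → gaps f x ≋ suc (gaps f (i + t * e))) eq
      (bal (i + t * e) (j ∸ t) ft (trans (cong f eq) fj))
    where
    eq : i + t * e + (j ∸ t) * e ≡ i + j * e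
    eq = trans (row-shift i t (j ∸ t)) (cong (λ k → i + k * e) (m+[n∸m]≡n (<⇒≤ t<j)))

  rowBalanced⇒balanced : ∀ {f} → RowBalanced f → Balancedᶠ f
  rowBalanced⇒balanced {f} bal x zero fx fy =
    contradiction (trans (sym fx) (trans (cong f (sym (+-identityʳ x))) fy)) λ ()
  rowBalanced⇒balanced {f} bal x (suc k) fx fy =
    subst₂ (λ y z → gaps f y ≋ suc (gaps f z)) (sym eqʸ) (sym eqˣ)
      (bal (x % e) (x / e) (x / e + suc k) (m%n<n x e) (m<m+n (x / e) z<s)
        (trans (cong f (sym eqˣ)) fx) (trans (cong f (sym eqʸ)) fy))
    where
    eqˣ : x ≡ x % e + x / e * e
    eqˣ = m≡m%n+[m/n]*n x e
    eqʸ : x + suc k * e ≡ x % e + (x / e + suc k) * e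
    eqʸ = trans (cong (_+ suc k * e) eqˣ) (row-shift (x % e) (x / e) (suc k))

  ≗-rows : ∀ {f h : Beads} → (∀ i t → i < e → column f i t ≡ column h i t) → f ≗ h
  ≗-rows {f} {h} eq x = begin
    f x                    ≡⟨ cong f (m≡m%n+[m/n]*n x e) ⟩
    column f (x % e) (x / e) ≡⟨ eq (x % e) (x / e) (m%n<n x e) ⟩
    column h (x % e) (x / e) ≡⟨ cong h (m≡m%n+[m/n]*n x e) ⟨
    h x                    ∎
    where open ≡-Reasoning

  single : Beads → Beads
  single f t = column f 0 t xor column f 1 t

  rowGaps : Beads → ℕ → ℕ
  rowGaps f t = gaps f (t * e)

  PairEq : Bool → Bool → Bool → Bool → Set
  PairEq a b a′ b′ = (a′ ≡ a × b′ ≡ b) ⊎ (a′ ≡ b × b′ ≡ a)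

  record SameFrame (f h : Beads) : Set where
    field
      pair : ∀ t → PairEq (column f 0 t) (column f 1 t) (column h 0 t) (column h 1 t)
      rest : ∀ i t → i < e′ → column h (2 + i) t ≡ column f (2 + i) t

  pairEq-sym : ∀ {a b a′ b′} → PairEq a b a′ b′ → PairEq a′ b′ a b
  pairEq-sym (inj₁ (refl , refl)) = inj₁ (refl , refl)
  pairEq-sym (inj₂ (refl , refl)) = inj₂ (refl , refl)

  pairEq-trans : ∀ {a b a′ b′ a″ b″} → PairEq a b a′ b′ → PairEq a′ b′ a″ b″ → PairEq a b a″ b″
  pairEq-trans (inj₁ (refl , refl)) q                    = q
  pairEq-trans (inj₂ (refl , refl)) (inj₁ (refl , refl)) = inj₂ (refl , refl)
  pairEq-trans (inj₂ (refl , refl)) (inj₂ (refl , refl)) = inj₁ (refl , refl)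

  frame-sym : ∀ {f h} → SameFrame f h → SameFrame h f
  frame-sym F = record { pair = λ t → pairEq-sym (pair t) ; rest = λ i t i<e → sym (rest i t i<e) }
    where open SameFrame F

  frame-trans : ∀ {f h k} → SameFrame f h → SameFrame h k → SameFrame f k
  frame-trans F H = record
    { pair = λ t → pairEq-trans (F.pair t) (H.pair t)
    ; rest = λ i t i<e → trans (H.rest i t i<e) (F.rest i t i<e) }
    where module F = SameFrame F
          module H = SameFrame H

  frame-≗ : ∀ {f h} → f ≗ h → SameFrame f h
  frame-≗ eq = record { pair = λ t → inj₁ (sym (eq _) , sym (eq _)) ; rest = λ i t _ → sym (eq _) }

  pair-symmetric : ∀ {A : Set} (op : Bool → Bool → A) → (∀ a b → op a b ≡ op b a) →
    ∀ {a b a′ b′} → PairEq a b a′ b′ → op a b ≡ op a′ b′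
  pair-symmetric op comm (inj₁ (refl , refl)) = refl
  pair-symmetric op comm {a} {b} (inj₂ (refl , refl)) = comm a b

  pair-beads : ∀ {a b a′ b′} → PairEq a b a′ b′ → ⟦ a ⟧ + ⟦ b ⟧ ≡ ⟦ a′ ⟧ + ⟦ b′ ⟧
  pair-beads = pair-symmetric (λ a b → ⟦ a ⟧ + ⟦ b ⟧) (λ a b → +-comm ⟦ a ⟧ ⟦ b ⟧)

  pair-gaps : ∀ {a b a′ b′} → PairEq a b a′ b′ → ⟦ not a ⟧ + ⟦ not b ⟧ ≡ ⟦ not a′ ⟧ + ⟦ not b′ ⟧
  pair-gaps = pair-symmetric (λ a b → ⟦ not a ⟧ + ⟦ not b ⟧) (λ a b → +-comm ⟦ not a ⟧ ⟦ not b ⟧)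

  module _ {f h : Beads} (F : SameFrame f h) where
    open SameFrame F

    frame-single : single f ≗ single h
    frame-single t = pair-symmetric _xor_ xor-comm (pair t)

    -- Permuting the first two cells of a row affects the gap count only at the position between
    -- them. The two claims are mutual because each row starts where the previous one ends.
    frame-rowGaps : ∀ t → rowGaps f t ≡ rowGaps h t
    frame-gaps    : ∀ t i → i ≤ e′ → gaps f (2 + i + t * e) ≡ gaps h (2 + i + t * e)

    frame-rowGaps zero    = refl
    frame-rowGaps (suc t) = frame-gaps t e′ ≤-refl

    frame-gaps t zero _ = begin
      rowGaps f t + ⟦ not (column f 0 t) ⟧ + ⟦ not (column f 1 t) ⟧    ≡⟨ +-assoc (rowGaps f t) _ _ ⟩
      rowGaps f t + (⟦ not (column f 0 t) ⟧ + ⟦ not (column f 1 t) ⟧)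
        ≡⟨ cong₂ _+_ (frame-rowGaps t) (pair-gaps (pair t)) ⟩
      rowGaps h t + (⟦ not (column h 0 t) ⟧ + ⟦ not (column h 1 t) ⟧)  ≡⟨ +-assoc (rowGaps h t) _ _ ⟨
      rowGaps h t + ⟦ not (column h 0 t) ⟧ + ⟦ not (column h 1 t) ⟧    ∎
      where open ≡-Reasoning
    frame-gaps t (suc i) i<e′ =
      cong₂ (λ m b → m + ⟦ not b ⟧) (frame-gaps t i (<⇒≤ i<e′)) (sym (rest i t i<e′))

  ≋-+ : ∀ {a b m n} → m ≡ n → a ≋ suc b → a + m ≋ suc (b + n)
  ≋-+ {a} {b} {m} refl (k , l , p) = k , l , trans (lemma a m (k * d)) (trans (cong (_+ m) p) (lemma′ b m (l * d)))
    where
    lemma : ∀ a m k → a + m + k ≡ a + k + m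
    lemma = solve-∀
    lemma′ : ∀ a m k → suc a + k + m ≡ suc (a + m) + k
    lemma′ = solve-∀

  ≋-cancel-+ : ∀ {a b m n} → m ≡ n → a + m ≋ suc (b + n) → a ≋ suc b
  ≋-cancel-+ {a} {b} {m} refl (k , l , p) =
    k , l , +-cancelʳ-≡ m _ _ (trans (sym (lemma a m (k * d))) (trans p (sym (lemma′ b m (l * d)))))
    where
    lemma : ∀ a m k → a + m + k ≡ a + k + m
    lemma = solve-∀
    lemma′ : ∀ a m k → suc a + k + m ≡ suc (a + m) + k
    lemma′ = solve-∀

  rowBalanced⇒valid : ∀ {f} → RowBalanced f → Valid (single f) (rowGaps f) (column f 0)
  rowBalanced⇒valid {f} bal t j t<j st sj
    with column f 0 t in at | column f 1 t in bt | column f 0 j in aj | column f 1 j in bj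
  ... | true  | false | true  | false = tt
  ... | false | true  | false | true  = tt
  ... | false | true  | true  | false = bal 0 t j z<s t<j at aj
  -- On the second runner the count at the earlier row skips a bead and the count at the later row
  -- skips a gap; this extra gap cancels the `suc` of the balance condition.
  ... | true  | false | false | true  = ≋-suc⁻¹ (subst₂ (λ x y → x ≋ suc y) eqʲ eqᵗ (bal 1 t j (s<s z<s) t<j bt bj))
    where
    eqʲ : gaps f (1 + j * e) ≡ suc (rowGaps f j)
    eqʲ = trans (cong (λ b → rowGaps f j + ⟦ not b ⟧) aj) (+-comm _ 1)
    eqᵗ : gaps f (1 + t * e) ≡ rowGaps f t
    eqᵗ = trans (cong (λ b → rowGaps f t + ⟦ not b ⟧) at) (+-identityʳ _)

  -- The constraints between two rows that are not both single do not see how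
  -- the single rows are filled.
  frame-constraint : ∀ {f} → RowBalanced f → ∀ t j → t < j → single f t ∧ single f j ≡ false →
    column f 0 t ∧ column f 1 t ≡ false → column f 0 j ∨ column f 1 j ≡ true → rowGaps f j ≋ suc (rowGaps f t)
  frame-constraint {f} bal t j t<j s gap bead
    with column f 0 t in at | column f 1 t in bt | column f 0 j in aj | column f 1 j in bj
  ... | false | _     | true  | _     = bal 0 t j z<s t<j at aj
  ... | false | false | false | true  =
    ≋-cancel-+ (trans (cong (λ b → ⟦ not b ⟧) aj) (cong (λ b → ⟦ not b ⟧) (sym at))) (bal 1 t j (s<s z<s) t<j bt bj)
  ... | true  | false | true  | true  =
    ≋-cancel-+ (trans (cong (λ b → ⟦ not b ⟧) aj) (cong (λ b → ⟦ not b ⟧) (sym at))) (bal 1 t j (s<s z<s) t<j bt bj)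
  frame-constraint bal t j t<j () gap bead | true | false | true  | false
  frame-constraint bal t j t<j s gap ()    | _    | false | false | false

  -- Only pairs of single rows depend on the filling, and for them `Valid` is exactly what balance
  -- asks. The congruences for all other pairs and for the other runners are inherited from `f`.
  valid⇒rowBalanced : ∀ {f h} → RowBalanced f → SameFrame f h →
    Valid (single h) (rowGaps h) (column h 0) → RowBalanced h
  valid⇒rowBalanced {f} {h} bal F v = go
    where
    open SameFrame F
    constraint : ∀ t j → t < j → single h t ∧ single h j ≡ false → column h 0 t ∧ column h 1 t ≡ false →
      column h 0 j ∨ column h 1 j ≡ true → rowGaps h j ≋ suc (rowGaps h t)
    constraint t j t<j s g b = subst₂ (λ x y → x ≋ suc y) (frame-rowGaps F j) (frame-rowGaps F t)
      (frame-constraint bal t j t<j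
        (trans (cong₂ _∧_ (frame-single F t) (frame-single F j)) s)
        (trans (pair-symmetric _∧_ ∧-comm (pair t)) g)
        (trans (pair-symmetric _∨_ ∨-comm (pair j)) b))

    fixed : ∀ t → column h 0 t ≡ column h 1 t → column f 1 t ≡ column h 1 t
    fixed t eq with pair t
    ... | inj₁ (_ , q) = sym q
    ... | inj₂ (p , q) = trans (sym p) eq

    second : ∀ t j → t < j → column h 1 t ≡ false → column h 1 j ≡ true →
      rowGaps h j + ⟦ not (column h 0 j) ⟧ ≋ suc (rowGaps h t + ⟦ not (column h 0 t) ⟧)
    second t j t<j ht hj with column h 0 t in at | column h 0 j in aj
    ... | false | false = ≋-+ {m = 1} refl (constraint t j t<j
            (cong (_∧ single h j) (cong₂ _xor_ at ht))
            (cong (_∧ column h 1 t) at) (trans (cong (_∨ column h 1 j) aj) hj))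
    ... | true  | true  = ≋-+ {m = 0} refl (constraint t j t<j
            (trans (cong (single h t ∧_) (cong₂ _xor_ aj hj)) (cong (_∧ false) (cong₂ _xor_ at ht)))
            (cong₂ _∧_ at ht) (cong (_∨ column h 1 j) aj))
    ... | true  | false = subst₂ _≋_ (sym (+-comm (rowGaps h j) 1)) (cong suc (sym (+-identityʳ _)))
            (≋-suc (subst₂ (λ x y → Link x y (rowGaps h t) (rowGaps h j)) at aj
              (v t j t<j (cong₂ _xor_ at ht) (cong₂ _xor_ aj hj))))
    -- Row `t` starts with two gaps and row `j` with two beads. The congruence needed here is off by
    -- one from that of `constraint`, but neither row is single, so `h` agrees with `f` on both and
    -- the second runner of `f` provides it.
    ... | false | true  = subst₂ (λ x y → x ≋ suc y) (eq j aj (fixed j (trans aj (sym hj)))) (eq t at (fixed t (trans at (sym ht))))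
            (bal 1 t j (s<s z<s) t<j (trans (fixed t (trans at (sym ht))) ht) (trans (fixed j (trans aj (sym hj))) hj))
      where
      eq : ∀ t {b} → column h 0 t ≡ b → column f 1 t ≡ column h 1 t → gaps f (1 + t * e) ≡ rowGaps h t + ⟦ not b ⟧
      eq t {b} p q = cong₂ (λ m c → m + ⟦ not c ⟧) (frame-rowGaps F t) (trans (other (pair t)) p)
        where
        other : PairEq (column f 0 t) (column f 1 t) (column h 0 t) (column h 1 t) → column f 0 t ≡ column h 0 t
        other (inj₁ (x , _)) = sym x
        other (inj₂ (x , y)) = trans (sym y) (trans (sym q) (sym x))

    go : RowBalanced h
    go (suc (suc i)) t j i<e t<j ht hj = subst₂ (λ x y → x ≋ suc y)
      (frame-gaps F j i (<⇒≤ i<e′)) (frame-gaps F t i (<⇒≤ i<e′))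
      (bal (2 + i) t j i<e t<j (trans (sym (rest i t i<e′)) ht) (trans (sym (rest i j i<e′)) hj))
      where
      i<e′ : i < e′
      i<e′ = s<s⁻¹ (s<s⁻¹ i<e)
    go 1 t j _ t<j ht hj = second t j t<j ht hj
    go 0 t j _ t<j ht hj with single h t in st | single h j in sj
    ... | true | true = subst₂ (λ x y → Link x y (rowGaps h t) (rowGaps h j)) ht hj (v t j t<j st sj)
    ... | false | _   = constraint t j t<j (cong (_∧ single h j) st)
                          (cong (_∧ column h 1 t) ht) (cong (_∨ column h 1 j) hj)
    ... | true | false = constraint t j t<j (cong₂ _∧_ st sj)
                          (cong (_∧ column h 1 t) ht) (cong (_∨ column h 1 j) hj)

-- Refilling the single rows.

module Exchange (d e′ : ℕ) (1<d : 1 < d) where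
  open Abacus d e′

  valid-cong : ∀ {s s′ g g′ a a′} → s ≗ s′ → g ≗ g′ → (∀ t → s t ≡ true → a t ≡ a′ t) →
    Valid s g a → Valid s′ g′ a′
  valid-cong {a = a} eqs eqg eqa v i j i<j si sj
    with trans (eqs i) si | trans (eqs j) sj
  ... | si′ | sj′ rewrite sym (eqa i si′) | sym (eqa j sj′) | sym (eqg i) | sym (eqg j) = v i j i<j si′ sj′

  fromRows : (ℕ → Beads) → Beads
  fromRows c x = c (x % e) (x / e)

  column-fromRows : ∀ c {i} t → i < e → column (fromRows c) i t ≡ c i t
  column-fromRows c t i<e = cong₂ c ([r+q*n]%n≡r t i<e) ([r+q*n]/n≡q t i<e)

  cells : Beads → Beads → ℕ → Beads
  cells f b 0             t = if single f t then b t else column f 0 t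
  cells f b 1             t = if single f t then not (b t) else column f 1 t
  cells f b (suc (suc i)) t = column f (2 + i) t

  fill : Beads → Beads → Beads
  fill f b = fromRows (cells f b)

  fill-frame : ∀ f b → SameFrame f (fill f b)
  fill-frame f b = record
    { pair = λ t → subst₂ (PairEq (column f 0 t) (column f 1 t))
        (sym (column-fromRows (cells f b) t z<s)) (sym (column-fromRows (cells f b) t (s<s z<s))) (pairs t)
    ; rest = λ i t i<e′ → column-fromRows (cells f b) t (s<s (s<s i<e′)) }
    where
    pairs : ∀ t → PairEq (column f 0 t) (column f 1 t) (cells f b 0 t) (cells f b 1 t)
    pairs t with column f 0 t | column f 1 t | b t
    ... | true  | true  | _     = inj₁ (refl , refl)
    ... | false | false | _     = inj₁ (refl , refl)
    ... | true  | false | true  = inj₁ (refl , refl)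
    ... | true  | false | false = inj₂ (refl , refl)
    ... | false | true  | true  = inj₂ (refl , refl)
    ... | false | true  | false = inj₁ (refl , refl)

  fill-first : ∀ f b t → single f t ≡ true → b t ≡ column (fill f b) 0 t
  fill-first f b t st = sym (trans (column-fromRows (cells f b) t z<s)
    (cong (if_then b t else column f 0 t) st))

  double : Beads → Beads
  double f t = column f 0 t ∧ column f 1 t

  count-false : ∀ n → count n (const false) ≡ 0
  count-false n = count-vanish n (λ _ _ → refl)

  rights-first : ∀ n f → count n (double f) + rights n (single f) (column f 0) ≡ count n (column f 0)
  rights-first n f = trans (count-+ n eq) (trans (cong (count n (column f 0) +_) (count-false n)) (+-identityʳ _))
    where
    eq : ∀ t → ⟦ double f t ⟧ + ⟦ single f t ∧ column f 0 t ⟧ ≡ ⟦ column f 0 t ⟧ + 0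
    eq t with column f 0 t | column f 1 t
    ... | true  | true  = refl
    ... | true  | false = refl
    ... | false | true  = refl
    ... | false | false = refl

  lefts-second : ∀ n f → count n (double f) + lefts n (single f) (column f 0) ≡ count n (column f 1)
  lefts-second n f = trans (count-+ n eq) (trans (cong (count n (column f 1) +_) (count-false n)) (+-identityʳ _))
    where
    eq : ∀ t → ⟦ double f t ⟧ + ⟦ single f t ∧ not (column f 0 t) ⟧ ≡ ⟦ column f 1 t ⟧ + 0
    eq t with column f 0 t | column f 1 t
    ... | true  | true  = refl
    ... | true  | false = refl
    ... | false | true  = refl
    ... | false | false = refl

  single-vanishes : ∀ {n f} → Vanishes (n * e) f → Vanishes n (single f)
  single-vanishes v t n≤t = cong₂ _xor_ (column-vanishes 0 v t n≤t) (column-vanishes 1 v t n≤t)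

  vanishes-rows : ∀ {n f} → (∀ i → i < e → Vanishes n (column f i)) → Vanishes (n * e) f
  vanishes-rows {n} {f} v x n≤x = trans (cong f (m≡m%n+[m/n]*n x e))
    (v (x % e) (m%n<n x e) (x / e) (subst (_≤ x / e) (m*n/n≡m n e) (/-monoˡ-≤ e n≤x)))

  frame-vanishes : ∀ {n f h} → SameFrame f h → Vanishes (n * e) f → Vanishes (n * e) h
  frame-vanishes {n} {f} {h} F v = vanishes-rows {n} go
    where
    open SameFrame F
    both : ∀ {a b a′ b′} → a ≡ false → b ≡ false → PairEq a b a′ b′ → a′ ≡ false × b′ ≡ false
    both a b (inj₁ (p , q)) = trans p a , trans q b
    both a b (inj₂ (p , q)) = trans p b , trans q a
    go : ∀ i → i < e → Vanishes n (column h i)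
    go 0 _ t n≤t = proj₁ (both (column-vanishes 0 v t n≤t) (column-vanishes 1 v t n≤t) (pair t))
    go 1 _ t n≤t = proj₂ (both (column-vanishes 0 v t n≤t) (column-vanishes 1 v t n≤t) (pair t))
    go (suc (suc i)) i<e t n≤t = trans (rest i t (s<s⁻¹ (s<s⁻¹ i<e))) (column-vanishes (2 + i) v t n≤t)

  frame-double : ∀ {f h} → SameFrame f h → double f ≗ double h
  frame-double F t = pair-symmetric _∧_ ∧-comm (SameFrame.pair F t)

  -- The rows with two beads are part of the frame, so the charge of the first runner fixes the
  -- number of right letters, and `valid-unique` fixes the word.
  frame-unique : ∀ n {f h} → SameFrame f h → Balancedᶠ f → Balancedᶠ h → Vanishes (n * e) f →
    count n (column f 0) ≡ count n (column h 0) → f ≗ h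
  frame-unique n {f} {h} F bf bh v eq = ≗-rows go
    where
    open SameFrame F
    rights≡ : rights n (single f) (column f 0) ≡ rights n (single f) (column h 0)
    rights≡ = +-cancelˡ-≡ (count n (double f)) _ _ (begin
      count n (double f) + rights n (single f) (column f 0)  ≡⟨ rights-first n f ⟩
      count n (column f 0)                                   ≡⟨ eq ⟩
      count n (column h 0)                                   ≡⟨ rights-first n h ⟨
      count n (double h) + rights n (single h) (column h 0)
        ≡⟨ cong₂ _+_ (count-cong n (λ t _ → sym (frame-double F t)))
                     (count-cong n (λ t _ → cong (_∧ column h 0 t) (sym (frame-single F t)))) ⟩
      count n (double f) + rights n (single f) (column h 0)  ∎)
      where open ≡-Reasoning
    valid-h : Valid (single f) (rowGaps f) (column h 0)
    valid-h = valid-cong (λ t → sym (frame-single F t)) (λ t → sym (frame-rowGaps F t)) (λ _ _ → refl)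
                (rowBalanced⇒valid (balanced⇒rowBalanced bh))
    first : ∀ t → single f t ≡ true → column f 0 t ≡ column h 0 t
    first t st with t <? n
    ... | yes t<n = valid-unique 1<d n (rowBalanced⇒valid (balanced⇒rowBalanced bf)) valid-h rights≡ t t<n st
    ... | no t≮n  = contradiction (trans (sym st) (single-vanishes {n} v t (≮⇒≥ t≮n))) λ ()
    resolve : ∀ a b a′ b′ → PairEq a b a′ b′ → (a xor b ≡ true → a ≡ a′) → a ≡ a′ × b ≡ b′
    resolve a b _ _ (inj₁ (refl , refl)) _ = refl , refl
    resolve true  true  _ _ (inj₂ (refl , refl)) _ = refl , refl
    resolve false false _ _ (inj₂ (refl , refl)) _ = refl , refl
    resolve true  false _ _ (inj₂ (refl , refl)) h = contradiction (h refl) λ ()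
    resolve false true  _ _ (inj₂ (refl , refl)) h = contradiction (h refl) λ ()
    go : ∀ i t → i < e → column f i t ≡ column h i t
    go 0 t _ = proj₁ (resolve _ _ _ _ (pair t) (first t))
    go 1 t _ = proj₂ (resolve _ _ _ _ (pair t) (first t))
    go (suc (suc i)) t i<e = sym (rest i t (s<s⁻¹ (s<s⁻¹ i<e)))

  -- Taken over both runners together, charge and energy depend only on the number of beads in each
  -- row, which the frame preserves. So one new charge determines the other, and the weight stays
  -- the same.
  exchanged-block : ∀ {n c₀ c₁ cs w f h} → SameFrame f h → count n (column h 0) ≡ count n (column f 1) →
    InBlockAt n (c₀ ∷ c₁ ∷ cs) w f → InBlockAt n (c₁ ∷ c₀ ∷ cs) w h
  exchanged-block {n} {c₀} {c₁} {cs} {w} {f} {h} F swap₀ b =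
    inBlockAt (frame-vanishes {n} F vanishes) charges′ energy′
    where
    open InBlockAt b
    open SameFrame F
    open ≡-Reasoning
    beads : ∀ t → ⟦ column f 0 t ⟧ + ⟦ column f 1 t ⟧ ≡ ⟦ column h 0 t ⟧ + ⟦ column h 1 t ⟧
    beads t = pair-beads (pair t)
    swap₁ : count n (column h 1) ≡ count n (column f 0)
    swap₁ = +-cancelˡ-≡ (count n (column h 0)) _ _ (begin
      count n (column h 0) + count n (column h 1)  ≡⟨ count-+ n beads ⟨
      count n (column f 0) + count n (column f 1)  ≡⟨ cong (count n (column f 0) +_) swap₀ ⟨
      count n (column f 0) + count n (column h 0)  ≡⟨ +-comm (count n (column f 0)) _ ⟩
      count n (column h 0) + count n (column f 0)  ∎)
    charges′ : charges n h ≡ c₁ ∷ c₀ ∷ cs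
    charges′ with ∷-injective charges≡
    ... | eq₀ , eq with ∷-injective eq
    ...   | eq₁ , eqs = cong₂ _∷_ (trans swap₀ eq₁) (cong₂ _∷_ (trans swap₁ eq₀)
      (trans (applyUpTo-cong e′ (λ i i<e′ → count-cong n (λ t _ → rest i t i<e′))) eqs))
    energy′ : totalEnergy n h ≡ sum (map tri (c₁ ∷ c₀ ∷ cs)) + w
    energy′ = begin
      energy n (column h 0) + (energy n (column h 1) + sum (applyUpTo (λ i → energy n (column h (2 + i))) e′))
        ≡⟨ +-assoc (energy n (column h 0)) _ _ ⟨
      energy n (column h 0) + energy n (column h 1) + sum (applyUpTo (λ i → energy n (column h (2 + i))) e′)
        ≡⟨ cong₂ _+_ (sym (energy-+ n beads))
             (cong sum (applyUpTo-cong e′ (λ i i<e′ → energy-cong n (λ t _ → rest i t i<e′)))) ⟩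
      energy n (column f 0) + energy n (column f 1) + sum (applyUpTo (λ i → energy n (column f (2 + i))) e′)
        ≡⟨ +-assoc (energy n (column f 0)) _ _ ⟩
      totalEnergy n f                         ≡⟨ energy≡ ⟩
      tri c₀ + (tri c₁ + sum (map tri cs)) + w  ≡⟨ lemma (tri c₀) (tri c₁) _ w ⟩
      tri c₁ + (tri c₀ + sum (map tri cs)) + w  ∎
      where
      lemma : ∀ a b c d → a + (b + c) + d ≡ b + (a + c) + d
      lemma = solve-∀

  exchange : ∀ n {c₀ c₁ cs w f} → InBlockAt n (c₀ ∷ c₁ ∷ cs) w f → Balancedᶠ f →
    ∃ λ h → SameFrame f h × InBlockAt n (c₁ ∷ c₀ ∷ cs) w h × Balancedᶠ h
  exchange n {f = f} b bal
    with exchanged-word n (single-vanishes {n} (InBlockAt.vanishes b)) (rowBalanced⇒valid (balanced⇒rowBalanced bal))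
  ... | a , v , eq = h , F , exchanged-block F first b ,
    rowBalanced⇒balanced (valid⇒rowBalanced (balanced⇒rowBalanced bal) F
      (valid-cong (frame-single F) (frame-rowGaps F) (fill-first f a) v))
    where
    h : Beads
    h = fill f a
    F : SameFrame f h
    F = fill-frame f a
    first : count n (column h 0) ≡ count n (column f 1)
    first = begin
      count n (column h 0)                                   ≡⟨ rights-first n h ⟨
      count n (double h) + rights n (single h) (column h 0)
        ≡⟨ cong₂ _+_ (count-cong n (λ t _ → sym (frame-double F t))) (count-cong n (λ t _ → agree t)) ⟩
      count n (double f) + rights n (single f) a             ≡⟨ cong (count n (double f) +_) eq ⟩
      count n (double f) + lefts n (single f) (column f 0)   ≡⟨ lefts-second n f ⟩
      count n (column f 1)                                   ∎
      where
      open ≡-Reasoning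
      agree : ∀ t → single h t ∧ column h 0 t ≡ single f t ∧ a t
      agree t rewrite sym (frame-single F t) with single f t in st
      ... | true  = sym (fill-first f a t st)
      ... | false = refl

  -- Exchanging twice stays in the frame and restores the charges. Hence this gives both inverse
  -- laws, and compatibility with pointwise equality, without looking at the words that `exchange`
  -- chooses.
  block-unique : ∀ {c₀ c₁ cs w f h} → SameFrame f h →
    InBlock (c₀ ∷ c₁ ∷ cs) w f × Balancedᶠ f → InBlock (c₀ ∷ c₁ ∷ cs) w h × Balancedᶠ h → f ≗ h
  block-unique {f = f} {h} F ((n , b) , bf) ((n′ , b′) , bh) =
    frame-unique n F bf bh (InBlockAt.vanishes b) (begin
      count n (column f 0)   ≡⟨ proj₁ (∷-injective (InBlockAt.charges≡ b)) ⟩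
      _                      ≡⟨ proj₁ (∷-injective (InBlockAt.charges≡ b′)) ⟨
      count n′ (column h 0)  ≡⟨ count-unique (column-vanishes {n′} 0 (InBlockAt.vanishes b′))
                                  (column-vanishes {n} 0 (frame-vanishes {n} F (InBlockAt.vanishes b))) (λ _ → refl) ⟩
      count n (column h 0)   ∎)
    where open ≡-Reasoning

  exchange-config : ∀ {c₀ c₁ cs w} → Setoid.Carrier (Config (c₀ ∷ c₁ ∷ cs) w) → Setoid.Carrier (Config (c₁ ∷ c₀ ∷ cs) w)
  exchange-config (f , (n , b) , bal) with exchange n b bal
  ... | h , _ , b′ , bal′ = h , (n , b′) , bal′

  exchange-frame : ∀ {c₀ c₁ cs w} (F : Setoid.Carrier (Config (c₀ ∷ c₁ ∷ cs) w)) →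
    SameFrame (proj₁ F) (proj₁ (exchange-config F))
  exchange-frame (f , (n , b) , bal) = proj₁ (proj₂ (exchange n b bal))

  exchange-cong : ∀ {c₀ c₁ cs w} (F G : Setoid.Carrier (Config (c₀ ∷ c₁ ∷ cs) w)) →
    proj₁ F ≗ proj₁ G → proj₁ (exchange-config F) ≗ proj₁ (exchange-config G)
  exchange-cong F G eq = block-unique
    (frame-trans (frame-sym (exchange-frame F)) (frame-trans (frame-≗ eq) (exchange-frame G)))
    (proj₂ (exchange-config F)) (proj₂ (exchange-config G))

  exchange-inverse : ∀ {c₀ c₁ cs w} (F : Setoid.Carrier (Config (c₀ ∷ c₁ ∷ cs) w))
    (G : Setoid.Carrier (Config (c₁ ∷ c₀ ∷ cs) w)) →
    proj₁ G ≗ proj₁ (exchange-config F) → proj₁ (exchange-config G) ≗ proj₁ F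
  exchange-inverse F G eq = block-unique
    (frame-sym (frame-trans (exchange-frame F) (frame-trans (frame-≗ (λ x → sym (eq x))) (exchange-frame G))))
    (proj₂ (exchange-config G)) (proj₂ F)

  exchange-↔ : ∀ c₀ c₁ cs w → Inverse (Config (c₀ ∷ c₁ ∷ cs) w) (Config (c₁ ∷ c₀ ∷ cs) w)
  exchange-↔ c₀ c₁ cs w = record
    { to        = exchange-config
    ; from      = exchange-config
    ; to-cong   = λ {F} {G} → exchange-cong F G
    ; from-cong = λ {F} {G} → exchange-cong F G
    ; inverse   = (λ {F} {G} → exchange-inverse F G) , (λ {F} {G} → exchange-inverse F G)
    }

-- Rotating the runners

sum-tri≤ : ∀ n (r : ℕ → Beads) m →
  sum (map tri (applyUpTo (λ i → count n (r i)) m)) ≤ sum (applyUpTo (λ i → energy n (r i)) m)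
sum-tri≤ n r zero    = z≤n
sum-tri≤ n r (suc m) = +-mono-≤ (tri-count≤energy n (r 0)) (sum-tri≤ n (r ∘ suc) m)

sum-∷ʳ : ∀ xs x → sum (xs ∷ʳ x) ≡ sum xs + x
sum-∷ʳ xs x = trans (sum-++ xs [ x ]) (cong (sum xs +_) (+-identityʳ x))

module Rotation (d e′ : ℕ) (1<d : 1 < d) where
  open Abacus d e′
  open Exchange d e′ 1<d

  -- Shifting by one position takes runner `i` to runner `i + 1`, except that the last runner
  -- becomes the first, one row higher and with the new bead beneath it.
  rotated-charges : ∀ n f → f 0 ≡ true → Vanishes (n * e) (f ∘ suc) →
    charges (suc n) f ≡ suc (count n (column (f ∘ suc) (suc e′))) ∷ applyUpTo (λ i → count n (column (f ∘ suc) i)) (suc e′)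
  rotated-charges n f f0 v = cong₂ _∷_ (cong (λ b → ⟦ b ⟧ + count n (column (f ∘ suc) (suc e′))) f0)
    (applyUpTo-cong (suc e′) λ i _ →
      trans (cong (λ m → count m (column (f ∘ suc) i)) (+-comm 1 n)) (count-extend n 1 (column-vanishes i v)))

  rotated-energy : ∀ n f → Vanishes (n * e) (f ∘ suc) →
    totalEnergy (suc n) f ≡ count n (column (f ∘ suc) (suc e′)) + totalEnergy n (f ∘ suc)
  rotated-energy n f v = begin
    count n L + energy n L + sum (applyUpTo (λ i → energy (suc n) (column g i)) (suc e′))
      ≡⟨ cong (λ es → count n L + energy n L + sum es) (applyUpTo-cong (suc e′) λ i _ →
           trans (cong (λ m → energy m (column g i)) (+-comm 1 n)) (energy-extend n 1 (column-vanishes i v))) ⟩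
    count n L + energy n L + sum (applyUpTo (λ i → energy n (column g i)) (suc e′))
      ≡⟨ lemma (count n L) (energy n L) _ ⟩
    count n L + (sum (applyUpTo (λ i → energy n (column g i)) (suc e′)) + energy n L)
      ≡⟨ cong (count n L +_) (sum-∷ʳ (applyUpTo (λ i → energy n (column g i)) (suc e′)) (energy n L)) ⟨
    count n L + sum (applyUpTo (λ i → energy n (column g i)) (suc e′) ∷ʳ energy n L)
      ≡⟨ cong (λ es → count n L + sum es) (applyUpTo-∷ʳ (λ i → energy n (column g i)) (suc e′)) ⟩
    count n L + totalEnergy n g ∎
    where
    open ≡-Reasoning
    g L : Beads
    g = f ∘ suc
    L = column g (suc e′)
    lemma : ∀ a b c → a + b + c ≡ a + (c + b)
    lemma = solve-∀

  -- The `x` beads of the wrapped runner rise by one row each, which is precisely the growth from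
  -- `tri x` to `tri (suc x)`; so the weight is unchanged.
  rotate-block : ∀ {n cs x w f} → f 0 ≡ true → InBlockAt n (cs ∷ʳ x) w (f ∘ suc) → InBlockAt (suc n) (suc x ∷ cs) w f
  rotate-block {n} {cs} {x} {w} {f} f0 b = inBlockAt v charges′ energy′
    where
    open InBlockAt b
    v : Vanishes (suc n * e) f
    v (suc t) (s≤s n≤t) = vanishes t (m+n≤o⇒n≤o (suc e′) n≤t)
    eqs = ∷ʳ-injective _ cs (trans (applyUpTo-∷ʳ (λ i → count n (column (f ∘ suc) i)) (suc e′)) charges≡)
    charges′ : charges (suc n) f ≡ suc x ∷ cs
    charges′ = trans (rotated-charges n f f0 vanishes) (cong₂ _∷_ (cong suc (proj₂ eqs)) (proj₁ eqs))
    energy′ : totalEnergy (suc n) f ≡ sum (map tri (suc x ∷ cs)) + w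
    energy′ = begin
      totalEnergy (suc n) f                                           ≡⟨ rotated-energy n f vanishes ⟩
      count n (column (f ∘ suc) (suc e′)) + totalEnergy n (f ∘ suc)   ≡⟨ cong₂ _+_ (proj₂ eqs) energy≡ ⟩
      x + (sum (map tri (cs ∷ʳ x)) + w)
        ≡⟨ cong (λ s → x + (s + w)) (trans (cong sum (map-++ tri cs [ x ])) (sum-∷ʳ (map tri cs) (tri x))) ⟩
      x + (sum (map tri cs) + tri x + w)                              ≡⟨ lemma x _ (tri x) w ⟩
      x + tri x + sum (map tri cs) + w                                ∎
      where
      open ≡-Reasoning
      lemma : ∀ a b c d → a + (b + c + d) ≡ a + c + b + d
      lemma = solve-∀

  unrotate-block : ∀ {n cs x w f} → f 0 ≡ true → InBlockAt n (suc x ∷ cs) w f → InBlockAt n (cs ∷ʳ x) w (f ∘ suc)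
  unrotate-block {n} {cs} {x} {w} {f} f0 b = inBlockAt v charges′ energy′
    where
    open InBlockAt b
    v : Vanishes (n * e) (f ∘ suc)
    v t n≤t = vanishes (suc t) (m≤n⇒m≤1+n n≤t)
    b⁺ : InBlockAt (suc n) (suc x ∷ cs) w f
    b⁺ = subst (λ m → InBlockAt m (suc x ∷ cs) w f) (+-comm n 1) (extend-block 1 b)
    eqs = ∷-injective (trans (sym (rotated-charges n f f0 v)) (InBlockAt.charges≡ b⁺))
    last : count n (column (f ∘ suc) (suc e′)) ≡ x
    last = suc-injective (proj₁ eqs)
    charges′ : charges n (f ∘ suc) ≡ cs ∷ʳ x
    charges′ = trans (sym (applyUpTo-∷ʳ (λ i → count n (column (f ∘ suc) i)) (suc e′))) (cong₂ _∷ʳ_ (proj₂ eqs) last)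
    energy′ : totalEnergy n (f ∘ suc) ≡ sum (map tri (cs ∷ʳ x)) + w
    energy′ = +-cancelˡ-≡ x _ _ (begin
      x + totalEnergy n (f ∘ suc)          ≡⟨ cong (_+ totalEnergy n (f ∘ suc)) last ⟨
      count n (column (f ∘ suc) (suc e′)) + totalEnergy n (f ∘ suc)  ≡⟨ rotated-energy n f v ⟨
      totalEnergy (suc n) f                ≡⟨ InBlockAt.energy≡ b⁺ ⟩
      x + tri x + sum (map tri cs) + w     ≡⟨ lemma x _ (tri x) w ⟨
      x + (sum (map tri cs) + tri x + w)
        ≡⟨ cong (λ s → x + (s + w)) (trans (cong sum (map-++ tri cs [ x ])) (sum-∷ʳ (map tri cs) (tri x))) ⟨
      x + (sum (map tri (cs ∷ʳ x)) + w)    ∎)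
      where
      open ≡-Reasoning
      lemma : ∀ a b c d → a + (b + c + d) ≡ a + c + b + d
      lemma = solve-∀

  -- A gap at position 0 would push all suc x beads of its runner up by one row,
  -- which costs more than the weight w.
  first-bead : ∀ {n cs x w f} → w ≤ x → InBlockAt n (suc x ∷ cs) w f → f 0 ≡ true
  first-bead {n} {cs} {x} {w} {f} w≤x b with f 0 in f0
  ... | true  = refl
  ... | false = contradiction energy≥ (<⇒≱ (begin-strict
    tri (suc x) + sum (map tri cs) + w        ≤⟨ +-monoʳ-≤ (tri (suc x) + sum (map tri cs)) w≤x ⟩
    tri (suc x) + sum (map tri cs) + x        <⟨ ≤-reflexive (lemma (tri (suc x)) _ x) ⟩
    suc x + tri (suc x) + sum (map tri cs)    ∎))
    where
    open ≤-Reasoning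
    b⁺ : InBlockAt (suc n) (suc x ∷ cs) w f
    b⁺ = subst (λ m → InBlockAt m (suc x ∷ cs) w f) (+-comm n 1) (extend-block 1 b)
    open InBlockAt b⁺
    eqs = ∷-injective charges≡
    tail : Beads
    tail = column f 0 ∘ suc
    tail≡ : count n tail ≡ suc x
    tail≡ = trans (cong (λ b → ⟦ b ⟧ + count n tail) (sym f0)) (proj₁ eqs)
    lemma : ∀ a b c → suc (a + b + c) ≡ suc c + a + b
    lemma = solve-∀
    energy≥ : suc x + tri (suc x) + sum (map tri cs) ≤ tri (suc x) + sum (map tri cs) + w
    energy≥ = begin
      suc x + tri (suc x) + sum (map tri cs)
        ≡⟨ cong₂ (λ c cs → c + tri c + sum (map tri cs)) (sym tail≡) (sym (proj₂ eqs)) ⟩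
      count n tail + tri (count n tail) + sum (map tri (applyUpTo (λ i → count (suc n) (column f (suc i))) (suc e′)))
        ≤⟨ +-mono-≤ (+-monoʳ-≤ (count n tail) (tri-count≤energy n tail))
             (sum-tri≤ (suc n) (λ i → column f (suc i)) (suc e′)) ⟩
      totalEnergy (suc n) f                ≡⟨ energy≡ ⟩
      tri (suc x) + sum (map tri cs) + w   ∎

  rotate-balanced : ∀ {f} → f 0 ≡ true → Balancedᶠ (f ∘ suc) → Balancedᶠ f
  rotate-balanced f0 bal zero    k fx fy = contradiction (trans (sym f0) fx) λ ()
  rotate-balanced {f} f0 bal (suc x) k fx fy =
    subst₂ (λ y z → y ≋ suc z) (sym (shift (x + k * e))) (sym (shift x)) (bal x k fx fy)
    where
    shift : ∀ x → gaps f (suc x) ≡ gaps (f ∘ suc) x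
    shift x = trans (gaps-tail f x) (cong (λ b → ⟦ not b ⟧ + gaps (f ∘ suc) x) f0)

  unrotate-balanced : ∀ {f} → f 0 ≡ true → Balancedᶠ f → Balancedᶠ (f ∘ suc)
  unrotate-balanced {f} f0 bal x k fx fy =
    subst₂ (λ y z → y ≋ suc z) (shift (x + k * e)) (shift x) (bal (suc x) k fx fy)
    where
    shift : ∀ x → gaps f (suc x) ≡ gaps (f ∘ suc) x
    shift x = trans (gaps-tail f x) (cong (λ b → ⟦ not b ⟧ + gaps (f ∘ suc) x) f0)

  rotate-↔ : ∀ cs {x w} → w ≤ x → Inverse (Config (cs ∷ʳ x) w) (Config (suc x ∷ cs) w)
  rotate-↔ cs {x} {w} w≤x = record
    { to        = λ { (f , (n , b) , bal) → true ◂ f , (suc n , rotate-block refl b) , rotate-balanced refl bal }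
    ; from      = λ { (f , (n , b) , bal) → f ∘ suc , (n , unrotate-block (first-bead w≤x b) b)
                                          , unrotate-balanced (first-bead w≤x b) bal }
    ; to-cong   = λ { eq zero → refl ; eq (suc t) → eq t }
    ; from-cong = λ eq t → eq (suc t)
    ; inverse   = (λ { {_ , (_ , b) , _} eq zero → sym (first-bead w≤x b) ; eq (suc t) → eq t })
                , (λ eq t → eq (suc t))
    }

  infix 4 _~[_]_
  _~[_]_ : List ℕ → ℕ → List ℕ → Set
  cs ~[ w ] cs′ = Inverse (Config cs w) (Config cs′ w)

  ~-sym : ∀ {w cs cs′} → cs ~[ w ] cs′ → cs′ ~[ w ] cs
  ~-sym = Symmetry.inverse

  ~-trans : ∀ {w cs cs′ cs″} → cs ~[ w ] cs′ → cs′ ~[ w ] cs″ → cs ~[ w ] cs″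
  ~-trans = Compose.inverse

  ~-reflexive : ∀ {w cs cs′} → cs ≡ cs′ → cs ~[ w ] cs′
  ~-reflexive refl = Identity.inverse _

  module _ {w : ℕ} where

    -- Rotating back afterwards takes the added ones away again, so that moves available only at the
    -- front can be carried out anywhere.
    rotate-all : ∀ as bs → All (w ≤_) bs → as ++ bs ~[ w ] map suc bs ++ as
    rotate-all as []       []       = ~-reflexive (++-identityʳ as)
    rotate-all as (b ∷ bs) (p ∷ ps) =
      ~-trans (~-reflexive (sym (++-assoc as [ b ] bs)))
      (~-trans (rotate-all (as ∷ʳ b) bs ps)
      (~-trans (~-reflexive (sym (++-assoc (map suc bs) as [ b ])))
      (rotate-↔ (map suc bs ++ as) p)))

    swap-at : ∀ as x y bs → All (w ≤_) (x ∷ y ∷ bs) → as ++ x ∷ y ∷ bs ~[ w ] as ++ y ∷ x ∷ bs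
    swap-at as x y bs ps@(p ∷ q ∷ qs) =
      ~-trans (rotate-all as (x ∷ y ∷ bs) ps)
      (~-trans (exchange-↔ (suc x) (suc y) (map suc bs ++ as) w)
      (~-sym (rotate-all as (y ∷ x ∷ bs) (q ∷ p ∷ qs))))

    move-last : ∀ as x xs → All (w ≤_) (x ∷ xs) → as ++ x ∷ xs ~[ w ] (as ++ xs) ∷ʳ x
    move-last as x []       _              = ~-reflexive (cong (_∷ʳ x) (sym (++-identityʳ as)))
    move-last as x (y ∷ ys) ps@(p ∷ q ∷ qs) =
      ~-trans (swap-at as x y ys ps)
      (~-trans (~-reflexive (sym (++-assoc as [ y ] (x ∷ ys))))
      (~-trans (move-last (as ∷ʳ y) x ys (p ∷ qs))
      (~-reflexive (cong (_∷ʳ x) (++-assoc as [ y ] ys)))))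

    -- Sending a runner behind all others by exchanges leaves the charges as they are, whereas
    -- fetching it by a rotation adds a bead to it.
    raise-head : ∀ x xs → All (w ≤_) (x ∷ xs) → x ∷ xs ~[ w ] suc x ∷ xs
    raise-head x xs ps@(p ∷ _) = ~-trans (move-last [] x xs ps) (rotate-↔ xs p)

    raise-suc : ∀ as x bs → All (w ≤_) as → All (w ≤_) (x ∷ bs) → as ++ x ∷ bs ~[ w ] as ++ suc x ∷ bs
    raise-suc as x bs qs ps@(p ∷ ps′) =
      ~-trans (rotate-all as (x ∷ bs) ps)
      (~-trans (raise-head (suc x) (map suc bs ++ as)
        (m≤n⇒m≤1+n p ∷ All.++⁺ (All.map⁺ (All.map m≤n⇒m≤1+n ps′)) qs))
      (~-sym (rotate-all as (suc x ∷ bs) (m≤n⇒m≤1+n p ∷ ps′))))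

    raise-by : ∀ k as x bs → All (w ≤_) as → All (w ≤_) (x ∷ bs) → as ++ x ∷ bs ~[ w ] as ++ (k + x) ∷ bs
    raise-by zero    as x bs qs ps       = ~-reflexive refl
    raise-by (suc k) as x bs qs (p ∷ ps) = ~-trans (raise-by k as x bs qs (p ∷ ps))
      (raise-suc as (k + x) bs qs (≤-trans p (m≤n+m x k) ∷ ps))

    raise-all : ∀ as xs ks → length ks ≡ length xs → All (w ≤_) as → All (w ≤_) xs →
      as ++ xs ~[ w ] as ++ zipWith _+_ ks xs
    raise-all as []       []       _  qs ps       = ~-reflexive refl
    raise-all as (x ∷ xs) (k ∷ ks) eq qs (p ∷ ps) =
      ~-trans (raise-by k as x xs qs (p ∷ ps))
      (~-trans (~-reflexive (sym (++-assoc as [ k + x ] xs)))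
      (~-trans (raise-all (as ∷ʳ (k + x)) xs ks (suc-injective eq)
        (All.++⁺ qs (≤-trans p (m≤n+m x k) ∷ [])) ps)
      (~-reflexive (++-assoc as [ k + x ] (zipWith _+_ ks xs)))))

    -- Both lists are raised to their entrywise sum, which is reached from either side by raising
    -- alone.
    all-charges-equivalent : ∀ cs cs′ → length cs ≡ length cs′ → All (w ≤_) cs → All (w ≤_) cs′ → cs ~[ w ] cs′
    all-charges-equivalent cs cs′ eq ps qs =
      ~-trans (raise-all [] cs cs′ (sym eq) [] ps)
      (~-trans (~-reflexive (zipWith-comm _+_ +-comm cs′ cs))
      (~-sym (raise-all [] cs′ cs eq [] qs)))

-- Separated charges

-- The runner with p + n beads that encodes the partition (1ⁿ).
hookRunner : ℕ → ℕ → Beads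
hookRunner zero    n = false ◂ flat n
hookRunner (suc p) n = true ◂ hookRunner p n

hookRunner-vanishes : ∀ p n → Vanishes (suc (p + n)) (hookRunner p n)
hookRunner-vanishes zero    n (suc t) (s≤s n≤t) = flat-vanishes n t n≤t
hookRunner-vanishes (suc p) n (suc t) (s≤s q≤t) = hookRunner-vanishes p n t q≤t

count-hookRunner : ∀ {m} p n → p + n < m → count m (hookRunner p n) ≡ p + n
count-hookRunner zero    n (s≤s n≤m) = count-flat n n≤m
count-hookRunner (suc p) n (s≤s q≤m) = cong suc (count-hookRunner p n q≤m)

energy-hookRunner : ∀ {m} p n → p + n < m → energy m (hookRunner p n) ≡ tri (p + n) + n
energy-hookRunner zero    n (s≤s n≤m) = trans (cong₂ _+_ (count-flat n n≤m) (energy-flat n n≤m)) (+-comm n (tri n))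
energy-hookRunner (suc p) n (s≤s q≤m) =
  trans (cong₂ _+_ (count-hookRunner p n q≤m) (energy-hookRunner p n q≤m)) (sym (+-assoc (p + n) _ n))

-- No bead has two gaps below it: in terms of the encoded partition, every part is at most 1.
Solid : Beads → Set
Solid r = ∀ {t u v} → t < u → u < v → r t ≡ false → r v ≡ true → r u ≡ true

hookRunner-solid : ∀ p n → Solid (hookRunner p n)
hookRunner-solid zero    n {zero}  {suc u} {suc v} _ (s≤s u<v) _ rv =
  <ᵇ-true {u} {n} (<-trans u<v (<ᵇ-true⁻¹ {v} {n} rv))
hookRunner-solid zero    n {suc t} {suc u} {suc v} (s≤s t<u) (s≤s u<v) rt rv =
  <ᵇ-true {u} {n} (<-trans u<v (<ᵇ-true⁻¹ {v} {n} rv))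
hookRunner-solid (suc p) n {suc t} {suc u} {suc v} (s≤s t<u) (s≤s u<v) rt rv = hookRunner-solid p n t<u u<v rt rv

hookRunner-0-no-hook : ∀ p {t v} → t < v → hookRunner p 0 t ≡ false → hookRunner p 0 v ≢ true
hookRunner-0-no-hook zero    {_}     {suc v} _         _  ()
hookRunner-0-no-hook (suc p) {suc t} {suc v} (s≤s t<v) rt rv = hookRunner-0-no-hook p t<v rt rv

solid-characterization : ∀ m {r} → Vanishes m r → Solid r →
  ∃₂ λ p n → p + n ≡ count m r × r ≗ hookRunner p n
solid-characterization zero    v solid = 0 , 0 , refl , λ { zero → v 0 z≤n ; (suc t) → v (suc t) z≤n }
solid-characterization (suc m) {r} v solid with r 0 in r0
... | false = 0 , count m (r ∘ suc) , refl , λ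
  { zero → r0 ; (suc t) → flat-characterization m (vanishes-tail v) stays t }
  where
  stays : ∀ t → r (suc t) ≡ false → r (suc (suc t)) ≡ false
  stays t rt with r (suc (suc t)) in eq
  ... | false = refl
  ... | true  = contradiction (trans (sym rt) (solid z<s ≤-refl r0 eq)) λ ()
... | true with solid-characterization m (vanishes-tail v) (λ t<u u<v → solid (s<s t<u) (s<s u<v))
...   | p , n , eq , r≗ = suc p , n , cong suc eq , λ { zero → r0 ; (suc t) → r≗ t }

-- At most `t` beads lie below the gap; each of the others sits at least one row above its place in
-- the tightest packing, whose energy is `tri (count m r)`.
gap-bound : ∀ m {r t} → Vanishes m r → r t ≡ false → count m r + tri (count m r) ≤ t + energy m r
gap-bound zero    v rt = z≤n
gap-bound (suc m) {r} {zero} v rt rewrite rt = +-monoʳ-≤ (count m (r ∘ suc)) (tri-count≤energy m (r ∘ suc))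
gap-bound (suc m) {r} {suc t} v rt with r 0 | gap-bound m {r ∘ suc} {t} (vanishes-tail v) rt
... | true  | ih = s≤s (begin
  c + (c + tri c)  ≤⟨ +-monoʳ-≤ c ih ⟩
  c + (t + E)      ≡⟨ x∙yz≈y∙xz c t E ⟩
  t + (c + E)      ∎)
  where
  open ≤-Reasoning
  c = count m (r ∘ suc)
  E = energy m (r ∘ suc)
... | false | ih = ≤-trans ih (≤-trans (+-monoʳ-≤ t (m≤n+m _ _)) (n≤1+n _))

-- With `c` beads in all, those other than the one at `t` have energy at least `tri (c ∸ 1)`, and
-- `tri c` exceeds this by `c ∸ 1`.
bead-bound : ∀ m {r t} → Vanishes m r → r t ≡ true → t + tri (count m r) < count m r + energy m r
bead-bound zero    {r} {t} v rt = contradiction (trans (sym rt) (v t z≤n)) λ ()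
bead-bound (suc m) {r} {zero} v rt rewrite rt =
  s≤s (+-monoʳ-≤ (count m (r ∘ suc)) (≤-trans (tri-count≤energy m (r ∘ suc)) (m≤n+m _ _)))
bead-bound (suc m) {r} {suc t} v rt with r 0 | bead-bound m {r ∘ suc} {t} (vanishes-tail v) rt
... | true  | ih = s<s (begin-strict
  t + (c + tri c)  ≡⟨ x∙yz≈y∙xz t c (tri c) ⟩
  c + (t + tri c)  <⟨ +-monoʳ-< c ih ⟩
  c + (c + E)      ∎)
  where
  open ≤-Reasoning
  c = count m (r ∘ suc)
  E = energy m (r ∘ suc)
... | false | ih = begin-strict
  suc t + tri c    ≤⟨ ih ⟩
  c + E            <⟨ +-monoʳ-< c (m<n+m E (count-positive m (vanishes-tail v) rt)) ⟩
  c + (c + E)      ∎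
  where
  open ≤-Reasoning
  c = count m (r ∘ suc)
  E = energy m (r ∘ suc)
  count-positive : ∀ m {r t} → Vanishes m r → r t ≡ true → 0 < count m r
  count-positive zero    {t = t} v rt = contradiction (trans (sym rt) (v t z≤n)) λ ()
  count-positive (suc m) {t = zero}  v rt rewrite rt = z<s
  count-positive (suc m) {r} {suc t} v rt = ≤-trans (count-positive m (vanishes-tail v) rt) (m≤n+m _ ⟦ r 0 ⟧)

bead-run : ∀ f x m → (∀ i → i < m → f (i + x) ≡ true) → gaps f (m + x) ≡ gaps f x
bead-run f x zero    run = refl
bead-run f x (suc m) run = trans
  (cong₂ (λ g b → g + ⟦ not b ⟧) (bead-run f x m (λ i i<m → run i (m<n⇒m<1+n i<m))) (run m ≤-refl)) (+-identityʳ _)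

gap-run : ∀ f x m → (∀ i → i < m → f (i + x) ≡ false) → gaps f (m + x) ≡ m + gaps f x
gap-run f x zero    run = refl
gap-run f x (suc m) run = trans
  (cong₂ (λ g b → g + ⟦ not b ⟧) (gap-run f x m (λ i i<m → run i (m<n⇒m<1+n i<m))) (run m ≤-refl)) (+-comm _ 1)

sum-applyDownFrom : ∀ f n → sum (applyDownFrom f n) ≡ sum (applyUpTo f n)
sum-applyDownFrom f zero    = refl
sum-applyDownFrom f (suc n) = begin
  f n + sum (applyDownFrom f n)  ≡⟨ cong (f n +_) (sum-applyDownFrom f n) ⟩
  f n + sum (applyUpTo f n)      ≡⟨ +-comm (f n) _ ⟩
  sum (applyUpTo f n) + f n      ≡⟨ sum-∷ʳ (applyUpTo f n) (f n) ⟨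
  sum (applyUpTo f n ∷ʳ f n)     ≡⟨ cong sum (applyUpTo-∷ʳ f n) ⟩
  sum (applyUpTo f (suc n))      ∎
  where open ≡-Reasoning

sum-applyUpTo-+ : ∀ f g n → sum (applyUpTo (λ i → f i + g i) n) ≡ sum (applyUpTo f n) + sum (applyUpTo g n)
sum-applyUpTo-+ f g zero    = refl
sum-applyUpTo-+ f g (suc n) = trans (cong (f 0 + g 0 +_) (sum-applyUpTo-+ (f ∘ suc) (g ∘ suc) n))
  (interchange (f 0) (g 0) _ _)

term≤sum : ∀ f n i → i < n → f i ≤ sum (applyUpTo f n)
term≤sum f (suc n) zero    _         = m≤m+n _ _
term≤sum f (suc n) (suc i) (s≤s i<n) = ≤-trans (term≤sum (f ∘ suc) n i i<n) (m≤n+m _ _)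

applyUpTo-injective : ∀ {a} {A : Set a} {f g : ℕ → A} n → applyUpTo f n ≡ applyUpTo g n → ∀ i → i < n → f i ≡ g i
applyUpTo-injective (suc n) eq zero    _         = proj₁ (∷-injective eq)
applyUpTo-injective {f = f} {g} (suc n) eq (suc i) (s≤s i<n) =
  applyUpTo-injective {f = f ∘ suc} {g ∘ suc} n (proj₂ (∷-injective eq)) i i<n

applyDownFrom-cong : ∀ {a} {A : Set a} {f g : ℕ → A} n → (∀ i → i < n → f i ≡ g i) →
  applyDownFrom f n ≡ applyDownFrom g n
applyDownFrom-cong zero    eq = refl
applyDownFrom-cong (suc n) eq = cong₂ _∷_ (eq n ≤-refl) (applyDownFrom-cong n (λ i i<n → eq i (m<n⇒m<1+n i<n)))

-- Entries are numbered from the end, so that prepending the entry of a new runner leaves the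
-- numbers of the others unchanged.
value : List ℕ → ℕ → ℕ
value []       k = 0
value (n ∷ ns) k with k ≟ length ns
... | yes _ = n
... | no  _ = value ns k

value-last : ∀ n ns → value (n ∷ ns) (length ns) ≡ n
value-last n ns with length ns ≟ length ns
... | yes _ = refl
... | no ¬p = contradiction refl ¬p

value-init : ∀ n ns {k} → k < length ns → value (n ∷ ns) k ≡ value ns k
value-init n ns {k} k<l with k ≟ length ns
... | yes p = contradiction p (<⇒≢ k<l)
... | no _  = refl

applyDownFrom-value : ∀ ns → applyDownFrom (value ns) (length ns) ≡ ns
applyDownFrom-value []       = refl
applyDownFrom-value (n ∷ ns) = cong₂ _∷_ (value-last n ns)
  (trans (applyDownFrom-cong (length ns) (λ i → value-init n ns)) (applyDownFrom-value ns))

value-applyDownFrom : ∀ f n k → k < n → value (applyDownFrom f n) k ≡ f k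
value-applyDownFrom f (suc n) k k<1+n with k ≟ length (applyDownFrom f n)
... | yes refl = cong f (sym (length-applyDownFrom f n))
... | no k≢    = value-applyDownFrom f n k (≤∧≢⇒< (s≤s⁻¹ k<1+n) (k≢ ∘ λ p → trans p (sym (length-applyDownFrom f n))))

-- Balanced configurations with separated charges as compositions.

module Supports (d : ℕ) where

  -- Read from the top: the entry in front of ns has index length ns.
  Supported : List ℕ → Set
  Supported []       = ⊤
  Supported (n ∷ ns) = (n ≢ 0 → d ∣ length ns) × Supported ns

  Composition : ℕ → ℕ → List ℕ → Set
  Composition k w ns = length ns ≡ k × sum ns ≡ w × Supported ns

  supported-applyDownFrom : ∀ f n → (∀ k → k < n → f k ≢ 0 → d ∣ k) → Supported (applyDownFrom f n)
  supported-applyDownFrom f zero    h = tt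
  supported-applyDownFrom f (suc n) h =
    (λ fn≢0 → subst (d ∣_) (sym (length-applyDownFrom f n)) (h n ≤-refl fn≢0)) ,
    supported-applyDownFrom f n (λ k k<n → h k (m<n⇒m<1+n k<n))

  supported-value : ∀ ns → Supported ns → ∀ k → k < length ns → value ns k ≢ 0 → d ∣ k
  supported-value (n ∷ ns) (h , s) k k<1+l v≢0 with k ≟ length ns
  ... | yes refl = h v≢0
  ... | no k≢    = supported-value ns s k (≤∧≢⇒< (s≤s⁻¹ k<1+l) k≢) v≢0

module Separated (d e′ w : ℕ) (1<d : 1 < d) where
  open Abacus d e′
  open Exchange d e′ 1<d using (fromRows; column-fromRows; vanishes-rows)
  open Supports d

  -- At weight w only the rows in [zone k, zone (suc k)) of runner k can vary, and
  -- these ranges are disjoint.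
  zone charge : ℕ → ℕ
  zone k   = k * (w + w)
  charge k = zone k + w

  separatedCharges : List ℕ
  separatedCharges = applyUpTo charge e

  zone-mono : ∀ {k l} → k ≤ l → zone k ≤ zone l
  zone-mono = *-monoˡ-≤ (w + w)

  record Zoned (f : Beads) : Set where
    field
      below : ∀ k t → k < e → t < zone k → column f k t ≡ true
      above : ∀ k t → k < e → zone (suc k) ≤ t → column f k t ≡ false

  module _ {f : Beads} (Z : Zoned f) where
    open Zoned Z

    -- While runner `k` is in its zone, the runners after it are still full in row `t` and the `k`
    -- runners before it are already empty in row `suc t`.
    zoned-step : ∀ k t → k < e → zone k ≤ t → t < zone (suc k) →
      gaps f (k + suc t * e) ≡ k + (gaps f (k + t * e) + ⟦ not (column f k t) ⟧)
    zoned-step k t k<e z≤t t<z = begin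
      gaps f (k + suc t * e)                                ≡⟨ gap-run f (suc t * e) k before ⟩
      k + gaps f (e + t * e)                                ≡⟨ cong (λ x → k + gaps f x) split ⟩
      k + gaps f ((e ∸ suc k) + (suc k + t * e))            ≡⟨ cong (k +_) (bead-run f (suc k + t * e) (e ∸ suc k) after) ⟩
      k + (gaps f (k + t * e) + ⟦ not (column f k t) ⟧)     ∎
      where
      open ≡-Reasoning
      before : ∀ i → i < k → f (i + suc t * e) ≡ false
      before i i<k = above i (suc t) (<-trans i<k k<e) (≤-trans (zone-mono i<k) (m≤n⇒m≤1+n z≤t))
      split : e + t * e ≡ (e ∸ suc k) + (suc k + t * e)
      split = trans (cong (_+ t * e) (sym (m∸n+n≡m k<e))) (+-assoc (e ∸ suc k) (suc k) (t * e))
      after : ∀ i → i < e ∸ suc k → f (i + (suc k + t * e)) ≡ true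
      after i i< = trans (cong f (sym (+-assoc i (suc k) (t * e))))
        (below (i + suc k) t (m<n∸o⇒m+o<n i<) (<-≤-trans t<z (zone-mono (m≤n+m (suc k) i))))
        where
        m<n∸o⇒m+o<n : i < e ∸ suc k → i + suc k < e
        m<n∸o⇒m+o<n p = subst (i + suc k <_) (m∸n+n≡m k<e) (+-monoˡ-< (suc k) p)

    zone-of-gap : ∀ {k t} → k < e → column f k t ≡ false → zone k ≤ t
    zone-of-gap {k} {t} k<e ft = ≮⇒≥ λ t<z → contradiction (trans (sym ft) (below k t k<e t<z)) λ ()

    zone-of-bead : ∀ {k t} → k < e → column f k t ≡ true → t < zone (suc k)
    zone-of-bead {k} {t} k<e ft = ≰⇒> λ z≤t → contradiction (trans (sym (above k t k<e z≤t)) ft) λ ()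

    ≋-multiple : ∀ {k a b} → d ∣ k → a ≋ b → k + a ≋ b
    ≋-multiple {k} {a} d∣k a≋b = ≋-trans (∣∸⇒≋ (m≤n+m _ k) (subst (d ∣_) (sym (m+n∸n≡m k a)) d∣k)) a≋b

    -- After a gap the gap count stays congruent along a run of beads of the
    -- same runner, because each row contributes k further gaps.
    solid-run : ∀ k t j → k < e → d ∣ k → column f k t ≡ false → j + t < zone (suc k) →
      (∀ u → t < u → u ≤ j + t → column f k u ≡ true) →
      gaps f (k + suc (j + t) * e) ≋ suc (gaps f (k + t * e))
    solid-run k t zero k<e d∣k ft j<z run =
      subst (_≋ suc (gaps f (k + t * e))) (sym (zoned-step k t k<e (zone-of-gap k<e ft) j<z))
        (≋-multiple d∣k (≋-reflexive (trans (cong (λ b → gaps f (k + t * e) + ⟦ not b ⟧) ft) (+-comm _ 1))))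
    solid-run k t (suc j) k<e d∣k ft j<z run =
      subst (_≋ suc (gaps f (k + t * e)))
        (sym (zoned-step k (suc j + t) k<e (≤-trans (zone-of-gap k<e ft) (m≤n+m t (suc j))) j<z))
        (≋-multiple d∣k (≋-trans
          (≋-reflexive (trans (cong (λ b → gaps f (k + (suc j + t) * e) + ⟦ not b ⟧) (run (suc j + t) (s≤s (m≤n+m t j)) ≤-refl)) (+-identityʳ _)))
          (solid-run k t j k<e d∣k ft (<-trans (n<1+n _) j<z) (λ u t<u u≤ → run u t<u (m≤n⇒m≤1+n u≤)))))

    solid⇒balanced : (∀ k → k < e → Solid (column f k)) →
      (∀ k t v → k < e → t < v → column f k t ≡ false → column f k v ≡ true → d ∣ k) → Balancedᶠ f
    solid⇒balanced solid div = rowBalanced⇒balanced λ k t v k<e t<v ft fv →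
      let j , eq = m<n⇒1+[n-m]≡ t<v in
      subst (λ v → gaps f (k + v * e) ≋ suc (gaps f (k + t * e))) eq
        (solid-run k t j k<e (div k t v k<e t<v ft fv) ft
          (<-trans (subst (j + t <_) eq ≤-refl) (zone-of-bead k<e fv))
          (λ u t<u u≤ → solid k k<e t<u (subst (u <_) eq (s≤s u≤)) ft fv))
      where
      m<n⇒1+[n-m]≡ : ∀ {m n} → m < n → ∃ λ j → suc (j + m) ≡ n
      m<n⇒1+[n-m]≡ {m} {n} m<n = n ∸ suc m , trans (sym (+-suc (n ∸ suc m) m)) (m∸n+n≡m m<n)

    adjacent-hook : ∀ k j t → column f k t ≡ false → column f k (suc (j + t)) ≡ true →
      ∃ λ u → column f k u ≡ false × column f k (suc u) ≡ true
    adjacent-hook k zero    t ft fv = t , ft , fv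
    adjacent-hook k (suc j) t ft fv with column f k (suc t) in eq
    ... | true  = t , ft , eq
    ... | false = adjacent-hook k j (suc t) eq (trans (cong (λ v → column f k (suc v)) (+-suc j t)) fv)

    -- Somewhere along the hook a gap is directly followed by a bead of its runner. That shorter
    -- hook crosses a single row, hence `k` gaps besides its own, and balance makes `k` divisible by
    -- `d`.
    hook⇒divides : Balancedᶠ f → ∀ k t v → k < e → t < v → column f k t ≡ false → column f k v ≡ true → d ∣ k
    hook⇒divides bal k t v k<e t<v ft fv
      with adjacent-hook k (v ∸ suc t) t ft (trans (cong (column f k) (trans (sym (+-suc (v ∸ suc t) t)) (m∸n+n≡m t<v))) fv)
    ... | u , fu , fsu = subst (d ∣_) (m+n∸n≡m k (suc g)) (≋⇒∣∸ (m≤n+m (suc g) k) cong-g)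
      where
      g = gaps f (k + u * e)
      step : gaps f (k + suc u * e) ≡ k + suc g
      step = trans (zoned-step k u k<e (zone-of-gap k<e fu) (<-trans (n<1+n u) (zone-of-bead k<e fsu)))
        (cong (k +_) (trans (cong (λ b → g + ⟦ not b ⟧) fu) (+-comm g 1)))
      cong-g : k + suc g ≋ suc g
      cong-g = subst (_≋ suc g) step (balanced⇒rowBalanced bal k u (suc u) k<e ≤-refl fu fsu)

    -- Let `x` be the first further gap between the gap `t` and the bead `v`. The hooks from `t` and
    -- from `x` to `v` make the gap counts at `t` and `x` congruent, but by `solid-run` the count at
    -- `x` is congruent to one more than that at `t`.
    balanced⇒solid : Balancedᶠ f → ∀ k → k < e → Solid (column f k)
    balanced⇒solid bal k k<e {t} {u} {v} t<u u<v ft fv = go (u ∸ suc t) u u≡ u<v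
      where
      row-bal = balanced⇒rowBalanced bal
      d∣k = hook⇒divides bal k t v k<e (<-trans t<u u<v) ft fv
      u≡ : u ≡ suc (u ∸ suc t + t)
      u≡ = sym (trans (sym (+-suc (u ∸ suc t) t)) (m∸n+n≡m t<u))
      upTo : ∀ j → suc (j + t) ≤ v → ∀ x → t < x → x < suc (j + t) → column f k x ≡ true
      go : ∀ j x → x ≡ suc (j + t) → x < v → column f k x ≡ true
      go j x refl x<v with column f k x in fx
      ... | true  = refl
      ... | false = contradiction
        (≋-trans (≋-sym (solid-run k t j k<e d∣k ft (<-trans (n<1+n _) (<-trans x<v (zone-of-bead k<e fv)))
                          (λ y t<y y≤ → upTo j (<⇒≤ x<v) y t<y (s≤s y≤))))
                 (≋-suc⁻¹ (≋-trans (≋-sym (row-bal k x v k<e x<v fx fv))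
                                   (row-bal k t v k<e (<-trans t<u u<v) ft fv))))
        (suc-≋̸ 1<d)
      upTo zero    _  x t<x x<1+t = contradiction t<x (<⇒≱ x<1+t)
      upTo (suc j) j<v x t<x x<   with m≤n⇒m<n∨m≡n (s≤s⁻¹ x<)
      ... | inj₁ x<′ = upTo j (<⇒≤ j<v) x t<x x<′
      ... | inj₂ x≡  = go j x x≡ (subst (_< v) (sym x≡) j<v)

  sum-bounded : ∀ f g n → (∀ i → i < n → f i ≤ g i) → sum (applyUpTo g n) ≡ sum (applyUpTo f n) + w →
    sum (applyUpTo (λ i → g i ∸ f i) n) ≡ w
  sum-bounded f g n f≤g eq = +-cancelˡ-≡ (sum (applyUpTo f n)) _ _ (begin
    sum (applyUpTo f n) + sum (applyUpTo (λ i → g i ∸ f i) n)  ≡⟨ sum-applyUpTo-+ f (λ i → g i ∸ f i) n ⟨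
    sum (applyUpTo (λ i → f i + (g i ∸ f i)) n)
      ≡⟨ cong sum (applyUpTo-cong n (λ i i<n → m+[n∸m]≡n (f≤g i i<n))) ⟩
    sum (applyUpTo g n)                                        ≡⟨ eq ⟩
    sum (applyUpTo f n) + w                                    ∎)
    where open ≡-Reasoning

  weight : ℕ → Beads → ℕ → ℕ
  weight n f k = energy n (column f k) ∸ tri (charge k)

  module _ {n f} (b : InBlockAt n separatedCharges w f) where
    open InBlockAt b

    count-column : ∀ k → k < e → count n (column f k) ≡ charge k
    count-column = applyUpTo-injective e charges≡

    tri≤energy : ∀ k → k < e → tri (charge k) ≤ energy n (column f k)
    tri≤energy k k<e = subst (λ c → tri c ≤ energy n (column f k)) (count-column k k<e) (tri-count≤energy n (column f k))

    sum-weight : sum (applyUpTo (weight n f) e) ≡ w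
    sum-weight = sum-bounded (tri ∘ charge) (λ i → energy n (column f i)) e tri≤energy
      (trans energy≡ (cong (λ cs → sum cs + w) (map-applyUpTo charge tri e)))

    energy-bound : ∀ k → k < e → energy n (column f k) ≤ tri (charge k) + w
    energy-bound k k<e = subst (_≤ tri (charge k) + w) (m+[n∸m]≡n (tri≤energy k k<e))
      (+-monoʳ-≤ (tri (charge k)) (subst (weight n f k ≤_) sum-weight (term≤sum (weight n f) e k k<e)))

    -- The excess energy of a single runner is at most `w`. So `gap-bound` puts every gap at or
    -- above `charge k ∸ w`, and `bead-bound` puts every bead below `charge k + w`; these are the
    -- ends of the zone.
    separated-zoned : Zoned f
    separated-zoned = record { below = below ; above = above }
      where
      open ≤-Reasoning
      below : ∀ k t → k < e → t < zone k → column f k t ≡ true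
      below k t k<e t<z with column f k t in ft
      ... | true  = refl
      ... | false = contradiction (+-cancelʳ-≤ (w + tri (charge k)) _ _ (begin
        zone k + (w + tri (charge k))     ≡⟨ +-assoc (zone k) w _ ⟨
        charge k + tri (charge k)
          ≤⟨ subst (λ c → c + tri c ≤ t + energy n (column f k)) (count-column k k<e)
               (gap-bound n (column-vanishes k vanishes) ft) ⟩
        t + energy n (column f k)         ≤⟨ +-monoʳ-≤ t (energy-bound k k<e) ⟩
        t + (tri (charge k) + w)          ≡⟨ cong (t +_) (+-comm _ w) ⟩
        t + (w + tri (charge k))          ∎)) (<⇒≱ t<z)
      above : ∀ k t → k < e → zone (suc k) ≤ t → column f k t ≡ false
      above k t k<e z≤t with column f k t in ft
      ... | false = refl
      ... | true  = contradiction (+-cancelʳ-< (tri (charge k)) _ _ (begin-strict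
        t + tri (charge k)
          <⟨ subst (λ c → t + tri c < c + energy n (column f k)) (count-column k k<e)
               (bead-bound n (column-vanishes k vanishes) ft) ⟩
        charge k + energy n (column f k)  ≤⟨ +-monoʳ-≤ (charge k) (energy-bound k k<e) ⟩
        charge k + (tri (charge k) + w)   ≡⟨ lemma (zone k) w (tri (charge k)) ⟩
        zone (suc k) + tri (charge k)     ∎)) (≤⇒≯ z≤t)
        where
        lemma : ∀ z w t → z + w + (t + w) ≡ w + w + z + t
        lemma = solve-∀

    module _ (bal : Balancedᶠ f) where

      -- Solidity leaves the two parameters of the runner open. The charge is their sum, and the
      -- excess energy is the second one, because each of its `n` beads is raised by one row.
      column-shape : ∀ k → k < e → column f k ≗ hookRunner (charge k ∸ weight n f k) (weight n f k)
      column-shape k k<e with solid-characterization n (column-vanishes k vanishes) (balanced⇒solid separated-zoned bal k k<e)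
      ... | p , m , p+m≡ , f≗ = λ t → trans (f≗ t) (cong₂ (λ p m → hookRunner p m t) p≡ m≡)
        where
        p+m≡charge = trans p+m≡ (count-column k k<e)
        energy≡′ : energy n (column f k) ≡ tri (charge k) + m
        energy≡′ = begin
          energy n (column f k)                    ≡⟨ energy-unique (column-vanishes {n} k vanishes) (hookRunner-vanishes p m) f≗ ⟩
          energy (suc (p + m)) (hookRunner p m)    ≡⟨ energy-hookRunner p m ≤-refl ⟩
          tri (p + m) + m                          ≡⟨ cong (λ c → tri c + m) p+m≡charge ⟩
          tri (charge k) + m                       ∎
          where open ≡-Reasoning
        m≡ : m ≡ weight n f k
        m≡ = sym (trans (cong (_∸ tri (charge k)) energy≡′) (m+n∸m≡n (tri (charge k)) m))
        p≡ : p ≡ charge k ∸ weight n f k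
        p≡ = sym (trans (cong₂ _∸_ (sym p+m≡charge) (sym m≡)) (m+n∸n≡m p m))

      weight-divides : ∀ k → k < e → weight n f k ≢ 0 → d ∣ k
      weight-divides k k<e wt≢0 with weight n f k in eq
      ... | zero  = contradiction refl wt≢0
      ... | suc m = hook⇒divides separated-zoned bal k p (suc p) k<e ≤-refl
        (trans (shape p) (gap-at p)) (trans (shape (suc p)) (bead-at p))
        where
        p : ℕ
        p = charge k ∸ suc m
        shape : column f k ≗ hookRunner p (suc m)
        shape t = trans (column-shape k k<e t) (cong (λ m → hookRunner (charge k ∸ m) m t) eq)
        gap-at : ∀ p → hookRunner p (suc m) p ≡ false
        gap-at zero    = refl
        gap-at (suc p) = gap-at p
        bead-at : ∀ p → hookRunner p (suc m) (suc p) ≡ true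
        bead-at zero    = refl
        bead-at (suc p) = bead-at p

  module _ (ns : List ℕ) (comp : Composition e w ns) where

    private
      length≡ = proj₁ comp
      sum≡ = proj₁ (proj₂ comp)
      supp = proj₂ (proj₂ comp)

    cells : ℕ → Beads
    cells k = hookRunner (charge k ∸ value ns k) (value ns k)

    configOf : Beads
    configOf = fromRows cells

    sum-value : sum (applyUpTo (value ns) e) ≡ w
    sum-value = begin
      sum (applyUpTo (value ns) e)                ≡⟨ sum-applyDownFrom (value ns) e ⟨
      sum (applyDownFrom (value ns) e)            ≡⟨ cong (λ m → sum (applyDownFrom (value ns) m)) length≡ ⟨
      sum (applyDownFrom (value ns) (length ns))  ≡⟨ cong sum (applyDownFrom-value ns) ⟩
      sum ns                                      ≡⟨ sum≡ ⟩
      w                                           ∎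
      where open ≡-Reasoning

    value≤w : ∀ k → k < e → value ns k ≤ w
    value≤w k k<e = subst (value ns k ≤_) sum-value (term≤sum (value ns) e k k<e)

    value-split : ∀ k → k < e → charge k ∸ value ns k + value ns k ≡ charge k
    value-split k k<e = m∸n+n≡m (≤-trans (value≤w k k<e) (m≤n+m w (zone k)))

    -- This explains the cut-off `suc (zone e)`: no charge exceeds `zone e`, and a runner of shape
    -- `(1ⁿ)` reaches one row further than a packed one.
    charge<zone : ∀ k → k < e → charge k < suc (zone e)
    charge<zone k k<e = s≤s (≤-trans (subst (_≤ zone (suc k)) (+-comm w (zone k)) (+-monoˡ-≤ (zone k) (m≤m+n w w)))
                                     (zone-mono k<e))

    configOf-block : InBlockAt (suc (zone e)) separatedCharges w configOf
    configOf-block = inBlockAt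
      (vanishes-rows λ k k<e → vanishes-≗ (λ t → sym (column-fromRows cells t k<e))
        (vanishes-mono (subst (_≤ suc (zone e)) (cong suc (sym (value-split k k<e))) (charge<zone k k<e))
          (hookRunner-vanishes (charge k ∸ value ns k) (value ns k))))
      (applyUpTo-cong e λ k k<e → trans (count-cong (suc (zone e)) (λ t _ → column-fromRows cells t k<e))
        (trans (count-hookRunner (charge k ∸ value ns k) (value ns k) (bound k k<e)) (value-split k k<e)))
      (begin
        totalEnergy (suc (zone e)) configOf
          ≡⟨ cong sum (applyUpTo-cong e configOf-energy) ⟩
        sum (applyUpTo (λ k → tri (charge k) + value ns k) e)
          ≡⟨ sum-applyUpTo-+ (tri ∘ charge) (value ns) e ⟩
        sum (applyUpTo (tri ∘ charge) e) + sum (applyUpTo (value ns) e)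
          ≡⟨ cong₂ _+_ (cong sum (sym (map-applyUpTo charge tri e))) sum-value ⟩
        sum (map tri separatedCharges) + w ∎)
      where
      open ≡-Reasoning
      bound : ∀ k → k < e → charge k ∸ value ns k + value ns k < suc (zone e)
      bound k k<e = subst (_< suc (zone e)) (sym (value-split k k<e)) (charge<zone k k<e)
      configOf-energy : ∀ k → k < e → energy (suc (zone e)) (column configOf k) ≡ tri (charge k) + value ns k
      configOf-energy k k<e = trans (energy-cong (suc (zone e)) (λ t _ → column-fromRows cells t k<e))
        (trans (energy-hookRunner (charge k ∸ value ns k) (value ns k) (bound k k<e))
               (cong (λ c → tri c + value ns k) (value-split k k<e)))

    weight-configOf : ∀ k → k < e → weight (suc (zone e)) configOf k ≡ value ns k
    weight-configOf k k<e = begin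
      energy (suc (zone e)) (column configOf k) ∸ tri (charge k)
        ≡⟨ cong (_∸ tri (charge k)) (trans (energy-cong (suc (zone e)) (λ t _ → column-fromRows cells t k<e))
             (energy-hookRunner (charge k ∸ value ns k) (value ns k)
               (subst (_< suc (zone e)) (sym (value-split k k<e)) (charge<zone k k<e)))) ⟩
      tri (charge k ∸ value ns k + value ns k) + value ns k ∸ tri (charge k)
        ≡⟨ cong (λ c → tri c + value ns k ∸ tri (charge k)) (value-split k k<e) ⟩
      tri (charge k) + value ns k ∸ tri (charge k)  ≡⟨ m+n∸m≡n (tri (charge k)) _ ⟩
      value ns k                                    ∎
      where open ≡-Reasoning

    configOf-balanced : Balancedᶠ configOf
    configOf-balanced = solid⇒balanced (separated-zoned configOf-block)
      (λ k k<e {t} {u} {v} t<u u<v ft fv → trans (column≗ k k<e u)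
        (hookRunner-solid (charge k ∸ value ns k) (value ns k) t<u u<v
          (trans (sym (column≗ k k<e t)) ft) (trans (sym (column≗ k k<e v)) fv)))
      (λ k t v k<e t<v ft fv → supported-value ns supp k (subst (k <_) (sym length≡) k<e)
        (λ v≡0 → hookRunner-0-no-hook (charge k ∸ value ns k) {t} {v} t<v
          (trans (cong (λ m → hookRunner (charge k ∸ value ns k) m t) (sym v≡0)) (trans (sym (column≗ k k<e t)) ft))
          (trans (cong (λ m → hookRunner (charge k ∸ value ns k) m v) (sym v≡0)) (trans (sym (column≗ k k<e v)) fv))))
      where
      column≗ : ∀ k → k < e → column configOf k ≗ cells k
      column≗ k k<e t = column-fromRows cells t k<e

  weights : ℕ → Beads → List ℕ
  weights n f = applyDownFrom (weight n f) e

  weights-composition : ∀ {n f} → InBlockAt n separatedCharges w f → Balancedᶠ f → Composition e w (weights n f)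
  weights-composition {n} {f} b bal = length-applyDownFrom (weight n f) e ,
    trans (sum-applyDownFrom (weight n f) e) (sum-weight b) ,
    supported-applyDownFrom (weight n f) e (weight-divides b bal)

  weights-cong : ∀ {n n′ f f′} → InBlockAt n separatedCharges w f → InBlockAt n′ separatedCharges w f′ →
    f ≗ f′ → weights n f ≡ weights n′ f′
  weights-cong {n} {n′} b b′ eq = applyDownFrom-cong e λ k _ → cong (_∸ tri (charge k))
    (energy-unique (column-vanishes {n} k (InBlockAt.vanishes b)) (column-vanishes {n′} k (InBlockAt.vanishes b′)) (λ t → eq _))

  weights-configOf : ∀ ns comp → weights (suc (zone e)) (configOf ns comp) ≡ ns
  weights-configOf ns comp = begin
    applyDownFrom (weight (suc (zone e)) (configOf ns comp)) e ≡⟨ applyDownFrom-cong e (weight-configOf ns comp) ⟩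
    applyDownFrom (value ns) e                      ≡⟨ cong (applyDownFrom (value ns)) (proj₁ comp) ⟨
    applyDownFrom (value ns) (length ns)            ≡⟨ applyDownFrom-value ns ⟩
    ns                                              ∎
    where open ≡-Reasoning

  configOf-weights : ∀ {n f} (b : InBlockAt n separatedCharges w f) (bal : Balancedᶠ f) ns comp →
    ns ≡ weights n f → configOf ns comp ≗ f
  configOf-weights {n} {f} b bal _ comp refl = ≗-rows λ k t k<e → begin
    column (configOf (weights n f) comp) k t  ≡⟨ column-fromRows (cells (weights n f) comp) t k<e ⟩
    hookRunner (charge k ∸ value (weights n f) k) (value (weights n f) k) t
      ≡⟨ cong (λ m → hookRunner (charge k ∸ m) m t) (value-applyDownFrom (weight n f) e k k<e) ⟩
    hookRunner (charge k ∸ weight n f k) (weight n f k) t  ≡⟨ column-shape b bal k k<e t ⟨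
    column f k t                              ∎
    where open ≡-Reasoning

  separated-↔ : Inverse (Config separatedCharges w) (SubSetoid (setoid (List ℕ)) (Composition e w))
  separated-↔ = record
    { to        = λ { (f , (n , b) , bal) → weights n f , weights-composition b bal }
    ; from      = λ { (ns , comp) → configOf ns comp , (suc (zone e) , configOf-block ns comp) , configOf-balanced ns comp }
    ; to-cong   = λ { {_ , (_ , b) , _} {_ , (_ , b′) , _} eq → weights-cong b b′ eq }
    ; from-cong = λ { refl t → refl }
    ; inverse   =
        (λ { {ns , comp} {f , (n , b) , bal} eq →
             trans (weights-cong b (configOf-block ns comp) eq) (weights-configOf ns comp) }) ,
        (λ { {f , (n , b) , bal} {ns , comp} eq → configOf-weights b bal ns comp eq })
    }

-- Counting compositions

module Enumeration (d : ℕ) .{{_ : NonZero d}} where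
  open Supports d

  increment : List ℕ → List ℕ
  increment []       = []
  increment (n ∷ ns) = suc n ∷ ns

  -- Prepends every possible first entry. Positive entries arise by incrementing the lists for the
  -- preceding total, so that the lengths obey Pascal's rule.
  extend : (ℕ → List (List ℕ)) → ℕ → List (List ℕ)
  extend xs zero    = map (0 ∷_) (xs zero)
  extend xs (suc w) = map (0 ∷_) (xs (suc w)) ++ map increment (extend xs w)

  compositions : ℕ → ℕ → List (List ℕ)
  compositions zero    zero    = [] ∷ []
  compositions zero    (suc w) = []
  compositions (suc k) w with d ∣? k
  ... | yes _ = extend (compositions k) w
  ... | no _  = map (0 ∷_) (compositions k w)

  ∈-extend⁺ : ∀ {xs : ℕ → List (List ℕ)} n v {ns} → ns ∈ˡ xs v → n ∷ ns ∈ˡ extend xs (n + v)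
  ∈-extend⁺ zero    zero    ns∈ = ∈-map⁺ (0 ∷_) ns∈
  ∈-extend⁺ zero    (suc v) ns∈ = ∈-++⁺ˡ (∈-map⁺ (0 ∷_) ns∈)
  ∈-extend⁺ (suc n) v       ns∈ = ∈-++⁺ʳ _ (∈-map⁺ increment (∈-extend⁺ n v ns∈))

  ∈-extend⁻ : ∀ (xs : ℕ → List (List ℕ)) w {ms} → ms ∈ˡ extend xs w →
    ∃₂ λ n v → ∃ λ ns → ms ≡ n ∷ ns × n + v ≡ w × ns ∈ˡ xs v
  ∈-extend⁻ xs zero    ms∈ with ∈-map⁻ (0 ∷_) ms∈
  ... | ns , ns∈ , refl = 0 , 0 , ns , refl , refl , ns∈
  ∈-extend⁻ xs (suc w) ms∈ with ∈-++⁻ (map (0 ∷_) (xs (suc w))) ms∈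
  ... | inj₁ ms∈₁ with ∈-map⁻ (0 ∷_) ms∈₁
  ...   | ns , ns∈ , refl = 0 , suc w , ns , refl , refl , ns∈
  ∈-extend⁻ xs (suc w) ms∈ | inj₂ ms∈₂ with ∈-map⁻ increment ms∈₂
  ...   | ms , ms∈′ , eq with ∈-extend⁻ xs w ms∈′
  ...     | n , v , ns , refl , n+v , ns∈ = suc n , v , ns , eq , cong suc n+v , ns∈

  unique-extend : ∀ (xs : ℕ → List (List ℕ)) → (∀ v → Unique (xs v)) → ∀ w → Unique (extend xs w)
  unique-extend xs u zero    = Unique.map⁺ (proj₂ ∘ ∷-injective) (u zero)
  unique-extend xs u (suc w) = Unique.++⁺ (Unique.map⁺ (proj₂ ∘ ∷-injective) (u (suc w)))
    (unique-incremented (unique-extend xs u w) (λ ms∈ → let n , _ , ns , eq , _ = ∈-extend⁻ xs w ms∈ in n , ns , eq))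
    disjoint
    where
    unique-incremented : ∀ {yss} → Unique yss → (∀ {ms} → ms ∈ˡ yss → ∃₂ λ n ns → ms ≡ n ∷ ns) → Unique (map increment yss)
    unique-incremented []       _ = []
    unique-incremented {ys ∷ yss} (p ∷ u) nonempty = distinct p (λ ms∈ → nonempty (there ms∈)) ∷
      unique-incremented u (λ ms∈ → nonempty (there ms∈))
      where
      distinct : ∀ {zss} → All (ys ≢_) zss → (∀ {ms} → ms ∈ˡ zss → ∃₂ λ n ns → ms ≡ n ∷ ns) →
        All (increment ys ≢_) (map increment zss)
      distinct []       _  = []
      distinct (q ∷ qs) ne with nonempty (here refl) | ne (here refl)
      ... | n , ns , refl | m , ms , refl =
        (λ eq → q (cong₂ _∷_ (suc-injective (proj₁ (∷-injective eq))) (proj₂ (∷-injective eq)))) ∷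
        distinct qs (λ ms∈ → ne (there ms∈))
    disjoint : ∀ {ms} → ms ∈ˡ map (0 ∷_) (xs (suc w)) × ms ∈ˡ map increment (extend xs w) → _
    disjoint (p , q) with ∈-map⁻ (0 ∷_) p | ∈-map⁻ increment q
    ... | ns , _ , refl | ms , ms∈ , eq with ∈-extend⁻ xs w ms∈
    ...   | n , v , _ , refl , _ with eq
    ...     | ()

  ∈-compositions⁻ : ∀ k w {ms} → ms ∈ˡ compositions k w → Composition k w ms
  ∈-compositions⁻ zero zero (here refl) = refl , refl , tt
  ∈-compositions⁻ (suc k) w ms∈ with d ∣? k
  ... | yes d∣k with ∈-extend⁻ (compositions k) w ms∈
  ...   | n , v , ns , refl , n+v , ns∈ with ∈-compositions⁻ k v ns∈
  ...     | l , s , sup = cong suc l , trans (cong (n +_) s) n+v , (λ _ → subst (d ∣_) (sym l) d∣k) , sup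
  ∈-compositions⁻ (suc k) w ms∈ | no _ with ∈-map⁻ (0 ∷_) ms∈
  ...   | ns , ns∈ , refl with ∈-compositions⁻ k w ns∈
  ...     | l , s , sup = cong suc l , s , (λ 0≢0 → contradiction refl 0≢0) , sup

  ∈-compositions⁺ : ∀ k w {ms} → Composition k w ms → ms ∈ˡ compositions k w
  ∈-compositions⁺ zero    w {[]}     (_ , refl , _) = here refl
  ∈-compositions⁺ (suc k) w {n ∷ ns} (l , s , h , sup) with d ∣? k
  ... | yes _ = subst (λ w → n ∷ ns ∈ˡ extend (compositions k) w) s
    (∈-extend⁺ n (sum ns) (∈-compositions⁺ k (sum ns) (suc-injective l , refl , sup)))
  ... | no d∤k with n
  ...   | zero  = ∈-map⁺ (0 ∷_) (∈-compositions⁺ k w (suc-injective l , s , sup))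
  ...   | suc _ = contradiction (subst (d ∣_) (suc-injective l) (h λ ())) d∤k

  unique-compositions : ∀ k w → Unique (compositions k w)
  unique-compositions zero    zero    = [] ∷ []
  unique-compositions zero    (suc w) = []
  unique-compositions (suc k) w with d ∣? k
  ... | yes _ = unique-extend (compositions k) (unique-compositions k) w
  ... | no _  = Unique.map⁺ (proj₂ ∘ ∷-injective) (unique-compositions k w)

  length-extend : ∀ (xs : ℕ → List (List ℕ)) m → (∀ w → length (xs w) ≡ (w + m) C w) →
    ∀ w → length (extend xs w) ≡ (w + suc m) C w
  length-extend xs m eq zero    = trans (length-map (0 ∷_) (xs 0)) (eq 0)
  length-extend xs m eq (suc w) = begin
    length (map (0 ∷_) (xs (suc w)) ++ map increment (extend xs w))
      ≡⟨ length-++ (map (0 ∷_) (xs (suc w))) ⟩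
    length (map (0 ∷_) (xs (suc w))) + length (map increment (extend xs w))
      ≡⟨ cong₂ _+_ (length-map (0 ∷_) (xs (suc w))) (length-map increment (extend xs w)) ⟩
    length (xs (suc w)) + length (extend xs w)  ≡⟨ cong₂ _+_ (eq (suc w)) (length-extend xs m eq w) ⟩
    (suc w + m) C suc w + (w + suc m) C w       ≡⟨ cong (λ n → n C suc w + (w + suc m) C w) (+-suc w m) ⟨
    (w + suc m) C suc w + (w + suc m) C w       ≡⟨ +-comm ((w + suc m) C suc w) _ ⟩
    (w + suc m) C w + (w + suc m) C suc w       ≡⟨ nCk+nC[k+1]≡[n+1]C[k+1] (w + suc m) w ⟩
    suc (w + suc m) C suc w                     ∎
    where open ≡-Reasoning

  -- The base of the induction: for lists without entries the counts are 1, 0, 0, and so on, which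
  -- would be the hypothesis of `length-extend` with `m = -1`.
  length-extend-0 : ∀ (xs : ℕ → List (List ℕ)) → length (xs 0) ≡ 1 → (∀ w → length (xs (suc w)) ≡ 0) →
    ∀ w → length (extend xs w) ≡ (w + 0) C w
  length-extend-0 xs eq₀ eq zero    = trans (length-map (0 ∷_) (xs 0)) eq₀
  length-extend-0 xs eq₀ eq (suc w) = begin
    length (map (0 ∷_) (xs (suc w)) ++ map increment (extend xs w))
      ≡⟨ length-++ (map (0 ∷_) (xs (suc w))) ⟩
    length (map (0 ∷_) (xs (suc w))) + length (map increment (extend xs w))
      ≡⟨ cong₂ _+_ (trans (length-map (0 ∷_) (xs (suc w))) (eq w)) (length-map increment (extend xs w)) ⟩
    length (extend xs w)     ≡⟨ length-extend-0 xs eq₀ eq w ⟩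
    (w + 0) C w              ≡⟨ cong (_C w) (+-identityʳ w) ⟩
    w C w                    ≡⟨ nCn≡1 w ⟩
    1                        ≡⟨ nCn≡1 (suc w) ⟨
    suc w C suc w            ≡⟨ cong (_C suc w) (+-identityʳ (suc w)) ⟨
    (suc w + 0) C suc w      ∎
    where open ≡-Reasoning

  suc/-∣ : ∀ {k} → d ∣ suc k → suc k / d ≡ suc (k / d)
  suc/-∣ {k} d∣1+k with m≤n⇒m<n∨m≡n (m%n<n k d)
  ... | inj₁ lt = contradiction (n∣m⇒m%n≡0 (suc k) d d∣1+k) λ eq → 1+n≢0 (begin
    suc (k % d)                      ≡⟨ m<n⇒m%n≡m lt ⟨
    suc (k % d) % d                  ≡⟨ [m+kn]%n≡m%n (suc (k % d)) (k / d) d ⟨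
    (suc (k % d) + k / d * d) % d    ≡⟨ cong (λ m → suc m % d) (m≡m%n+[m/n]*n k d) ⟨
    suc k % d                        ≡⟨ eq ⟩
    0                                ∎)
    where open ≡-Reasoning
  ... | inj₂ eq = begin
    suc k / d                        ≡⟨ cong (λ m → suc m / d) (m≡m%n+[m/n]*n k d) ⟩
    (suc (k % d) + k / d * d) / d    ≡⟨ cong (λ m → (m + k / d * d) / d) eq ⟩
    suc (k / d) * d / d              ≡⟨ m*n/n≡m (suc (k / d)) d ⟩
    suc (k / d)                      ∎
    where open ≡-Reasoning

  suc/-∤ : ∀ {k} → ¬ (d ∣ suc k) → suc k / d ≡ k / d
  suc/-∤ {k} d∤1+k with m≤n⇒m<n∨m≡n (m%n<n k d)
  ... | inj₁ lt = trans (cong (λ m → suc m / d) (m≡m%n+[m/n]*n k d)) ([r+q*n]/n≡q (k / d) lt)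
  ... | inj₂ eq = contradiction (divides (suc (k / d))
    (trans (cong suc (m≡m%n+[m/n]*n k d)) (cong (_+ k / d * d) eq))) d∤1+k

  -- The quotient `k / d` goes up exactly at the multiples of `d`, which are the indices where
  -- `extend` is applied. Index 0 accounts for the absence of a further `+ 1`.
  length-compositions : ∀ k w → length (compositions (suc k) w) ≡ (w + k / d) C w
  length-compositions zero    w with d ∣? 0
  ... | yes _ = trans (length-extend-0 (compositions 0) refl (λ _ → refl) w) (cong (λ m → (w + m) C w) (sym (0/n≡0 d)))
  ... | no d∤0 = contradiction (d ∣0) d∤0
  length-compositions (suc k) w with d ∣? suc k
  ... | yes d∣ = trans (length-extend (compositions (suc k)) (k / d) (length-compositions k) w)
                   (cong (λ m → (w + m) C w) (sym (suc/-∣ d∣)))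
  ... | no d∤  = trans (length-map (0 ∷_) (compositions (suc k) w))
                   (trans (length-compositions k w) (cong (λ m → (w + m) C w) (sym (suc/-∤ d∤))))

  compositions-cardinality : ∀ k w → HasCardinality (Composition (suc k) w) ((w + k / d) C w)
  compositions-cardinality k w = compositions (suc k) w , unique-compositions (suc k) w ,
    (λ ms → mk⇔ (∈-compositions⁻ (suc k) w) (∈-compositions⁺ (suc k) w)) , length-compositions k w

-- The abacus of a partition

-- The β-set shifted by n, valid when there are at most n parts.
abacus : ℕ → List ℕ → Beads
abacus n       []       x = flat n x
abacus zero    (l ∷ ls) x = false
abacus (suc n) (l ∷ ls) x with x ≟ l + n
... | yes _ = true
... | no  _ = abacus n ls x

abacus-top : ∀ n l ls → abacus (suc n) (l ∷ ls) (l + n) ≡ true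
abacus-top n l ls with l + n ≟ l + n
... | yes _ = refl
... | no ¬p = contradiction refl ¬p

abacus-rest : ∀ n l ls {x} → x ≢ l + n → abacus (suc n) (l ∷ ls) x ≡ abacus n ls x
abacus-rest n l ls {x} x≢ with x ≟ l + n
... | yes p = contradiction p x≢
... | no _  = refl

sorted-head : ∀ {l ls} → Linked _≥_ (l ∷ ls) → entry ls 0 ≤ l
sorted-head [-]     = z≤n
sorted-head (p ∷ _) = p

sorted-tail : ∀ {l ls} → Linked _≥_ (l ∷ ls) → Linked _≥_ ls
sorted-tail = Linked.tail

abacus-vanishes : ∀ n ls → Linked _≥_ ls → Vanishes (entry ls 0 + n) (abacus n ls)
abacus-vanishes n       []       s x n≤x = flat-vanishes n x n≤x
abacus-vanishes zero    (l ∷ ls) s x _   = refl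
abacus-vanishes (suc n) (l ∷ ls) s x b≤x = trans
  (abacus-rest n l ls (λ x≡ → <⇒≱ (subst (_< l + suc n) (sym x≡) (+-monoʳ-< l ≤-refl)) b≤x))
  (abacus-vanishes n ls (sorted-tail s) x
    (≤-trans (+-mono-≤ (sorted-head s) (n≤1+n n)) b≤x))

rest-below-top : ∀ {n l ls} → Linked _≥_ (l ∷ ls) → Vanishes (l + n) (abacus n ls)
rest-below-top {n} {l} {ls} s =
  vanishes-mono (+-monoˡ-≤ n (sorted-head s)) (abacus-vanishes n ls (sorted-tail s))

-- Each part lifts one bead of the packed configuration by its own size, and the packed one has
-- energy `tri n`.
abacus-totals : ∀ n ls m → Linked _≥_ ls → length ls ≤ n → entry ls 0 + n ≤ m →
  count m (abacus n ls) ≡ n × energy m (abacus n ls) ≡ sum ls + tri n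
abacus-totals n       []       m s _         n≤m = count-flat n n≤m , energy-flat n n≤m
abacus-totals (suc n) (l ∷ ls) m s (s≤s len) b≤m
  with abacus-totals n ls m (sorted-tail s) len (≤-trans (+-mono-≤ (sorted-head s) (n≤1+n n)) b≤m)
     | remove-bead m (l + n) (<-≤-trans (+-monoʳ-< l ≤-refl) b≤m) (abacus-top n l ls)
         (rest-below-top s (l + n) ≤-refl) (λ x x≢ → abacus-rest n l ls x≢)
... | c , en | c′ , en′ = trans c′ (cong suc c) ,
  trans en′ (trans (cong (l + n +_) en) (lemma l n (sum ls) (tri n)))
  where
  lemma : ∀ l n s t → l + n + (s + t) ≡ l + s + (n + t)
  lemma = solve-∀

count-below-top : ∀ n l ls {x} → x ≤ l + n → count x (abacus (suc n) (l ∷ ls)) ≡ count x (abacus n ls)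
count-below-top n l ls {x} x≤ = count-cong x λ t t<x → abacus-rest n l ls (<⇒≢ (<-≤-trans t<x x≤))

gaps-below-top : ∀ n l ls {x} → x ≤ l + n → gaps (abacus (suc n) (l ∷ ls)) x ≡ gaps (abacus n ls) x
gaps-below-top n l ls {x} x≤ = gaps-cong x λ t t<x → abacus-rest n l ls (<⇒≢ (<-≤-trans t<x x≤))

count-monoˡ : ∀ r {m n} → m ≤ n → count m r ≤ count n r
count-monoˡ r {m} {zero}  z≤n = z≤n
count-monoˡ r {m} {suc n} m≤ with m≤n⇒m<n∨m≡n m≤
... | inj₂ refl = ≤-refl
... | inj₁ (s≤s m≤n) = ≤-trans (count-monoˡ r m≤n) (≤-trans (m≤m+n _ ⟦ r n ⟧) (≤-reflexive (sym (count-snoc n r))))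

count≤ : ∀ n ls → Linked _≥_ ls → length ls ≤ n → ∀ x → count x (abacus n ls) ≤ n
count≤ n ls s len x = subst (count x (abacus n ls) ≤_)
  (proj₁ (abacus-totals n ls (x + (entry ls 0 + n)) s len (m≤n+m _ x)))
  (count-monoˡ (abacus n ls) (m≤m+n x _))

count<-at-bead : ∀ n ls → Linked _≥_ ls → length ls ≤ n → ∀ x → abacus n ls x ≡ true → count x (abacus n ls) < n
count<-at-bead n ls s len x fx = subst (_≤ n)
  (trans (count-snoc x (abacus n ls)) (trans (cong (λ b → count x (abacus n ls) + ⟦ b ⟧) fx) (+-comm _ 1)))
  (count≤ n ls s len (suc x))

gaps-at-top : ∀ n l ls → Linked _≥_ (l ∷ ls) → length ls ≤ n → gaps (abacus n ls) (l + n) ≡ l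
gaps-at-top n l ls s len = +-cancelˡ-≡ n _ _ (begin
  n + gaps (abacus n ls) (l + n)
    ≡⟨ cong (_+ gaps (abacus n ls) (l + n))
         (proj₁ (abacus-totals n ls (l + n) (sorted-tail s) len (+-monoˡ-≤ n (sorted-head s)))) ⟨
  count (l + n) (abacus n ls) + gaps (abacus n ls) (l + n)  ≡⟨ count+gaps (l + n) (abacus n ls) ⟩
  l + n                                                     ≡⟨ +-comm l n ⟩
  n + l                                                     ∎)
  where open ≡-Reasoning

-- A part is the number of gaps below its bead. Rows count beads from above, so a bead with `c` of
-- the `n` beads below it belongs to row `n ∸ c`; the further `∸ 1` is the 0-based list position.
row-at-bead : ∀ n ls → Linked _≥_ ls → length ls ≤ n → ∀ x → abacus n ls x ≡ true →
  entry ls (n ∸ count x (abacus n ls) ∸ 1) ≡ gaps (abacus n ls) x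
row-at-bead n       []       s _         x fx = +-cancelˡ-≡ x _ _ (begin
  x + 0                                 ≡⟨ +-identityʳ x ⟩
  x                                     ≡⟨ count+gaps x (flat n) ⟨
  count x (flat n) + gaps (flat n) x
    ≡⟨ cong (_+ gaps (flat n) x) (trans (count-cong x (λ t t<x → trans (<ᵇ-true {t} {n} (<-trans t<x (<ᵇ-true⁻¹ {x} {n} fx))) (sym (<ᵇ-true t<x))))
         (count-flat x ≤-refl)) ⟩
  x + gaps (flat n) x                   ∎)
  where open ≡-Reasoning
row-at-bead (suc n) (l ∷ ls) s (s≤s len) x fx with x ≟ l + n
... | yes refl = trans
  (cong (λ c → entry (l ∷ ls) (suc n ∸ c ∸ 1)) (trans (count-below-top n l ls ≤-refl)
    (proj₁ (abacus-totals n ls (l + n) (sorted-tail s) len (+-monoˡ-≤ n (sorted-head s))))))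
  (trans (cong (λ c → entry (l ∷ ls) (c ∸ 1)) (m+n∸n≡m 1 n))
    (trans (sym (gaps-at-top n l ls s len)) (sym (gaps-below-top n l ls ≤-refl))))
... | no x≢ = begin
  entry (l ∷ ls) (suc n ∸ count x f ∸ 1)  ≡⟨ cong (λ c → entry (l ∷ ls) (suc n ∸ c ∸ 1)) (count-below-top n l ls x≤) ⟩
  entry (l ∷ ls) (suc n ∸ c ∸ 1)          ≡⟨ cong (entry (l ∷ ls)) index ⟩
  entry ls (n ∸ c ∸ 1)                    ≡⟨ row-at-bead n ls (sorted-tail s) len x fx ⟩
  gaps (abacus n ls) x                    ≡⟨ gaps-below-top n l ls x≤ ⟨
  gaps f x                                ∎
  where
  open ≡-Reasoning
  f = abacus (suc n) (l ∷ ls)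
  c = count x (abacus n ls)
  x≤ : x ≤ l + n
  x≤ = ≮⇒≥ λ lt → contradiction (trans (sym fx) (rest-below-top s x (<⇒≤ lt))) λ ()
  c<n : c < n
  c<n = count<-at-bead n ls (sorted-tail s) len x fx
  index : suc n ∸ c ∸ 1 ≡ suc (n ∸ c ∸ 1)
  index = begin
    suc n ∸ c ∸ 1      ≡⟨ cong (_∸ 1) (+-∸-assoc 1 (<⇒≤ c<n)) ⟩
    n ∸ c              ≡⟨ m+[n∸m]≡n (m<n⇒0<n∸m c<n) ⟨
    1 + (n ∸ c ∸ 1)    ∎

sorted-bounded : ∀ {l ls} → Linked _≥_ (l ∷ ls) → All (_≤ l) (l ∷ ls)
sorted-bounded s = Linked⇒All (λ p q → ≤-trans q p) ≤-refl s

-- A part exceeds the number of gaps below `y` exactly if its bead lies above `y`, since it then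
-- counts the gap `y` too. What is counted are thus the beads above `y`.
col-at-gap : ∀ n ls → Linked _≥_ ls → length ls ≤ n → ∀ y → abacus n ls y ≡ false →
  length (filter (suc (gaps (abacus n ls) y) ≤?_) ls) ≡ n ∸ count y (abacus n ls)
col-at-gap n       []       s _         y fy = sym (trans
  (cong (n ∸_) (count-flat n (<ᵇ-false⁻¹ fy))) (n∸n≡0 n))
col-at-gap (suc n) (l ∷ ls) s (s≤s len) y fy with y ≟ l + n | <-cmp y (l + n)
... | no y≢ | tri≈ _ y≡ _ = contradiction y≡ y≢
... | no y≢ | tri< y< _ _ = begin
  length (filter (suc (gaps f y) ≤?_) (l ∷ ls))
    ≡⟨ cong (λ g → length (filter (suc g ≤?_) (l ∷ ls))) (gaps-below-top n l ls (<⇒≤ y<)) ⟩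
  length (filter (suc g ≤?_) (l ∷ ls))  ≡⟨ cong length (filter-accept (suc g ≤?_) g<l) ⟩
  suc (length (filter (suc g ≤?_) ls))  ≡⟨ cong suc (col-at-gap n ls (sorted-tail s) len y fy) ⟩
  1 + (n ∸ count y (abacus n ls))       ≡⟨ +-∸-assoc 1 (count≤ n ls (sorted-tail s) len y) ⟨
  suc n ∸ count y (abacus n ls)         ≡⟨ cong (suc n ∸_) (count-below-top n l ls (<⇒≤ y<)) ⟨
  suc n ∸ count y f                     ∎
  where
  open ≡-Reasoning
  f = abacus (suc n) (l ∷ ls)
  g = gaps (abacus n ls) y
  g<l : suc g ≤ l
  g<l = subst₂ _≤_ (trans (cong (λ b → g + ⟦ not b ⟧) fy) (+-comm g 1)) (gaps-at-top n l ls s len)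
    (gaps-mono (abacus n ls) y<)
... | no y≢ | tri> _ _ y> = begin
  length (filter (suc (gaps f y) ≤?_) (l ∷ ls))
    ≡⟨ cong length (filter-none (suc (gaps f y) ≤?_) (All.map (λ p q → <⇒≱ (s≤s l≤g) (≤-trans q p)) (sorted-bounded s))) ⟩
  0                    ≡⟨ n∸n≡0 (suc n) ⟨
  suc n ∸ suc n        ≡⟨ cong (suc n ∸_) total ⟨
  suc n ∸ count y f    ∎
  where
  open ≡-Reasoning
  f = abacus (suc n) (l ∷ ls)
  l+1+n≤y : l + suc n ≤ y
  l+1+n≤y = subst (_≤ y) (sym (+-suc l n)) y>
  total : count y f ≡ suc n
  total = proj₁ (abacus-totals (suc n) (l ∷ ls) y s (s≤s len) l+1+n≤y)
  l≤g : l ≤ gaps f y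
  l≤g = +-cancelʳ-≤ (suc n) _ _ (subst (l + suc n ≤_)
    (trans (sym (count+gaps y f)) (trans (cong (_+ gaps f y) total) (+-comm (suc n) (gaps f y)))) l+1+n≤y)

-- The highest bead determines the first part. Positivity separates the empty list from the others,
-- because trailing zeros would not change the abacus.
abacus-injective : ∀ n ls ls′ → Linked _≥_ ls → Linked _≥_ ls′ → All (0 <_) ls → All (0 <_) ls′ →
  length ls ≤ n → length ls′ ≤ n → abacus n ls ≗ abacus n ls′ → ls ≡ ls′
abacus-injective n [] [] _ _ _ _ _ _ _ = refl
abacus-injective n [] (zero ∷ _) _ _ _ (() ∷ _)
abacus-injective n (zero ∷ _) [] _ _ (() ∷ _)
abacus-injective (suc n) [] (suc l ∷ ls) _ _ _ _ _ _ eq =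
  contradiction (trans (sym (eq (suc l + n))) (flat-vanishes (suc n) (suc l + n) (s≤s (m≤n+m n l))))
    λ p → contradiction (trans (sym p) (abacus-top n (suc l) ls)) λ ()
abacus-injective (suc n) (suc l ∷ ls) [] _ _ _ _ _ _ eq =
  contradiction (trans (sym (abacus-top n (suc l) ls)) (eq (suc l + n)))
    λ p → contradiction (trans p (flat-vanishes (suc n) (suc l + n) (s≤s (m≤n+m n l)))) λ ()
abacus-injective (suc n) (l ∷ ls) (l′ ∷ ls′) s s′ (_ ∷ ps) (_ ∷ ps′) (s≤s len) (s≤s len′) eq with <-cmp l l′
... | tri< l< _ _ = contradiction (trans (eq (l′ + n)) (abacus-top n l′ ls′))
  λ p → contradiction (trans (sym p) (abacus-vanishes (suc n) (l ∷ ls) s (l′ + n)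
    (subst (_≤ l′ + n) (sym (+-suc l n)) (+-monoˡ-< n l<)))) λ ()
... | tri> _ _ l> = contradiction (trans (sym (eq (l + n))) (abacus-top n l ls))
  λ p → contradiction (trans (sym p) (abacus-vanishes (suc n) (l′ ∷ ls′) s′ (l + n)
    (subst (_≤ l + n) (sym (+-suc l′ n)) (+-monoˡ-< n l>)))) λ ()
... | tri≈ _ refl _ = cong (l ∷_) (abacus-injective n ls ls′ (sorted-tail s) (sorted-tail s′) ps ps′ len len′ rest)
  where
  rest : abacus n ls ≗ abacus n ls′
  rest x with x ≟ l + n
  ... | yes refl = trans (rest-below-top s x ≤-refl) (sym (rest-below-top s′ x ≤-refl))
  ... | no x≢    = trans (sym (abacus-rest n l ls x≢)) (trans (eq x) (abacus-rest n l ls′ x≢))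

-- Reading a partition off its beads.

infixr 5 _∷⁺_

_∷⁺_ : ℕ → List ℕ → List ℕ
zero  ∷⁺ ls = ls
suc g ∷⁺ ls = suc g ∷ ls

-- Going downwards, each bead contributes the number of gaps below it. Beads with no gap below stand
-- for zero parts, which `_∷⁺_` drops.
partsOf : Beads → ℕ → List ℕ
partsOf f zero    = []
partsOf f (suc x) = if f x then gaps f x ∷⁺ partsOf f x else partsOf f x

partsOf-head : ∀ f x → entry (partsOf f x) 0 ≤ gaps f x
partsOf-head f zero    = z≤n
partsOf-head f (suc x) with f x
... | false = ≤-trans (partsOf-head f x) (m≤m+n _ _)
... | true with gaps f x | partsOf-head f x
...   | zero  | ih = ≤-trans ih z≤n
...   | suc g | ih = m≤m+n _ _

sorted-∷ : ∀ {l ls} → entry ls 0 ≤ l → Linked _≥_ ls → Linked _≥_ (l ∷ ls)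
sorted-∷ {ls = []}    _ _ = [-]
sorted-∷ {ls = _ ∷ _} p s = p ∷ s

partsOf-sorted : ∀ f x → Linked _≥_ (partsOf f x)
partsOf-sorted f zero    = []
partsOf-sorted f (suc x) with f x
... | false = partsOf-sorted f x
... | true with gaps f x | partsOf-head f x
...   | zero  | _  = partsOf-sorted f x
...   | suc g | ih = sorted-∷ ih (partsOf-sorted f x)

partsOf-positive : ∀ f x → All (0 <_) (partsOf f x)
partsOf-positive f zero    = []
partsOf-positive f (suc x) with f x
... | false = partsOf-positive f x
... | true with gaps f x
...   | zero  = partsOf-positive f x
...   | suc g = z<s ∷ partsOf-positive f x

partsOf-length : ∀ f x → length (partsOf f x) ≤ count x f
partsOf-length f zero    = z≤n
partsOf-length f (suc x) = subst (length (partsOf f (suc x)) ≤_) (sym (count-snoc x f)) go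
  where
  go : length (partsOf f (suc x)) ≤ count x f + ⟦ f x ⟧
  go with f x
  ... | false = ≤-trans (partsOf-length f x) (m≤m+n _ _)
  ... | true with gaps f x
  ...   | zero  = ≤-trans (partsOf-length f x) (m≤m+n _ _)
  ...   | suc g = subst (suc (length (partsOf f x)) ≤_) (+-comm 1 _) (s≤s (partsOf-length f x))

partsOf-empty : ∀ f x → gaps f x ≡ 0 → partsOf f x ≡ []
partsOf-empty f zero    _ = refl
partsOf-empty f (suc x) g≡0 with f x | m+n≡0⇒m≡0 (gaps f x) g≡0
... | false | g = partsOf-empty f x g
... | true  | g rewrite g = partsOf-empty f x g

abacus-partsOf : ∀ f x → ∀ t → t < x → abacus (count x f) (partsOf f x) t ≡ f t
abacus-partsOf f (suc x) t t<1+x =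
  trans (cong (λ n → abacus n (partsOf f (suc x)) t) (count-snoc x f)) go
  where
  vanish : Vanishes x (abacus (count x f) (partsOf f x))
  vanish = vanishes-mono (subst (entry (partsOf f x) 0 + count x f ≤_)
    (trans (+-comm (gaps f x) (count x f)) (count+gaps x f)) (+-monoˡ-≤ (count x f) (partsOf-head f x)))
    (abacus-vanishes (count x f) (partsOf f x) (partsOf-sorted f x))
  go : abacus (count x f + ⟦ f x ⟧) (partsOf f (suc x)) t ≡ f t
  go with f x in fx
  ... | false = trans (cong (λ n → abacus n (partsOf f x) t) (+-identityʳ (count x f))) below
    where
    below : abacus (count x f) (partsOf f x) t ≡ f t
    below with m≤n⇒m<n∨m≡n (s≤s⁻¹ t<1+x)
    ... | inj₁ t<x  = abacus-partsOf f x t t<x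
    ... | inj₂ refl = trans (vanish t ≤-refl) (sym fx)
  ... | true = trans (cong (λ n → abacus n (gaps f x ∷⁺ partsOf f x) t) (+-comm (count x f) 1)) top
    where
    top : abacus (suc (count x f)) (gaps f x ∷⁺ partsOf f x) t ≡ f t
    top with gaps f x in gx
    ... | zero = trans (cong (λ ls → abacus (suc (count x f)) ls t) (partsOf-empty f x gx))
                   (trans (<ᵇ-true (subst (λ c → t < suc c) (sym all) t<1+x)) (sym ft))
      where
      all : count x f ≡ x
      all = trans (sym (+-identityʳ _)) (trans (cong (count x f +_) (sym gx)) (count+gaps x f))
      ft : f t ≡ true
      ft with m≤n⇒m<n∨m≡n (s≤s⁻¹ t<1+x)
      ... | inj₂ refl = fx
      ... | inj₁ t<x  = trans (sym (abacus-partsOf f x t t<x))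
        (trans (cong (λ ls → abacus (count x f) ls t) (partsOf-empty f x gx)) (<ᵇ-true (subst (t <_) (sym all) t<x)))
    ... | suc g with t ≟ suc g + count x f
    ...   | yes p = sym (trans (cong f (trans p (trans (+-comm (suc g) (count x f))
                      (trans (cong (count x f +_) (sym gx)) (count+gaps x f))))) fx)
    ...   | no t≢ = abacus-partsOf f x t (≤∧≢⇒< (s≤s⁻¹ t<1+x) λ t≡x → t≢ (trans t≡x
                      (trans (sym (count+gaps x f)) (trans (cong (count x f +_) gx) (+-comm (count x f) (suc g))))))

partitionOf : Beads → ℕ → Partition
partitionOf f x = mkPartition (partsOf f x) (partsOf-sorted f x) (partsOf-positive f x)

abacus-partitionOf : ∀ {f x} → Vanishes x f → abacus (count x f) (partsOf f x) ≗ f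
abacus-partitionOf {f} {x} v t with t <? x
... | yes t<x = abacus-partsOf f x t t<x
... | no t≮x  = trans (abacus-vanishes (count x f) (partsOf f x) (partsOf-sorted f x) t
  (≤-trans (subst (entry (partsOf f x) 0 + count x f ≤_)
    (trans (+-comm (gaps f x) (count x f)) (count+gaps x f)) (+-monoˡ-≤ (count x f) (partsOf-head f x))) (≮⇒≥ t≮x)))
  (sym (v t (≮⇒≥ t≮x)))

nth-bead : ∀ m f j → j < count m f → ∃ λ y → f y ≡ true × count y f ≡ j
nth-bead (suc m) f j j< with f m in fm | subst (j <_) (count-snoc m f) j<
... | false | lt = nth-bead m f j (subst (j <_) (+-identityʳ (count m f)) lt)
... | true  | lt with m≤n⇒m<n∨m≡n (s≤s⁻¹ (subst (j <_) (+-comm (count m f) 1) lt))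
...   | inj₁ lt′ = nth-bead m f j lt′
...   | inj₂ eq  = m , fm , sym eq

nth-gap : ∀ m f j → j < gaps f m → ∃ λ x → x < m × f x ≡ false × gaps f x ≡ j
nth-gap (suc m) f j j< with f m in fm
... | true with nth-gap m f j (subst (j <_) (+-identityʳ (gaps f m)) j<)
...   | x , x<m , rest = x , m<n⇒m<1+n x<m , rest
nth-gap (suc m) f j j< | false with m≤n⇒m<n∨m≡n (s≤s⁻¹ (subst (j <_) (+-comm (gaps f m) 1) j<))
... | inj₁ lt with nth-gap m f j lt
...   | x , x<m , rest = x , m<n⇒m<1+n x<m , rest
nth-gap (suc m) f j j< | false | inj₂ eq = m , ≤-refl , fm , sym eq

entry-positive : ∀ ls i → 0 < entry ls i → i < length ls
entry-positive (l ∷ ls) zero    _ = z<s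
entry-positive (l ∷ ls) (suc i) p = s<s (entry-positive ls i p)

[n∸k]∸[n∸m]≡m∸k : ∀ {n m k} → k ≤ m → m ≤ n → (n ∸ k) ∸ (n ∸ m) ≡ m ∸ k
[n∸k]∸[n∸m]≡m∸k {n} {m} {k} k≤m m≤n = begin
  (n ∸ k) ∸ (n ∸ m)            ≡⟨ cong (λ x → (x ∸ k) ∸ (n ∸ m)) (m+[n∸m]≡n m≤n) ⟨
  (m + (n ∸ m) ∸ k) ∸ (n ∸ m)  ≡⟨ cong (_∸ (n ∸ m)) (+-∸-comm (n ∸ m) k≤m) ⟩
  (m ∸ k + (n ∸ m)) ∸ (n ∸ m)  ≡⟨ m+n∸n≡m (m ∸ k) (n ∸ m) ⟩
  m ∸ k                        ∎
  where open ≡-Reasoning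

-- Nodes of the diagram as pairs of a gap and a higher bead.

module BalancedPartitions (d e′ n : ℕ) (p : Partition) (len : length (parts p) ≤ n) where
  open Abacus d e′

  f : Beads
  f = abacus n (parts p)

  gaps-increase : ∀ {x y} → x < y → f x ≡ false → suc (gaps f x) ≤ gaps f y
  gaps-increase {x} {y} x<y fx = subst (_≤ gaps f y)
    (trans (cong (λ b → gaps f x + ⟦ not b ⟧) fx) (+-comm _ 1)) (gaps-mono f x<y)

  module _ {x y} (x<y : x < y) (fx : f x ≡ false) (fy : f y ≡ true) where
    r c : ℕ
    r = n ∸ count y f
    c = suc (gaps f x)

    r≥1 : 1 ≤ r
    r≥1 = m<n⇒0<n∸m (count<-at-bead n (parts p) (sorted p) len y fy)

    row≡ : row p r ≡ gaps f y
    row≡ = row-at-bead n (parts p) (sorted p) len y fy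

    col≡ : col p c ≡ n ∸ count x f
    col≡ = col-at-gap n (parts p) (sorted p) len x fx

    c≤row : c ≤ gaps f y
    c≤row = gaps-increase x<y fx

    arm≡ : arm p r c ≡ gaps f y ∸ c
    arm≡ = cong (_∸ c) row≡

    count≤n : count y f ≤ n
    count≤n = count≤ n (parts p) (sorted p) len y

    -- Among the positions from `x` up to but excluding `y`, the beads make up the leg, the gaps
    -- other than `x` make up the arm, and `x` itself is the final `+ 1`.
    hook≡ : x + hook p r c ≡ y
    hook≡ = begin
      x + (arm p r c + (col p c ∸ r) + 1)
        ≡⟨ cong₂ (λ a l → x + (a + l + 1)) arm≡
             (trans (cong (_∸ r) col≡) ([n∸k]∸[n∸m]≡m∸k (count-monoˡ f (<⇒≤ x<y)) count≤n)) ⟩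
      x + (gaps f y ∸ c + (count y f ∸ count x f) + 1)
        ≡⟨ cong (_+ (gaps f y ∸ c + (count y f ∸ count x f) + 1)) (count+gaps x f) ⟨
      count x f + gaps f x + (gaps f y ∸ c + (count y f ∸ count x f) + 1)
        ≡⟨ lemma (count x f) (gaps f x) (gaps f y ∸ c) (count y f ∸ count x f) ⟩
      (count x f + (count y f ∸ count x f)) + (c + (gaps f y ∸ c))
        ≡⟨ cong₂ _+_ (m+[n∸m]≡n (count-monoˡ f (<⇒≤ x<y))) (m+[n∸m]≡n c≤row) ⟩
      count y f + gaps f y  ≡⟨ count+gaps y f ⟩
      y                     ∎
      where
      open ≡-Reasoning
      lemma : ∀ a b c d → a + b + (c + d + 1) ≡ (a + d) + (suc b + c)
      lemma = solve-∀

    r≤length : r ≤ length (parts p)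
    r≤length = subst (_≤ length (parts p)) (m+[n∸m]≡n r≥1)
      (entry-positive (parts p) (r ∸ 1) (subst (0 <_) (sym row≡) (≤-trans z<s c≤row)))

    node : Node p r c
    node = (r≥1 , r≤length) , (z<s , subst (c ≤_) (sym row≡) c≤row)

  balanced⇒abacus : Balanced d e p → Balancedᶠ f
  balanced⇒abacus bal x zero fx fy =
    contradiction (trans (sym fx) (trans (cong f (sym (+-identityʳ x))) fy)) λ ()
  balanced⇒abacus bal x (suc k) fx fy = ∣∸⇒≋ (c≤row x<y fx fy)
    (subst (d ∣_) (arm≡ x<y fx fy) (bal _ _ (node x<y fx fy)
      (divides (suc k) (+-cancelˡ-≡ x _ _ (hook≡ x<y fx fy)))))
    where
    x<y : x < x + suc k * e
    x<y = m<m+n x z<s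

  -- Every node arises from a pair: row `R` from the bead with `n ∸ R` beads below it, column `C`
  -- from the gap with `C ∸ 1` gaps below it. This gap lies below the bead because `C` is at most
  -- the row length.
  abacus⇒balanced : Balancedᶠ f → Balanced d e p
  abacus⇒balanced bal R C ((1≤R , R≤len) , (1≤C , C≤row)) e∣hook
    with nth-bead (entry (parts p) 0 + n) f (n ∸ R)
           (subst (n ∸ R <_) (sym (proj₁ (abacus-totals n (parts p) _ (sorted p) len ≤-refl)))
             (∸-monoʳ-< 1≤R (≤-trans R≤len len)))
  ... | y , fy , county with nth-gap y f (C ∸ 1) (subst (_≤ gaps f y) (sym (m+[n∸m]≡n 1≤C))
                                (subst (C ≤_) row≡gaps C≤row))
    where
    R≡ : n ∸ count y f ≡ R
    R≡ = trans (cong (n ∸_) county) (m∸[m∸n]≡n (≤-trans R≤len len))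
    row≡gaps : row p R ≡ gaps f y
    row≡gaps = trans (cong (row p) (sym R≡)) (row-at-bead n (parts p) (sorted p) len y fy)
  ...   | x , x<y , fx , gapsx = subst₂ (λ R C → d ∣ arm p R C) R≡ C≡
    (subst (d ∣_) (sym (arm≡ x<y fx fy)) (≋⇒∣∸ (c≤row x<y fx fy) gaps≋))
    where
    R≡ : r x<y fx fy ≡ R
    R≡ = trans (cong (n ∸_) county) (m∸[m∸n]≡n (≤-trans R≤len len))
    C≡ : c x<y fx fy ≡ C
    C≡ = trans (cong suc gapsx) (m+[n∸m]≡n 1≤C)
    gaps≋ : gaps f y ≋ suc (gaps f x)
    gaps≋ = subst (λ y → gaps f y ≋ suc (gaps f x)) y≡
      (bal x (quotient e∣hook) fx (trans (cong f y≡) fy))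
      where
      y≡ : x + quotient e∣hook * e ≡ y
      y≡ = trans (cong (x +_) (trans (sym (m∣n⇒n≡quotient*m e∣hook)) (cong₂ (hook p) (sym R≡) (sym C≡)))) (hook≡ x<y fx fy)

-- Sliding beads down to the e-core

slideAt : ℕ → ℕ → Beads → Beads
slideAt y δ f x with x ≟ y | x ≟ y + δ
... | yes _ | _     = true
... | no _  | yes _ = false
... | no _  | no _  = f x

slideAt-slides : ∀ {y δ f} → 0 < δ → f y ≡ false → f (y + δ) ≡ true → Slide y δ f (slideAt y δ f)
slideAt-slides {y} {δ} {f} 0<δ fy fyδ = record
  { gap-before = fy ; bead-before = fyδ ; bead-after = after ; gap-after = gap ; elsewhere = else }
  where
  after : slideAt y δ f y ≡ true
  after with y ≟ y | y ≟ y + δ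
  ... | yes _ | _ = refl
  ... | no ¬p | _ = contradiction refl ¬p
  gap : slideAt y δ f (y + δ) ≡ false
  gap with y + δ ≟ y | y + δ ≟ y + δ
  ... | yes p | _     = contradiction p (<⇒≢ (m<m+n y 0<δ) ∘ sym)
  ... | no _  | yes _ = refl
  ... | no _  | no ¬p = contradiction refl ¬p
  else : ∀ x → x ≢ y → x ≢ y + δ → f x ≡ slideAt y δ f x
  else x x≢y x≢yδ with x ≟ y | x ≟ y + δ
  ... | yes p | _     = contradiction p x≢y
  ... | no _  | yes p = contradiction p x≢yδ
  ... | no _  | no _  = refl

sum-update : ∀ {f g : ℕ → ℕ} n i → i < n → (∀ j → j < n → j ≢ i → f j ≡ g j) → f i ≡ suc (g i) →
  sum (applyUpTo f n) ≡ suc (sum (applyUpTo g n))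
sum-update (suc n) zero _ eq fi = cong₂ _+_ fi (cong sum (applyUpTo-cong n (λ j j<n → eq (suc j) (s<s j<n) λ ())))
sum-update {f} {g} (suc n) (suc i) (s≤s i<n) eq fi = trans
  (cong₂ _+_ (eq 0 z<s (λ ())) (sum-update {f ∘ suc} {g ∘ suc} n i i<n
    (λ j j<n j≢i → eq (suc j) (s<s j<n) (j≢i ∘ suc-injective)) fi))
  (+-suc (g 0) _)

module Slides (d e′ : ℕ) where
  open Abacus d e′

  data SlidesTo : ℕ → Beads → Beads → Set where
    done : ∀ {f h} → f ≗ h → SlidesTo 0 f h
    step : ∀ {k f h} y → f y ≡ false → f (y + e) ≡ true → SlidesTo k (slideAt y e f) h → SlidesTo (suc k) f h

  Stuck : Beads → Set
  Stuck f = ∀ y → f y ≡ false → f (y + e) ≡ false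

  -- Two energies are tracked, since a slide lowers a bead by one row of its runner but by `e`
  -- positions on the line. The first one measures the weight of a configuration, the second the
  -- size of a partition.
  record Drop (m k : ℕ) (f h : Beads) : Set where
    field
      vanishes : Vanishes (m * e) h
      charge   : charges m f ≡ charges m h
      energy↓  : totalEnergy m f ≡ k + totalEnergy m h
      beads    : count (m * e) f ≡ count (m * e) h
      energyᶠ↓ : energy (m * e) f ≡ k * e + energy (m * e) h

  drop-≗ : ∀ {m f h} → Vanishes (m * e) f → f ≗ h → Drop m 0 f h
  drop-≗ {m} v eq = record
    { vanishes = vanishes-≗ eq v
    ; charge   = applyUpTo-cong e (λ i _ → count-cong m (λ t _ → eq (i + t * e)))
    ; energy↓  = cong sum (applyUpTo-cong e (λ i _ → energy-cong m (λ t _ → eq (i + t * e))))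
    ; beads    = count-cong (m * e) (λ t _ → eq t)
    ; energyᶠ↓ = energy-cong (m * e) (λ t _ → eq t)
    }

  drop-trans : ∀ {m k l f g h} → Drop m k f g → Drop m l g h → Drop m (k + l) f h
  drop-trans {m} {k} {l} {h = h} F G = record
    { vanishes = G.vanishes
    ; charge   = trans F.charge G.charge
    ; energy↓  = trans F.energy↓ (trans (cong (λ z → k + z) G.energy↓) (sym (+-assoc k l _)))
    ; beads    = trans F.beads G.beads
    ; energyᶠ↓ = trans F.energyᶠ↓ (trans (cong (λ z → k * e + z) G.energyᶠ↓)
        (trans (sym (+-assoc (k * e) (l * e) _)) (cong (_+ energy (m * e) h) (sym (*-distribʳ-+ e k l)))))
    }
    where module F = Drop F
          module G = Drop G

  column-slide : ∀ {i t f g} → i < e → Slide (i + t * e) e f g → Slide t 1 (column f i) (column g i)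
  column-slide {i} {t} {f} {g} i<e σ = record
    { gap-before  = gap-before
    ; bead-before = trans (cong f below) bead-before
    ; bead-after  = bead-after
    ; gap-after   = trans (cong g below) gap-after
    ; elsewhere   = λ s s≢t s≢ → elsewhere (i + s * e)
        (s≢t ∘ λ eq → *-cancelʳ-≡ s t e (+-cancelˡ-≡ i _ _ eq))
        (s≢ ∘ λ eq → *-cancelʳ-≡ s (t + 1) e (+-cancelˡ-≡ i _ _ (trans eq (sym below))))
    }
    where
    open Slide σ
    below : i + (t + 1) * e ≡ i + t * e + e
    below = trans (sym (row-shift i t 1)) (cong (λ z → i + t * e + z) (*-identityˡ e))

  column-elsewhere : ∀ {i t f g j} → i < e → Slide (i + t * e) e f g → j < e → j ≢ i → column f j ≗ column g j
  column-elsewhere {i} {t} {f} {g} {j} i<e σ j<e j≢i s = Slide.elsewhere σ (j + s * e)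
    (λ eq → j≢i (residue t eq))
    (λ eq → j≢i (residue (t + 1) (trans eq (trans (cong (λ z → i + t * e + z) (sym (*-identityˡ e))) (row-shift i t 1)))))
    where
    residue : ∀ t → j + s * e ≡ i + t * e → j ≡ i
    residue t eq = trans (sym ([r+q*n]%n≡r s j<e)) (trans (cong (_% e) eq) ([r+q*n]%n≡r t i<e))

  slide-vanishes : ∀ {m y f g} → Vanishes m f → Slide y e f g → Vanishes m g
  slide-vanishes {m} {y} {f} v σ x m≤x = trans (sym (elsewhere x (<⇒≢ y<x ∘ sym) (<⇒≢ ye<x ∘ sym))) (v x m≤x)
    where
    open Slide σ
    ye<x : y + e < x
    ye<x = <-≤-trans (≰⇒> λ m≤ → contradiction (trans (sym (v (y + e) m≤)) bead-before) λ ()) m≤x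
    y<x : y < x
    y<x = ≤-<-trans (m≤m+n y e) ye<x

  slide-drop : ∀ {m y f g} → Vanishes (m * e) f → Slide y e f g → Drop m 1 f g
  slide-drop {m} {y} {f} {g} v σ = record
    { vanishes = slide-vanishes v σ
    ; charge   = applyUpTo-cong e charge
    ; energy↓  = sum-update e (y % e) i<e
        (λ j j<e j≢i → energy-cong m (λ s _ → column-elsewhere {t = y / e} i<e σ′ j<e j≢i s)) (proj₂ inv)
    ; beads    = proj₁ invᶠ
    ; energyᶠ↓ = trans (proj₂ invᶠ) (cong (_+ energy (m * e) g) (sym (*-identityˡ e)))
    }
    where
    i<e = m%n<n y e
    σ′ : Slide (y % e + y / e * e) e f g
    σ′ = subst (λ y → Slide y e f g) (m≡m%n+[m/n]*n y e) σ
    bound : ∀ {r s} t δ n → Slide t δ r s → Vanishes n r → t + δ < n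
    bound t δ n σ v = ≰⇒> λ n≤ → contradiction (trans (sym (v (t + δ) n≤)) (Slide.bead-before σ)) λ ()
    τ : Slide (y / e) 1 (column f (y % e)) (column g (y % e))
    τ = column-slide i<e σ′
    inv = slide-invariants m (y / e) 1 (bound (y / e) 1 m τ (column-vanishes (y % e) v)) τ
    invᶠ = slide-invariants (m * e) y e (bound y e (m * e) σ v) σ
    charge : ∀ j → j < e → count m (column f j) ≡ count m (column g j)
    charge j j<e with j ≟ y % e
    ... | yes refl = proj₁ inv
    ... | no j≢i   = count-cong m (λ s _ → column-elsewhere {t = y / e} i<e σ′ j<e j≢i s)

  slides-drop : ∀ {m k f h} → Vanishes (m * e) f → SlidesTo k f h → Drop m k f h
  slides-drop {m} v (done eq) = drop-≗ {m} v eq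
  slides-drop {m} v (step y fy fye rest) = drop-trans D (slides-drop {m} (Drop.vanishes D) rest)
    where D = slide-drop {m} v (slideAt-slides z<s fy fye)

  -- Every slide lowers the total energy by one, so its value `n` bounds the number of slides and
  -- serves as the recursion argument.
  reduce : ∀ m n f → Vanishes (m * e) f → totalEnergy m f ≡ n → ∃₂ λ k h → SlidesTo k f h × Stuck h
  reduce m n f v eq with some-bead? (m * e) (λ y → not (f y) ∧ f (y + e)) vanish
    where
    vanish : Vanishes (m * e) (λ y → not (f y) ∧ f (y + e))
    vanish y m≤y = trans (cong (not (f y) ∧_) (v (y + e) (≤-trans m≤y (m≤m+n y e)))) (∧-zeroʳ (not (f y)))
  ... | inj₂ none = 0 , f , done (λ _ → refl) , λ y fy → trans (sym (cong (λ b → not b ∧ f (y + e)) fy)) (none y)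
  reduce m n f v eq | inj₁ (y , p) = continue n eq
    where
    split : ∀ a b → not a ∧ b ≡ true → a ≡ false × b ≡ true
    split false true _ = refl , refl
    fy = proj₁ (split (f y) (f (y + e)) p)
    fye = proj₂ (split (f y) (f (y + e)) p)
    D : Drop m 1 f (slideAt y e f)
    D = slide-drop {m} v (slideAt-slides z<s fy fye)
    continue : ∀ n → totalEnergy m f ≡ n → ∃₂ λ k h → SlidesTo k f h × Stuck h
    continue zero    eq = contradiction (trans (sym (Drop.energy↓ D)) eq) λ ()
    continue (suc n) eq
      with reduce m n (slideAt y e f) (Drop.vanishes D) (suc-injective (trans (sym (Drop.energy↓ D)) eq))
    ... | k , h , slides , stuck = suc k , h , step y fy fye slides , stuck

  stuck-column : ∀ {f} → Stuck f → ∀ i t → column f i t ≡ false → column f i (suc t) ≡ false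
  stuck-column {f} stuck i t ft = trans
    (cong f (trans (cong (λ z → i + z) (+-comm e (t * e))) (sym (+-assoc i (t * e) e)))) (stuck (i + t * e) ft)

  stuck-flat : ∀ {m f} → Vanishes (m * e) f → Stuck f → ∀ i → column f i ≗ flat (count m (column f i))
  stuck-flat {m} v stuck i = flat-characterization m (column-vanishes i v) (stuck-column stuck i)

  -- A stuck runner is packed at the bottom, so its number of beads says everything about it.
  stuck-unique : ∀ {m f h} → Vanishes (m * e) f → Vanishes (m * e) h → Stuck f → Stuck h →
    charges m f ≡ charges m h → f ≗ h
  stuck-unique {m} {f} {h} v v′ s s′ eq = ≗-rows λ i t i<e → trans (stuck-flat {m} v s i t)
    (trans (cong (λ c → flat c t) (applyUpTo-injective {f = λ i → count m (column f i)} {λ i → count m (column h i)} e eq i i<e)) (sym (stuck-flat {m} v′ s′ i t)))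

  stuck-energy : ∀ {m f} → Vanishes (m * e) f → Stuck f → totalEnergy m f ≡ sum (map tri (charges m f))
  stuck-energy {m} {f} v stuck = go e (column f) λ i →
    trans (energy-cong m (λ t _ → stuck-flat {m} v stuck i t)) (energy-flat (count m (column f i)) (count≤n m (column f i)))
    where
    count≤n : ∀ n r → count n r ≤ n
    count≤n zero    r = z≤n
    count≤n (suc n) r with r 0
    ... | true  = s≤s (count≤n n (r ∘ suc))
    ... | false = m≤n⇒m≤1+n (count≤n n (r ∘ suc))
    go : ∀ n (r : ℕ → Beads) → (∀ i → energy m (r i) ≡ tri (count m (r i))) →
      sum (applyUpTo (λ i → energy m (r i)) n) ≡ sum (map tri (applyUpTo (λ i → count m (r i)) n))
    go zero    r eq = refl
    go (suc n) r eq = cong₂ _+_ (eq 0) (go n (r ∘ suc) (eq ∘ suc))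

-- From sets of integers to bead configurations.

module IntegerDifferences where
  open import Data.Integer.Base using (+_)

  ⊖-cong : ∀ {a b c d} → a + d ≡ c + b → a ⊖ b ≡ c ⊖ d
  ⊖-cong {a} {b} {c} {d} eq = begin
    a ⊖ b              ≡⟨ ℤ.+-cancelˡ-⊖ d a b ⟨
    (d + a) ⊖ (d + b)  ≡⟨ cong₂ _⊖_ (trans (+-comm d a) (trans eq (+-comm c b))) (+-comm d b) ⟩
    (b + c) ⊖ (b + d)  ≡⟨ ℤ.+-cancelˡ-⊖ b c d ⟩
    c ⊖ d              ∎
    where open ≡-Reasoning

  -- Adding `b + d` to both sides turns the two differences into natural numbers.
  ⊖-injective : ∀ {a b c d} → a ⊖ b ≡ c ⊖ d → a + d ≡ c + b
  ⊖-injective {a} {b} {c} {d} eq = ℤ.+-injective (begin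
    + (a + d)              ≡⟨ ⊖-cong {a + d} {0} {a + (b + d)} {b} (lemma a b d) ⟩
    (a + (b + d)) ⊖ b        ≡⟨ ℤ.distribˡ-⊖-+-pos (b + d) a b ⟨
    a ⊖ b ℤ.+ + (b + d)    ≡⟨ cong (ℤ._+ + (b + d)) eq ⟩
    c ⊖ d ℤ.+ + (b + d)    ≡⟨ ℤ.distribˡ-⊖-+-pos (b + d) c d ⟩
    (c + (b + d)) ⊖ d        ≡⟨ ⊖-cong {c + (b + d)} {d} {c + b} {0} (lemma′ b c d) ⟩
    + (c + b)              ∎)
    where
    open ≡-Reasoning
    lemma : ∀ a b d → a + d + b ≡ a + (b + d) + 0
    lemma = solve-∀
    lemma′ : ∀ b c d → c + (b + d) + 0 ≡ c + b + d
    lemma′ = solve-∀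

open IntegerDifferences

module Shifted (n : ℕ) where
  open import Data.Integer.Base using (+_)

  -- Position x of the abacus stands for the integer x - n, and every integer
  -- below -n is a bead.
  BeadSet : Beads → Pred ℤ 0ℓ
  BeadSet f b = ∀ x → b ≡ x ⊖ n → f x ≡ true

  position-injective : ∀ {x y} → x ⊖ n ≡ y ⊖ n → x ≡ y
  position-injective {x} {y} eq = +-cancelʳ-≡ n x y (⊖-injective {x} {n} {y} {n} eq)

  ∈-BeadSet : ∀ {f x} → f x ≡ true → x ⊖ n ∈ BeadSet f
  ∈-BeadSet {f} fx y eq = trans (cong f (sym (position-injective eq))) fx

  position : ∀ b → (∃ λ x → b ≡ x ⊖ n) ⊎ (∃ λ k → b ≡ 0 ⊖ suc k × n ≤ k)
  position (+ k)     = inj₁ (k + n , ⊖-cong {k} {0} {k + n} {n} (sym (+-identityʳ (k + n))))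
  position -[1+ k ] with n ≤? k
  ... | yes n≤k = inj₂ (k , refl , n≤k)
  ... | no n≰k  = inj₁ (n ∸ suc k , ⊖-cong {0} {suc k} {n ∸ suc k} {n} (sym (m∸n+n≡m (≰⇒> n≰k))))

  deep : ∀ {f k} → n ≤ k → 0 ⊖ suc k ∈ BeadSet f
  deep {k = k} n≤k x eq = contradiction (⊖-injective {0} {suc k} {x} {n} eq)
    (<⇒≢ (≤-trans (s≤s n≤k) (m≤n+m (suc k) x)))

  BeadSet-cong : ∀ {f h} → f ≗ h → BeadSet f ≐ BeadSet h
  BeadSet-cong eq = (λ f∈ x p → trans (sym (eq x)) (f∈ x p)) , (λ h∈ x p → trans (eq x) (h∈ x p))

  BeadSet-injective : ∀ {f h} → BeadSet f ≐ BeadSet h → f ≗ h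
  BeadSet-injective {f} {h} (f⊆h , h⊆f) x with f x in fx | h x in hx
  ... | true  | true  = refl
  ... | false | false = refl
  ... | true  | false = trans (sym (f⊆h (∈-BeadSet {f} fx) x refl)) hx
  ... | false | true  = trans (sym fx) (h⊆f (∈-BeadSet {h} hx) x refl)

  entry-of-position : ∀ m ls → length ls ≤ m → ∀ i x → entry ls i + m ≡ x + suc i → abacus m ls x ≡ true
  entry-of-position m       []       _         i       x eq = <ᵇ-true (subst (x <_) (sym eq) (m<m+n x z<s))
  entry-of-position (suc m) (l ∷ ls) (s≤s len) zero    x eq =
    trans (cong (abacus (suc m) (l ∷ ls)) (sym (suc-injective (trans (sym (+-suc l m)) (trans eq (+-comm x 1))))))
          (abacus-top m l ls)
  entry-of-position (suc m) (l ∷ ls) (s≤s len) (suc i) x eq with x ≟ l + m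
  ... | yes _ = refl
  ... | no _  = entry-of-position m ls len i x
    (suc-injective (trans (sym (+-suc (entry ls i) m)) (trans eq (+-suc x (suc i)))))

  position-of-entry : ∀ m ls → ∀ x → abacus m ls x ≡ true → ∃ λ i → entry ls i + m ≡ x + suc i
  position-of-entry m       []       x fx = m ∸ suc x , (begin
    m                    ≡⟨ m+[n∸m]≡n (<ᵇ-true⁻¹ {x} {m} fx) ⟨
    suc x + (m ∸ suc x)  ≡⟨ +-suc x (m ∸ suc x) ⟨
    x + suc (m ∸ suc x)  ∎)
    where open ≡-Reasoning
  position-of-entry (suc m) (l ∷ ls) x fx with x ≟ l + m
  ... | yes refl = 0 , trans (+-suc l m) (+-comm 1 (l + m))
  ... | no _ with position-of-entry m ls x fx
  ...   | i , eq = suc i , trans (+-suc (entry ls i) m) (trans (cong suc eq) (sym (+-suc x (suc i))))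

  entry-past-end : ∀ ls i → length ls ≤ i → entry ls i ≡ 0
  entry-past-end []       i       _         = refl
  entry-past-end (l ∷ ls) (suc i) (s≤s len) = entry-past-end ls i len

  β-set≐ : ∀ p → length (parts p) ≤ n → β-set p ≐ BeadSet (abacus n (parts p))
  β-set≐ p len = to , from
    where
    to : ∀ {b} → b ∈ β-set p → b ∈ BeadSet (abacus n (parts p))
    to (suc j , _ , refl) x eq = entry-of-position n (parts p) len j x
      (⊖-injective {entry (parts p) j} {suc j} {x} {n} (trans (sym (ℤ.[+m]-[+n]≡m⊖n (entry (parts p) j) (suc j))) eq))
    from : ∀ {b} → b ∈ BeadSet (abacus n (parts p)) → b ∈ β-set p
    from {b} b∈ with position b
    ... | inj₁ (x , refl) with position-of-entry n (parts p) x (b∈ x refl)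
    ...   | i , eq = suc i , z<s , trans (⊖-cong {x} {n} {entry (parts p) i} {suc i} (sym eq))
                       (sym (ℤ.[+m]-[+n]≡m⊖n (entry (parts p) i) (suc i)))
    -- The integer lies below all positions of the abacus; it is the element of row `suc k`, a zero
    -- row because `n ≤ k`.
    from b∈ | inj₂ (k , refl , n≤k) = suc k , z<s ,
      cong (λ l → + l ℤ.- + suc k) (sym (entry-past-end (parts p) k (≤-trans len n≤k)))

  module Moves (d e′ : ℕ) where
    open Abacus d e′ using (e)
    open Slides d e′

    raise : ∀ y → (y + e) ⊖ n ℤ.- + e ≡ y ⊖ n
    raise y = begin
      (y + e) ⊖ n ℤ.- + e            ≡⟨ cong (ℤ._- + e) (ℤ.distribˡ-⊖-+-pos e y n) ⟨
      y ⊖ n ℤ.+ + e ℤ.- + e          ≡⟨ ℤ.+-assoc (y ⊖ n) (+ e) (ℤ.- + e) ⟩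
      y ⊖ n ℤ.+ (+ e ℤ.- + e)        ≡⟨ cong (λ z → y ⊖ n ℤ.+ z) (ℤ.+-inverseʳ (+ e)) ⟩
      y ⊖ n ℤ.+ + 0                  ≡⟨ ℤ.+-identityʳ (y ⊖ n) ⟩
      y ⊖ n                          ∎
      where open ≡-Reasoning

    lower : ∀ b y → b ℤ.- + e ≡ y ⊖ n → b ≡ (y + e) ⊖ n
    lower b y eq = begin
      b                              ≡⟨ ℤ.+-identityʳ b ⟨
      b ℤ.+ + 0                      ≡⟨ cong (λ z → b ℤ.+ z) (ℤ.+-inverseˡ (+ e)) ⟨
      b ℤ.+ (ℤ.- + e ℤ.+ + e)        ≡⟨ ℤ.+-assoc b (ℤ.- + e) (+ e) ⟨
      b ℤ.- + e ℤ.+ + e              ≡⟨ cong (ℤ._+ + e) eq ⟩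
      y ⊖ n ℤ.+ + e                  ≡⟨ ℤ.distribˡ-⊖-+-pos e y n ⟩
      (y + e) ⊖ n                    ∎
      where open ≡-Reasoning

    moved-set : ∀ {X : Pred ℤ 0ℓ} {f y b c} → X ≐ BeadSet f → f y ≡ false → f (y + e) ≡ true → b ≡ (y + e) ⊖ n → c ≡ y ⊖ n →
      ((X ∖ ｛ b ｝) ∪ ｛ c ｝) ≐ BeadSet (slideAt y e f)
    moved-set {X} {f} {y} (X⊆f , f⊆X) fy fye refl refl = to , from
      where
      open Slide (slideAt-slides {y} {e} {f} z<s fy fye)
      to : ∀ {z} → z ∈ ((X ∖ ｛ (y + e) ⊖ n ｝) ∪ ｛ y ⊖ n ｝) → z ∈ BeadSet (slideAt y e f)
      to (inj₂ refl) = ∈-BeadSet {slideAt y e f} bead-after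
      to (inj₁ (z∈ , z≢)) x eq = decide (x ≟ y)
        where
        decide : Dec (x ≡ y) → slideAt y e f x ≡ true
        decide (yes refl) = bead-after
        decide (no x≢y)   = trans (sym (elsewhere x x≢y λ { refl → z≢ (sym eq) })) (X⊆f z∈ x eq)
      from : ∀ {z} → z ∈ BeadSet (slideAt y e f) → z ∈ ((X ∖ ｛ (y + e) ⊖ n ｝) ∪ ｛ y ⊖ n ｝)
      from {z} z∈ with y ⊖ n ℤ.≟ z
      ... | yes eq = inj₂ eq
      ... | no y≢  = inj₁ (f⊆X z∈f , λ eq → contradiction (trans (sym (z∈ (y + e) (sym eq))) gap-after) λ ())
        where
        z∈f : z ∈ BeadSet f
        z∈f x eq = trans (elsewhere x (λ { refl → y≢ (sym eq) })
          λ { refl → contradiction (trans (sym (z∈ (y + e) eq)) gap-after) λ () }) (z∈ x eq)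

    -- The target of a move is unoccupied, and all integers below `- n` are occupied. Hence the
    -- target is a position of the abacus, and so is the source, `e` places above it.
    move⇒slide : ∀ {X Y f} → X ≐ BeadSet f → Move e X Y →
      ∃ λ y → f y ≡ false × f (y + e) ≡ true × Y ≐ BeadSet (slideAt y e f)
    move⇒slide {X} {Y} {f} X≐@(X⊆f , f⊆X) (b , b∈ , c∉ , Y≐) with position (b ℤ.- + e)
    ... | inj₂ (k , eq , n≤k) = contradiction (f⊆X (subst (_∈ BeadSet f) (sym eq) (deep {f} n≤k))) c∉
    ... | inj₁ (y , eq) = y , fy , fye , ≐-trans Y≐ (moved-set X≐ fy fye b≡ eq)
      where
      b≡ : b ≡ (y + e) ⊖ n
      b≡ = lower b y eq
      fye : f (y + e) ≡ true
      fye = X⊆f b∈ (y + e) b≡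
      fy : f y ≡ false
      fy with f y in p
      ... | false = refl
      ... | true  = contradiction (f⊆X (subst (_∈ BeadSet f) (sym eq) (∈-BeadSet {f} p))) c∉

    slide⇒move : ∀ {X f} y → X ≐ BeadSet f → f y ≡ false → f (y + e) ≡ true → Move e X (BeadSet (slideAt y e f))
    slide⇒move {X} {f} y X≐@(X⊆f , f⊆X) fy fye = (y + e) ⊖ n , f⊆X (∈-BeadSet {f} fye) ,
      (λ c∈ → contradiction (trans (sym (X⊆f c∈ y (raise y))) fy) λ ()) , ≐-sym (moved-set X≐ fy fye refl (raise y))

    star⇒slides : ∀ {X Z f} → X ≐ BeadSet f → Star (Move e) X Z → ∃₂ λ k h → SlidesTo k f h × Z ≐ BeadSet h
    star⇒slides {f = f} X≐ ε = 0 , f , done (λ _ → refl) , X≐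
    star⇒slides X≐ (m ◅ ms) with move⇒slide X≐ m
    ... | y , fy , fye , Y≐ with star⇒slides Y≐ ms
    ...   | k , h , slides , Z≐ = suc k , h , step y fy fye slides , Z≐

    slides⇒star : ∀ {k X f h} → X ≐ BeadSet f → SlidesTo k f h → ∃ λ Z → Star (Move e) X Z × Z ≐ BeadSet h
    slides⇒star {X = X} X≐ (done eq) = X , ε , ≐-trans X≐ (BeadSet-cong eq)
    slides⇒star {X = X} X≐ (step y fy fye slides) with slides⇒star (id , id) slides
    ... | Z , ms , Z≐ = Z , slide⇒move y X≐ fy fye ◅ ms , Z≐

    normal⇒stuck : ∀ {X f} → X ≐ BeadSet f → IsNormalForm (Move e) X → Stuck f
    normal⇒stuck {f = f} X≐ normal y fy with f (y + e) in fye
    ... | false = refl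
    ... | true  = contradiction (_ , slide⇒move y X≐ fy fye) normal

    stuck⇒normal : ∀ {X f} → X ≐ BeadSet f → Stuck f → IsNormalForm (Move e) X
    stuck⇒normal X≐ stuck (Y , m) with move⇒slide X≐ m
    ... | y , fy , fye , _ = contradiction (trans (sym (stuck y fy)) fye) λ ()

-- Blocks of partitions and configurations

module _ {a b p q} {A : Set a} {B : Set b} {P : Pred A p} {Q : Pred B q}
         (I : Inverse (SubSetoid (setoid A) P) (SubSetoid (setoid B) Q)) where

  open Inverse I

  pullback : ∀ ys → All Q ys → List A
  pullback []       []       = []
  pullback (y ∷ ys) (q ∷ qs) = proj₁ (from (y , q)) ∷ pullback ys qs

  pullback-length : ∀ ys qs → length (pullback ys qs) ≡ length ys
  pullback-length []       []       = refl
  pullback-length (y ∷ ys) (q ∷ qs) = cong suc (pullback-length ys qs)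

  from-injective : ∀ {x y} → proj₁ (from x) ≡ proj₁ (from y) → proj₁ x ≡ proj₁ y
  from-injective {x} {y} eq =
    trans (sym (strictlyInverseˡ x)) (trans (to-cong {from x} {from y} eq) (strictlyInverseˡ y))

  pullback-unique : ∀ {ys} → Unique ys → ∀ qs → Unique (pullback ys qs)
  pullback-unique []      []       = []
  pullback-unique (p ∷ u) (q ∷ qs) = distinct p qs ∷ pullback-unique u qs
    where
    distinct : ∀ {y q ys} → All (y ≢_) ys → ∀ qs → All (proj₁ (from (y , q)) ≢_) (pullback ys qs)
    distinct []       []       = []
    distinct (p ∷ ps) (q ∷ qs) = (p ∘ from-injective) ∷ distinct ps qs

  ∈-pullback⁻ : ∀ ys qs {x} → x ∈ˡ pullback ys qs → P x
  ∈-pullback⁻ (y ∷ ys) (q ∷ qs) (here refl) = proj₂ (from (y , q))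
  ∈-pullback⁻ (y ∷ ys) (q ∷ qs) (there x∈)  = ∈-pullback⁻ ys qs x∈

  ∈-pullback⁺ : ∀ ys qs x → proj₁ (to x) ∈ˡ ys → proj₁ x ∈ˡ pullback ys qs
  ∈-pullback⁺ (y ∷ ys) (q ∷ qs) x (here eq)  = here (sym (inverseʳ {x} {y , q} (sym eq)))
  ∈-pullback⁺ (y ∷ ys) (q ∷ qs) x (there y∈) = there (∈-pullback⁺ ys qs x y∈)

  -- The equality of a `SubSetoid` ignores the membership proofs, so `from` stays injective on
  -- underlying elements whichever proofs are attached to the listed ones.
  cardinality-pullback : ∀ {n} → HasCardinality Q n → HasCardinality P n
  cardinality-pullback (ys , unique , members , len) =
    pullback ys qs , pullback-unique unique qs ,
    (λ x → mk⇔ (∈-pullback⁻ ys qs)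
      (λ px → ∈-pullback⁺ ys qs (x , px) (Equivalence.from (members _) (proj₂ (to (x , px)))))) ,
    trans (pullback-length ys qs) len
    where
    qs : All Q ys
    qs = All.tabulate (λ {y} y∈ → Equivalence.to (members y) y∈)

length≤sum : ∀ {ls} → All (0 <_) ls → length ls ≤ sum ls
length≤sum []       = z≤n
length≤sum (p ∷ ps) = +-mono-≤ p (length≤sum ps)

head≤sum : ∀ ls → entry ls 0 ≤ sum ls
head≤sum []       = z≤n
head≤sum (l ∷ ls) = m≤m+n l (sum ls)

abacus-below : ∀ n ls x → x + length ls < n → abacus n ls x ≡ true
abacus-below n       []       x x< = <ᵇ-true (subst (_< n) (+-identityʳ x) x<)
abacus-below (suc n) (l ∷ ls) x x< with x ≟ l + n
... | yes _ = refl
... | no _  = abacus-below n ls x (s<s⁻¹ (subst (_< suc n) (+-suc x (length ls)) x<))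

-- The balanced partitions of one block as balanced configurations.

module CoreBlock (d e′ w : ℕ) (1<d : 1 < d) (γ : Partition) (core : IsCore (2 + e′) γ) where
  open Abacus d e′
  open Slides d e′

  -- n bounds the number of parts of every partition in the block, and it makes
  -- every charge of the core at least w.
  n m : ℕ
  n = size γ + w * e
  m = n + n

  open Shifted n
  open Moves d e′

  abacusOf : Partition → Beads
  abacusOf p = abacus n (parts p)

  Γ : Beads
  Γ = abacusOf γ

  cs : List ℕ
  cs = charges m Γ

  small-length : ∀ p → size p ≤ n → length (parts p) ≤ n
  small-length p small = ≤-trans (length≤sum (positive p)) small

  small-bound : ∀ p → size p ≤ n → entry (parts p) 0 + n ≤ m * e
  small-bound p small = ≤-trans (+-monoˡ-≤ n (≤-trans (head≤sum (parts p)) small)) (m≤m*n m e)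

  small-vanishes : ∀ p → size p ≤ n → Vanishes (m * e) (abacusOf p)
  small-vanishes p small = vanishes-mono (small-bound p small) (abacus-vanishes n (parts p) (sorted p))

  small-energy : ∀ p → size p ≤ n → energy (m * e) (abacusOf p) ≡ size p + tri n
  small-energy p small =
    proj₂ (abacus-totals n (parts p) (m * e) (sorted p) (small-length p small) (small-bound p small))

  γ-small : size γ ≤ n
  γ-small = m≤m+n (size γ) (w * e)

  Γ-vanishes : Vanishes (m * e) Γ
  Γ-vanishes = small-vanishes γ γ-small

  γ≐ : β-set γ ≐ BeadSet Γ
  γ≐ = β-set≐ γ (small-length γ γ-small)

  Γ-stuck : Stuck Γ
  Γ-stuck = let _ , _ , normal , X≐ = core in normal⇒stuck (≐-trans X≐ γ≐) normal

  slides-≗ : ∀ {k f g h} → SlidesTo k f g → g ≗ h → SlidesTo k f h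
  slides-≗ (done eq)            eq′ = done (λ x → trans (eq x) (eq′ x))
  slides-≗ (step y fy fye rest) eq′ = step y fy fye (slides-≗ rest eq′)

  block-small : ∀ p → Block e γ w p → size p ≤ n
  block-small p (_ , eq) = ≤-reflexive eq

  -- The number `k` of slides down to the core is measured on the line, where `k * e` is the
  -- difference of the sizes, so `k ≡ w`. Measured on the runners, it is the excess energy over the
  -- core.
  block⇒inBlock : ∀ p → Block e γ w p → InBlockAt m cs w (abacusOf p)
  block⇒inBlock p B@((X , star , _ , X≐) , size≡)
    with star⇒slides (β-set≐ p (small-length p (block-small p B))) star
  ... | k , h , slides , X≐h = inBlockAt (small-vanishes p small) charge (begin
    totalEnergy m (abacusOf p)  ≡⟨ energy↓ ⟩
    k + totalEnergy m Γ         ≡⟨ cong₂ _+_ k≡w (stuck-energy {m} Γ-vanishes Γ-stuck) ⟩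
    w + sum (map tri cs)        ≡⟨ +-comm w _ ⟩
    sum (map tri cs) + w        ∎)
    where
    open ≡-Reasoning
    small : size p ≤ n
    small = block-small p B
    D : Drop m k (abacusOf p) Γ
    D = slides-drop {m} (small-vanishes p small)
          (slides-≗ slides (BeadSet-injective (≐-trans (≐-sym X≐h) (≐-trans X≐ γ≐))))
    open Drop D
    k≡w : k ≡ w
    k≡w = *-cancelʳ-≡ k w e (+-cancelʳ-≡ (size γ + tri n) _ _ (begin
      k * e + (size γ + tri n)           ≡⟨ cong (k * e +_) (small-energy γ γ-small) ⟨
      k * e + energy (m * e) Γ           ≡⟨ energyᶠ↓ ⟨
      energy (m * e) (abacusOf p)        ≡⟨ small-energy p small ⟩
      size p + tri n                     ≡⟨ cong (_+ tri n) size≡ ⟩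
      size γ + w * e + tri n             ≡⟨ lemma (size γ) (w * e) (tri n) ⟩
      w * e + (size γ + tri n)           ∎))
      where
      lemma : ∀ a b c → a + b + c ≡ b + (a + c)
      lemma = solve-∀

  module FromBlock {m₀ f} (b₀ : InBlockAt m₀ cs w f) where

    -- A cut-off that is large enough for `f` and for the core at once, so that their charges can be
    -- compared.
    M : ℕ
    M = m₀ + m

    b : InBlockAt M cs w f
    b = extend-block m b₀

    open InBlockAt b

    Γ-vanishesᴹ : Vanishes (M * e) Γ
    Γ-vanishesᴹ = vanishes-mono (*-monoˡ-≤ e (m≤n+m m m₀)) Γ-vanishes

    charges-Γ : charges M Γ ≡ cs
    charges-Γ = applyUpTo-cong e λ i _ →
      count-unique (column-vanishes {M} i Γ-vanishesᴹ) (column-vanishes {m} i Γ-vanishes) (λ _ → refl)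

    -- Sliding preserves charges, and a stuck configuration with the charges of `Γ` can only be `Γ`.
    reduction : ∃ λ k → SlidesTo k f Γ
    reduction with reduce M _ f vanishes refl
    ... | k , h , slides , stuck = k , slides-≗ slides
      (stuck-unique {M} (Drop.vanishes D) Γ-vanishesᴹ stuck Γ-stuck
        (trans (sym (Drop.charge D)) (trans charges≡ (sym charges-Γ))))
      where
      D : Drop M k f h
      D = slides-drop {M} vanishes slides

    k = proj₁ reduction
    slides = proj₂ reduction

    D : Drop M k f Γ
    D = slides-drop {M} vanishes slides

    k≡w : k ≡ w
    k≡w = +-cancelʳ-≡ (sum (map tri cs)) _ _ (begin
      k + sum (map tri cs)              ≡⟨ cong (λ cs → k + sum (map tri cs)) charges-Γ ⟨
      k + sum (map tri (charges M Γ))   ≡⟨ cong (k +_) (stuck-energy {M} Γ-vanishesᴹ Γ-stuck) ⟨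
      k + totalEnergy M Γ               ≡⟨ Drop.energy↓ D ⟨
      totalEnergy M f                   ≡⟨ energy≡ ⟩
      sum (map tri cs) + w              ≡⟨ +-comm _ w ⟩
      w + sum (map tri cs)              ∎)
      where open ≡-Reasoning

    totals-Γ : count (M * e) Γ ≡ n × energy (M * e) Γ ≡ size γ + tri n
    totals-Γ = abacus-totals n (parts γ) (M * e) (sorted γ) (small-length γ γ-small)
      (≤-trans (small-bound γ γ-small) (*-monoˡ-≤ e (m≤n+m m m₀)))

    count≡n : count (M * e) f ≡ n
    count≡n = trans (Drop.beads D) (proj₁ totals-Γ)

    partition : Partition
    partition = partitionOf f (M * e)

    length≤n : length (parts partition) ≤ n
    length≤n = subst (length (parts partition) ≤_) count≡n (partsOf-length f (M * e))

    abacus-partition : abacusOf partition ≗ f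
    abacus-partition = subst (λ n → abacus n (parts partition) ≗ f) count≡n (abacus-partitionOf vanishes)

    size-partition : size partition ≡ size γ + w * e
    size-partition = +-cancelʳ-≡ (tri n) _ _ (begin
      size partition + tri n              ≡⟨ proj₂ (abacus-totals n (parts partition) (M * e) (sorted partition) length≤n bound) ⟨
      energy (M * e) (abacusOf partition) ≡⟨ energy-cong (M * e) (λ t _ → abacus-partition t) ⟩
      energy (M * e) f                    ≡⟨ Drop.energyᶠ↓ D ⟩
      k * e + energy (M * e) Γ            ≡⟨ cong₂ (λ k E → k * e + E) k≡w (proj₂ totals-Γ) ⟩
      w * e + (size γ + tri n)            ≡⟨ lemma (w * e) (size γ) (tri n) ⟩
      size γ + w * e + tri n              ∎)
      where
      open ≡-Reasoning
      bound : entry (parts partition) 0 + n ≤ M * e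
      bound = subst (entry (parts partition) 0 + n ≤_)
        (trans (+-comm (gaps f (M * e)) n) (trans (cong (_+ gaps f (M * e)) (sym count≡n)) (count+gaps (M * e) f)))
        (+-monoˡ-≤ n (partsOf-head f (M * e)))
      lemma : ∀ a b c → a + (b + c) ≡ b + a + c
      lemma = solve-∀

    partition-core : IsCoreOf e γ partition
    partition-core with slides⇒star (≐-trans (β-set≐ partition length≤n) (BeadSet-cong abacus-partition)) slides
    ... | Z , star , Z≐ = Z , star , stuck⇒normal Z≐ Γ-stuck , ≐-trans Z≐ (≐-sym γ≐)

    partition-block : Block e γ w partition
    partition-block = partition-core , size-partition

  abacusOf-injective : ∀ p q → length (parts p) ≤ n → length (parts q) ≤ n → abacusOf p ≗ abacusOf q → p ≡ q
  abacusOf-injective p q lp lq eq = parts-injective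
    (abacus-injective n (parts p) (parts q) (sorted p) (sorted q) (positive p) (positive q) lp lq eq)

  balanced-≗ : ∀ {f h} → f ≗ h → Balancedᶠ f → Balancedᶠ h
  balanced-≗ eq bal x k hx hy = subst₂ (λ y z → y ≋ suc z)
    (gaps-cong (x + k * e) (λ t _ → eq t)) (gaps-cong x (λ t _ → eq t))
    (bal x k (trans (eq x) hx) (trans (eq (x + k * e)) hy))

  blockSetoid : Setoid _ _
  blockSetoid = SubSetoid (setoid Partition) (Block e γ w ∩ Balanced d e)

  toConfig : Setoid.Carrier blockSetoid → Setoid.Carrier (Config cs w)
  toConfig (p , B , bal) = abacusOf p , (m , block⇒inBlock p B) ,
    BalancedPartitions.balanced⇒abacus d e′ n p (small-length p (block-small p B)) bal

  fromConfig : Setoid.Carrier (Config cs w) → Setoid.Carrier blockSetoid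
  fromConfig (f , (m₀ , b₀) , bal) = partition , partition-block ,
    BalancedPartitions.abacus⇒balanced d e′ n partition length≤n
      (balanced-≗ (λ x → sym (abacus-partition x)) bal)
    where open FromBlock b₀

  block-↔ : Inverse blockSetoid (Config cs w)
  block-↔ = record
    { to        = toConfig
    ; from      = fromConfig
    ; to-cong   = λ { refl x → refl }
    ; from-cong = λ { {_ , (_ , b) , _} {_ , (_ , b′) , _} eq →
        abacusOf-injective _ _ (FromBlock.length≤n b) (FromBlock.length≤n b′)
          (λ x → trans (FromBlock.abacus-partition b x) (trans (eq x) (sym (FromBlock.abacus-partition b′ x)))) }
    ; inverse   = (λ { {_ , (_ , b) , _} refl x → FromBlock.abacus-partition b x })
                , (λ { {p , B , _} {_ , (_ , b) , _} eq →
        abacusOf-injective _ p (FromBlock.length≤n b) (small-length p (block-small p B))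
          (λ x → trans (FromBlock.abacus-partition b x) (eq x)) })
    }

  open Separated d e′ w 1<d using (separatedCharges; charge; zone; separated-↔)
  open Rotation d e′ 1<d using (all-charges-equivalent; _~[_]_)

  -- The abacus of `γ` is full below position `n ∸ length (parts γ)`. By the choice of `n` this is
  -- at least `w * e`, so every runner has beads in its first `w` rows.
  cs≥w : All (w ≤_) cs
  cs≥w = All.applyUpTo⁺₁ (λ i → count m (column Γ i)) e λ {i} i<e →
    subst (_≤ count m (column Γ i)) (count-flat w w≤m) (count-mono m λ t t<w →
      abacus-below n (parts γ) (i + t * e) (position< (<ᵇ-true⁻¹ t<w) i<e))
    where
    w≤m : w ≤ m
    w≤m = ≤-trans (m≤m*n w e) (≤-trans (m≤n+m (w * e) (size γ)) (m≤m+n n n))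
    position< : ∀ {t i} → t < w → i < e → i + t * e + length (parts γ) < n
    position< {t} {i} t<w i<e = begin-strict
      i + t * e + length (parts γ)  <⟨ +-monoˡ-< (length (parts γ)) (+-monoˡ-< (t * e) i<e) ⟩
      suc t * e + length (parts γ)  ≤⟨ +-mono-≤ (*-monoˡ-≤ e t<w) (length≤sum (positive γ)) ⟩
      w * e + size γ                ≡⟨ +-comm (w * e) (size γ) ⟩
      n                             ∎
      where open ≤-Reasoning

  separated : cs ~[ w ] separatedCharges
  separated = all-charges-equivalent cs separatedCharges
    (trans (length-applyUpTo (λ i → count m (column Γ i)) e) (sym (length-applyUpTo charge e)))
    cs≥w (All.applyUpTo⁺₁ charge e λ {k} _ → m≤n+m w (zone k))

  block-cardinality : .{{_ : NonZero d}} →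
    HasCardinality (Block e γ w ∩ Balanced d e) ((w + suc e′ / d) C w)
  block-cardinality = cardinality-pullback
    (Compose.inverse block-↔ (Compose.inverse separated separated-↔))
    (Enumeration.compositions-cardinality d (suc e′) w)

corollary5p8 : (d e w : ℕ) .{{_ : NonZero d}} → 1 < d → 1 < e →
    (γ : Partition) → IsCore e γ →
    HasCardinality (Block e γ w ∩ Balanced d e) ((w + (e ∸ 1) / d) C w)
corollary5p8 d (suc (suc e′)) w 1<d (s≤s (s≤s z≤n)) γ core = CoreBlock.block-cardinality d e′ w 1<d γ core
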